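{- Let $G$ be a finite simple graph and $\theta$ a real number. Let $Q_1,\dots,Q_m$ be all the connected components $Q$ of $G\setminus A_\theta(G)$ with $\textnormal{mult}(\theta,Q)=0$. Then for distinct $u,v\in V(G)$, $uv\in E(D_{2,\theta}(S_\theta(G)))$ if and only if (a) $u,v\in A_\theta(G)$, or (b) one of $u,v$ lies in $A_\theta(G)$ and the other in $P_\theta(G)$, or (c) $u,v\in P_\theta(G)$ with $u\in V(Q_{j_1})$ and $v\in V(Q_{j_2})$ for some $j_1\neq j_2$, or (d) $uv\in E(D_{2,\theta}(Q_{j_0}))$ for some $j_0$.
   Context: $\mu(G,x)=\sum_{r\ge 0}(-1)^r p(G,r)x^{|V(G)|-2r}$ is the matching polynomial ($p(G,r)$ = number of $r$-matchings, $p(G,0)=1$, empty graph has $\mu=1$); $\textnormal{mult}(\theta,G)$ is the multiplicity of $\theta$ as a root of $\mu(G,x)$ ($0$ if not a root). $G\setminus X$, $G\setminus uv$ denote vertex deletion. A vertex $u$ is $\theta$-essential if $\textnormal{mult}(\theta,G\setminus u)=\textnormal{mult}(\theta,G)-1$, $\theta$-positive if $\textnormal{mult}(\theta,G\setminus u)=\textnormal{mult}(\theta,G)+1$, and $\theta$-special if it is not $\theta$-essential but adjacent to a $\theta$-essential vertex. $A_\theta(G)$ is the set of $\theta$-special vertices and $P_\theta(G)$ is the set of $\theta$-positive vertices that are not $\theta$-special. $S_\theta(G)$ is the graph on $V(G)$ in which distinct $w,z$ are adjacent iff $wz\in E(G)$ or one of $w,z$ is in $A_\theta(G)$. For a graph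 $F$ and $r\in\{ -2,-1,0,1,2\}$, $D_{r,\theta}(F)$ is the graph on $V(F)$ in which distinct $u,v$ are adjacent iff $\textnormal{mult}(\theta,F\setminus uv)=\textnormal{mult}(\theta,F)+r$. -}

module Defs where

open import Level using (Level; _⊔_) renaming (suc to lsuc)
open import Algebra.Bundles using (CommutativeRing)
open import Relation.Binary.Core using (Rel)
open import Relation.Binary.Structures using (IsTotalOrder)
open import Data.Nat as ℕ using (ℕ; zero; suc; _∸_; _≤?_)
open import Data.Bool using (Bool; true; false; _∨_; _∧_; not; if_then_else_)
open import Data.Fin using (Fin; toℕ; _≟_)
open import Data.Fin.Subset using (Subset; _∈_; _∉_; ∣_∣; _─_; ⁅_⁆; ⊤)
open import Data.Vec using (lookup)
open import Data.List using (List; []; _∷_; map; foldr; length; filter; concatMap; upTo; allFin; _++_)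
open import Data.Product using (_×_; _,_; ∃; Σ)
open import Data.Sum using (_⊎_)
open import Relation.Nullary using (¬_; Dec; yes; no; does)
open import Relation.Binary.PropositionalEquality using (_≡_; _≢_)

-- The real numbers: a complete ordered field (unique up to isomorphism).
-- All notions below are stated for an arbitrary such structure R.

record RealField (ℓ : Level) : Set (lsuc ℓ) where
  field
    commutativeRing : CommutativeRing ℓ ℓ
  open CommutativeRing commutativeRing public
  field
    _≤_          : Rel Carrier ℓ
    isTotalOrder : IsTotalOrder _≈_ _≤_
    0≉1          : ¬ (0# ≈ 1#)
    inverse      : ∀ x → ¬ (x ≈ 0#) → ∃ λ y → x * y ≈ 1#
    +-mono-≤     : ∀ {x y} z → x ≤ y → (x + z) ≤ (y + z)
    *-nonneg     : ∀ {x y} → 0# ≤ x → 0# ≤ y → 0# ≤ (x * y)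
    complete     : (P : Carrier → Set ℓ) → (∃ λ x → P x) →
                   (∃ λ b → ∀ x → P x → x ≤ b) →
                   ∃ λ s → (∀ x → P x → x ≤ s) ×
                           (∀ b → (∀ x → P x → x ≤ b) → s ≤ b)

-- Polynomials over R: coefficient lists, lowest degree first.

module Poly {ℓ : Level} (R : RealField ℓ) where
  open RealField R

  Pol : Set ℓ
  Pol = List Carrier

  coeff : Pol → ℕ → Carrier
  coeff []       _       = 0#
  coeff (a ∷ p)  zero    = a
  coeff (a ∷ p)  (suc i) = coeff p i

  _≈ₚ_ : Pol → Pol → Set ℓ
  p ≈ₚ q = ∀ i → coeff p i ≈ coeff q i

  _+ₚ_ : Pol → Pol → Pol
  []      +ₚ q       = q
  (a ∷ p) +ₚ []      = a ∷ p
  (a ∷ p) +ₚ (b ∷ q) = (a + b) ∷ (p +ₚ q)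

  scale : Carrier → Pol → Pol
  scale c = map (c *_)

  _*ₚ_ : Pol → Pol → Pol
  []      *ₚ q = []
  (a ∷ p) *ₚ q = scale a q +ₚ (0# ∷ (p *ₚ q))

  _^ₚ_ : Pol → ℕ → Pol
  p ^ₚ zero  = 1# ∷ []
  p ^ₚ suc k = p *ₚ (p ^ₚ k)

  monomial : ℕ → Carrier → Pol
  monomial zero    c = c ∷ []
  monomial (suc d) c = 0# ∷ monomial d c

  _∣ₚ_ : Pol → Pol → Set ℓ
  d ∣ₚ p = ∃ λ q → (d *ₚ q) ≈ₚ p

  lin : Carrier → Pol
  lin θ = (- θ) ∷ 1# ∷ []

  Mult : Carrier → Pol → ℕ → Set ℓ
  Mult θ p k = ((lin θ ^ₚ k) ∣ₚ p) × ¬ ((lin θ ^ₚ suc k) ∣ₚ p)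

  fromℕ : ℕ → Carrier
  fromℕ zero    = 0#
  fromℕ (suc n) = 1# + fromℕ n

  sign : ℕ → Carrier
  sign zero    = 1#
  sign (suc r) = - sign r

-- Graphs on vertex set Fin n, given by a Boolean adjacency relation.
-- Subgraphs appearing in the statement are induced subgraphs G[X],
-- X : Subset n; vertex deletion G ∖ Y is G[V ∖ Y].

Graph : ℕ → Set
Graph n = Fin n → Fin n → Bool

SimpleGraph : ∀ {n} → Graph n → Set
SimpleGraph {n} G = (∀ i j → G i j ≡ G j i) × (∀ i → G i i ≡ false)

allPairs : (n : ℕ) → List (Fin n × Fin n)
allPairs n = concatMap (λ i → map (λ j → (i , j))
                          (filter (λ j → toℕ i ℕ.<? toℕ j) (allFin n)))
                       (allFin n)

sublists : ∀ {A : Set} → List A → List (List A)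
sublists []       = [] ∷ []
sublists (x ∷ xs) = let s = sublists xs in s ++ map (x ∷_) s

elemᵇ : ∀ {n} → Fin n → List (Fin n) → Bool
elemᵇ x []       = false
elemᵇ x (y ∷ ys) = does (x ≟ y) ∨ elemᵇ x ys

noDupᵇ : ∀ {n} → List (Fin n) → Bool
noDupᵇ []       = true
noDupᵇ (x ∷ xs) = not (elemᵇ x xs) ∧ noDupᵇ xs

allᵇ : ∀ {A : Set} → (A → Bool) → List A → Bool
allᵇ f []       = true
allᵇ f (x ∷ xs) = f x ∧ allᵇ f xs

endpoints : ∀ {n} → List (Fin n × Fin n) → List (Fin n)
endpoints = concatMap (λ e → Data.Product.proj₁ e ∷ Data.Product.proj₂ e ∷ [])

isMatchingᵇ : ∀ {n} → Graph n → Subset n → ℕ → List (Fin n × Fin n) → Bool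
isMatchingᵇ G X r E =
  allᵇ (λ e → G (Data.Product.proj₁ e) (Data.Product.proj₂ e)
              ∧ lookup X (Data.Product.proj₁ e) ∧ lookup X (Data.Product.proj₂ e)) E
  ∧ noDupᵇ (endpoints E)
  ∧ does (length E ℕ.≟ r)

numMatchings : ∀ {n} → Graph n → Subset n → ℕ → ℕ
numMatchings {n} G X r =
  length (filter (λ E → isMatchingᵇ G X r E ≡? true) (sublists (allPairs n)))
  where
    _≡?_ : (a b : Bool) → Dec (a ≡ b)
    _≡?_ = Data.Bool._≟_

-- S_θ(G), given the set A = A_θ(G) as a subset.

SGraph : ∀ {n} → Graph n → Subset n → Graph n
SGraph G A w z = not (does (w ≟ z)) ∧ (G w z ∨ lookup A w ∨ lookup A z)

data Reach {n : ℕ} (G : Graph n) (X : Subset n) : Fin n → Fin n → Set where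
  here : ∀ {u} → u ∈ X → Reach G X u u
  step : ∀ {u w v} → u ∈ X → G u w ≡ true → Reach G X w v → Reach G X u v

IsComponent : ∀ {n} → Graph n → Subset n → Subset n → Set
IsComponent {n} G A X =
  (∃ λ u → u ∈ X) ×
  (∀ u → u ∈ X → u ∉ A) ×
  (∀ u v → u ∈ X → v ∈ X → Reach G X u v) ×
  (∀ u w → u ∈ X → w ∉ A → G u w ≡ true → w ∈ X)

module Matching {ℓ : Level} (R : RealField ℓ) where
  open RealField R
  open Poly R public

  μ : ∀ {n} → Graph n → Subset n → Pol
  μ G X = foldr _+ₚ_ []
            (map (λ r → if does (2 ℕ.* r ≤? ∣ X ∣)
                          then monomial (∣ X ∣ ∸ 2 ℕ.* r)
                                        (sign r * fromℕ (numMatchings G X r))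
                          else [])
                 (upTo (suc ∣ X ∣)))

  MultIs : ∀ {n} → Carrier → Graph n → Subset n → ℕ → Set ℓ
  MultIs θ G X k = Mult θ (μ G X) k

  module _ {n : ℕ} (θ : Carrier) (G : Graph n) where

    Essential : Fin n → Set ℓ
    Essential u = ∃ λ k → ∃ λ l →
      MultIs θ G ⊤ k × MultIs θ G (⊤ ─ ⁅ u ⁆) l × suc l ≡ k

    Positive : Fin n → Set ℓ
    Positive u = ∃ λ k → ∃ λ l →
      MultIs θ G ⊤ k × MultIs θ G (⊤ ─ ⁅ u ⁆) l × l ≡ suc k

    Special : Fin n → Set ℓ
    Special u = ¬ Essential u × ∃ λ w → (G u w ≡ true) × Essential w

    D2Edge : Subset n → Fin n → Fin n → Set ℓ
    D2Edge X u v = u ≢ v × u ∈ X × v ∈ X × ∃ λ k → ∃ λ l →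
      MultIs θ G X k × MultIs θ G ((X ─ ⁅ u ⁆) ─ ⁅ v ⁆) l × l ≡ k ℕ.+ 2

    -- P_θ(G), given A = A_θ(G): θ-positive vertices that are not θ-special
    PosNotSpecial : Subset n → Fin n → Set ℓ
    PosNotSpecial A u = Positive u × u ∉ A

    ZeroComponent : Subset n → Subset n → Set ℓ
    ZeroComponent A X = IsComponent G A X × MultIs θ G X 0

{-# OPTIONS --safe #-}
module Submission where

-- Let v(X) be the order of vanishing at θ of F(X) = μ(G[X]).  Everything about v comes from two
-- facts: the vertex recursion F(X) = x F(X∖u) − Σ F(X∖uz), and the Heilmann–Lieb identity that
-- E(u,v) = F(X∖u) F(X∖v) − F(X) F(X∖uv) is a sum of squares, so that its order at θ is even and its
-- lowest coefficient positive.  Summing E(u,v) over v gives a Wronskian and hence interlacing,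
-- |v(X) − v(X∖u)| ≤ 1.  The identity holds for independent vertex weights; perturbing the weight of
-- one vertex yields the exchange property that if {w} and {d,d′} are independent (each deletion
-- lowers v by one) then so is {w,d} or {w,d′}.
-- Exchange gives stability: deleting a special vertex raises v by one and changes the type of no
-- other vertex.  Therefore every vertex of A contributes one to the multiplicity of G∖A, a property
-- that survives both the extra edges of S_θ(G) and the deletion of u and v.  The question becomes one
-- about G∖A, where v is additive over components, and where a component containing a positive vertex
-- has multiplicity 0: otherwise it would contain an essential vertex, and essentiality would spread
-- along its edges because none of its vertices is special.

open import Defs
open import Level using (Level)
open import Algebra.Bundles using (CommutativeRing)
open import Data.Nat as ℕ using (ℕ; zero; suc; z≤n; s≤s)
import Data.Nat.Properties as ℕₚ
open import Data.Bool as Bool using (Bool; true; false; _∧_; _∨_; not; if_then_else_)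
open import Data.Bool.Properties using (∧-identityʳ; ∧-zeroʳ; ∨-comm)
open import Data.Fin using (Fin; zero; suc; toℕ; _≟_)
import Data.Fin.Properties as Finₚ
open import Data.Fin.Subset using (Subset; _∈_; _∉_; _⊆_; ∣_∣; _─_; _-_; _∩_; _∪_; ⁅_⁆; ⊤)
open import Data.Fin.Subset.Properties using (_∈?_; nonempty?; Empty-unique; ⊆-antisym; ∈⊤; ∣⊥∣≡0; ∣p∣≤n; x∈⁅x⁆; x∈⁅y⁆⇒x≡y; p⊂q⇒∣p∣<∣q∣; x∈p∩q⁺; x∈p∩q⁻; p⊆p∪q; q⊆p∪q; x∈p∪q⁻; p─⊥≡p; p─q─r≡p─r─q; x∈p∧x∉q⇒x∈p─q; ∣p─q∣≤∣p∣; x∈p∧x≢y⇒x∈p-y; p─x─y≡p─y─x)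
open import Data.Vec using (lookup; []; _∷_; here; there)
open import Data.Vec.Properties using ([]=⇒lookup; lookup⇒[]=)
open import Data.List using (List; []; _∷_; map; filter; concatMap; foldr; length; allFin; tabulate; applyUpTo; _++_)
open import Data.List.Relation.Unary.All as All using (All; []; _∷_)
open import Data.List.Relation.Unary.All.Properties using (concat⁺; map⁺; tabulate⁺; all-filter)
open import Data.Product using (_×_; _,_; ∃; proj₁; proj₂)
open import Data.Sum using (_⊎_; inj₁; inj₂; [_,_]′)
open import Data.Empty using (⊥; ⊥-elim)
open import Function using (_∘_; id)
open import Relation.Nullary using (¬_; Dec; yes; no; does)
open import Relation.Nullary.Decidable using (dec-true; dec-false; _×-dec_; ¬?)
open import Relation.Binary.Structures using (IsTotalOrder)
open import Relation.Binary.PropositionalEquality as ≡ using (_≡_; _≢_)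

-- Ordered fields

-- Multiplicities are read off from power series in t = x - θ, as orders of vanishing. That an order
-- exists has to be proved constructively; the decision whether a coefficient is zero is extracted
-- from completeness, through suprema of suitable sets. Real roots never appear. What replaces them
-- is that series of even order with positive lowest coefficient cannot cancel each other in lowest
-- order, so that a bound on the order of a sum passes to every summand. The obstacle in comparing G
-- with S_θ(G) is that the new edges might change which vertices are essential. The equality v(Y∖A)
-- = v(Y) + |Y ∩ A| gets around this: its left side does not see the edges at A, and each vertex of
-- A is certified as positive by a single neighbour, along an edge that S_θ(G) keeps. From stability
-- on, only a short list of laws of v is used, so that they can be invoked for both graphs.

module RealFacts {ℓ : Level} (R : RealField ℓ) where
  open RealField R hiding (zero)
  open IsTotalOrder isTotalOrder using (total; antisym) renaming (trans to ≤-trans; reflexive to ≤-reflexive)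
  open import Algebra.Properties.Ring ring using (-‿distribˡ-*; -‿distribʳ-*; -‿involutive; -0#≈0#)

  ≤-resp : ∀ {x x′ y y′} → x ≈ x′ → y ≈ y′ → x ≤ y → x′ ≤ y′
  ≤-resp p q r = ≤-trans (≤-reflexive (sym p)) (≤-trans r (≤-reflexive q))

  neg-flip : ∀ {x} → x ≤ 0# → 0# ≤ (- x)
  neg-flip {x} p = ≤-resp (-‿inverseʳ x) (+-identityˡ _) (+-mono-≤ (- x) p)

  neg*neg : ∀ x → (- x) * (- x) ≈ x * x
  neg*neg x = trans (sym (-‿distribˡ-* x (- x))) (trans (-‿cong (sym (-‿distribʳ-* x x))) (-‿involutive _))

  square-nonneg : ∀ x → 0# ≤ (x * x)
  square-nonneg x with total 0# x
  ... | inj₁ p = *-nonneg p p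
  ... | inj₂ p = ≤-resp refl (neg*neg x) (*-nonneg (neg-flip p) (neg-flip p))

  1≰0 : ¬ (1# ≤ 0#)
  1≰0 p = 0≉1 (antisym (≤-resp refl (*-identityˡ 1#) (square-nonneg 1#)) p)

  0≤1 : 0# ≤ 1#
  0≤1 = [ (λ p → p) , (λ p → ⊥-elim (1≰0 p)) ]′ (total 0# 1#)

  +-nonneg : ∀ {x y} → 0# ≤ x → 0# ≤ y → 0# ≤ (x + y)
  +-nonneg {x} {y} p q = ≤-trans q (≤-resp (+-identityˡ y) refl (+-mono-≤ y p))

  nonneg-sum≈0 : ∀ {x y} → 0# ≤ x → 0# ≤ y → x + y ≈ 0# → x ≈ 0#
  nonneg-sum≈0 {x} {y} p q e =
    antisym (≤-trans (≤-resp (+-identityˡ x) (+-comm y x) (+-mono-≤ x q)) (≤-reflexive e)) p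

  1+nonneg≉0 : ∀ {x} → 0# ≤ x → ¬ (1# + x ≈ 0#)
  1+nonneg≉0 p e = 0≉1 (sym (nonneg-sum≈0 0≤1 p e))

  open Poly R using (fromℕ)

  fromℕ-nonneg : ∀ n → 0# ≤ fromℕ n
  fromℕ-nonneg zero    = ≤-reflexive refl
  fromℕ-nonneg (suc n) = +-nonneg 0≤1 (fromℕ-nonneg n)

  fromℕ-suc≉0 : ∀ n → ¬ (fromℕ (suc n) ≈ 0#)
  fromℕ-suc≉0 n = 1+nonneg≉0 (fromℕ-nonneg n)

  *-cancel-0 : ∀ {x y} → ¬ (x ≈ 0#) → x * y ≈ 0# → y ≈ 0#
  *-cancel-0 {x} {y} x≉0 e with inverse x x≉0
  ... | z , xz≈1 = trans (sym (*-identityˡ y)) (trans (*-congʳ (trans (sym xz≈1) (*-comm x z)))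
                     (trans (*-assoc z x y) (trans (*-congˡ e) (zeroʳ z))))

  *-≉0 : ∀ {x y} → ¬ (x ≈ 0#) → ¬ (y ≈ 0#) → ¬ (x * y ≈ 0#)
  *-≉0 p q e = q (*-cancel-0 p e)

  -- The supremum of {0} ∪ {2 | Q} is compared with 1.
  weak-lem : (Q : Set ℓ) → ¬ Q ⊎ ¬ ¬ Q
  weak-lem Q with complete P (0# , inj₁ refl) (2# , bound)
    where
    2# = 1# + 1#
    P : Carrier → Set ℓ
    P y = (y ≈ 0#) ⊎ ((y ≈ 2#) × Q)
    bound : ∀ x → P x → x ≤ 2#
    bound x (inj₁ e)       = ≤-trans (≤-reflexive e) (+-nonneg 0≤1 0≤1)
    bound x (inj₂ (e , _)) = ≤-reflexive e
  ... | s , ub , least with total s 1#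
  ... | inj₁ s≤1 = inj₁ λ q → 1≰0 (≤-resp
          (trans (+-assoc _ _ _) (trans (+-congˡ (-‿inverseʳ 1#)) (+-identityʳ _))) (-‿inverseʳ 1#)
          (+-mono-≤ (- 1#) (≤-trans (ub _ (inj₂ (refl , q))) s≤1)))
  ... | inj₂ 1≤s = inj₂ λ ¬q → 1≰0 (≤-trans 1≤s (least 0# λ where
          x (inj₁ e)       → ≤-reflexive e
          x (inj₂ (_ , q)) → ⊥-elim (¬q q)))

  -- The set {y | ¬ ¬ y ≈ 0} is closed under adding x, so its supremum s satisfies s ≤ s - x.
  ¬¬≈0⇒≤0 : ∀ {x} → ¬ ¬ (x ≈ 0#) → x ≤ 0#
  ¬¬≈0⇒≤0 {x} ¬¬x with complete P (0# , λ k → k refl) (1# , bound)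
    where
    P : Carrier → Set ℓ
    P y = ¬ ¬ (y ≈ 0#)
    bound : ∀ y → P y → y ≤ 1#
    bound y ¬¬y with total y 1#
    ... | inj₁ p = p
    ... | inj₂ p = ⊥-elim (¬¬y λ e → 1≰0 (≤-trans p (≤-reflexive e)))
  ... | s , ub , least = ≤-resp (cancelˡ s x) (-‿inverseʳ s) (+-mono-≤ (- s) s+x≤s)
    where
    cancelˡ : ∀ s x → (s + x) + (- s) ≈ x
    cancelˡ s x = trans (+-comm _ _) (trans (sym (+-assoc _ _ _)) (trans (+-congʳ (-‿inverseˡ s)) (+-identityˡ x)))
    y≤s-x : ∀ y → ¬ ¬ (y ≈ 0#) → y ≤ (s + (- x))
    y≤s-x y ¬¬y = ≤-resp (trans (+-congʳ (+-comm y x)) (cancelˡ x y)) refl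
      (+-mono-≤ (- x) (ub (y + x) λ k → ¬¬y λ e → ¬¬x λ e′ → k (trans (+-cong e e′) (+-identityˡ 0#))))
    s+x≤s : (s + x) ≤ s
    s+x≤s = ≤-resp refl (trans (+-assoc _ _ _) (trans (+-congˡ (-‿inverseˡ x)) (+-identityʳ s)))
      (+-mono-≤ x (least _ y≤s-x))

  ≈0-stable : ∀ {x} → ¬ ¬ (x ≈ 0#) → x ≈ 0#
  ≈0-stable {x} ¬¬x = antisym (¬¬≈0⇒≤0 ¬¬x)
    (≤-resp refl (-‿involutive x) (neg-flip (¬¬≈0⇒≤0 λ k → ¬¬x λ e → k (trans (-‿cong e) -0#≈0#))))

  -- The search for a first nonzero coefficient rests on this decision. Weak excluded middle
  -- suffices because equality with zero is stable under double negation.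
  _≈0? : ∀ x → Dec (x ≈ 0#)
  x ≈0? with weak-lem (x ≈ 0#)
  ... | inj₁ p = no p
  ... | inj₂ p = yes (≈0-stable p)

-- Power series and orders of vanishing

module Series {c ℓ : Level} (C : CommutativeRing c ℓ) where
  open CommutativeRing C
  open import Algebra.Solver.Ring.NaturalCoefficients.Default commutativeSemiring using (solve; _:=_; _:+_; _:*_)
  open import Relation.Binary.Reasoning.Setoid setoid

  Ser : Set c
  Ser = ℕ → Carrier

  infix 4 _≋_
  -- A record, not a bare function type: both series can then be inferred from the type of a proof.
  record _≋_ (f g : Ser) : Set ℓ where
    constructor mk≋
    field at : ∀ n → f n ≈ g n
  open _≋_ public

  tl : Ser → Ser
  tl f n = f (suc n)

  infixl 6 _⊕_
  infixl 7 _⊛_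
  infixr 8 _·_

  _⊕_ : Ser → Ser → Ser
  (f ⊕ g) n = f n + g n

  ⊝_ : Ser → Ser
  (⊝ f) n = - f n

  _·_ : Carrier → Ser → Ser
  (a · f) n = a * f n

  _⊛_ : Ser → Ser → Ser
  (f ⊛ g) zero    = f 0 * g 0
  (f ⊛ g) (suc n) = f 0 * g (suc n) + (tl f ⊛ g) n

  const : Carrier → Ser
  const a zero    = a
  const a (suc n) = 0#

  𝟘 : Ser
  𝟘 n = 0#

  shift : Ser → Ser
  shift f zero    = 0#
  shift f (suc n) = f n

  ⊛-cong′ : ∀ {f f′ g g′} → (∀ n → f n ≈ f′ n) → (∀ n → g n ≈ g′ n) → ∀ n → (f ⊛ g) n ≈ (f′ ⊛ g′) n
  ⊛-cong′ p q zero    = *-cong (p 0) (q 0)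
  ⊛-cong′ p q (suc n) = +-cong (*-cong (p 0) (q (suc n))) (⊛-cong′ (λ m → p (suc m)) q n)

  ⊛-zeroˡ′ : ∀ {f} g → (∀ n → f n ≈ 0#) → ∀ n → (f ⊛ g) n ≈ 0#
  ⊛-zeroˡ′ g p zero    = trans (*-congʳ (p 0)) (zeroˡ _)
  ⊛-zeroˡ′ g p (suc n) = trans (+-cong (trans (*-congʳ (p 0)) (zeroˡ _)) (⊛-zeroˡ′ g (λ m → p (suc m)) n))
      (+-identityˡ _)

  const-⊛ : ∀ a g n → (const a ⊛ g) n ≈ a * g n
  const-⊛ a g zero    = refl
  const-⊛ a g (suc n) = trans (+-congˡ (⊛-zeroˡ′ g (λ _ → refl) n)) (+-identityʳ _)

  shift-⊛ : ∀ f g n → (shift f ⊛ g) n ≈ shift (f ⊛ g) n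
  shift-⊛ f g zero    = zeroˡ _
  shift-⊛ f g (suc n) = trans (+-congʳ (zeroˡ _)) (+-identityˡ _)

  ⊛-distribʳ′ : ∀ h f g n → ((f ⊕ g) ⊛ h) n ≈ (f ⊛ h) n + (g ⊛ h) n
  ⊛-distribʳ′ h f g zero    = distribʳ _ _ _
  ⊛-distribʳ′ h f g (suc n) = trans (+-congˡ (⊛-distribʳ′ h (tl f) (tl g) n))
    (solve 5 (λ a b x p q → (a :+ b) :* x :+ (p :+ q) := (a :* x :+ p) :+ (b :* x :+ q)) refl _ _ _ _ _)

  ·-⊛ : ∀ a f g n → ((a · f) ⊛ g) n ≈ a * (f ⊛ g) n
  ·-⊛ a f g zero    = *-assoc _ _ _
  ·-⊛ a f g (suc n) = trans (+-congˡ (·-⊛ a (tl f) g n))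
    (solve 4 (λ a x y p → a :* x :* y :+ a :* p := a :* (x :* y :+ p)) refl _ _ _ _)

  -- The product is defined by peeling off the head of the left factor; peeling off that of the
  -- right factor is what turns commutativity into an induction.
  ⊛-unfoldʳ : ∀ f g n → (f ⊛ g) (suc n) ≈ f (suc n) * g 0 + (f ⊛ tl g) n
  ⊛-unfoldʳ f g zero    = +-comm _ _
  ⊛-unfoldʳ f g (suc n) = trans (+-congˡ (⊛-unfoldʳ (tl f) g n))
    (solve 3 (λ x y z → x :+ (y :+ z) := y :+ (x :+ z)) refl _ _ _)

  ⊛-comm′ : ∀ f g n → (f ⊛ g) n ≈ (g ⊛ f) n
  ⊛-comm′ f g zero    = *-comm _ _
  ⊛-comm′ f g (suc n) = trans (+-cong (*-comm _ _) (⊛-comm′ (tl f) g n)) (sym (⊛-unfoldʳ g f n))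

  ⊛-assoc′ : ∀ f g h n → ((f ⊛ g) ⊛ h) n ≈ (f ⊛ (g ⊛ h)) n
  ⊛-assoc′ f g h zero    = *-assoc _ _ _
  ⊛-assoc′ f g h (suc n) = begin
    f 0 * g 0 * h (suc n) + (tl (f ⊛ g) ⊛ h) n
      ≈⟨ +-congˡ (trans (⊛-distribʳ′ h (f 0 · tl g) (tl f ⊛ g) n)
                        (+-cong (·-⊛ (f 0) (tl g) h n) (⊛-assoc′ (tl f) g h n))) ⟩
    f 0 * g 0 * h (suc n) + (f 0 * (tl g ⊛ h) n + (tl f ⊛ (g ⊛ h)) n)
      ≈⟨ solve 5 (λ a b x p q → a :* b :* x :+ (a :* p :+ q) := a :* (b :* x :+ p) :+ q) refl _ _ _ _ _ ⟩
    f 0 * (g 0 * h (suc n) + (tl g ⊛ h) n) + (tl f ⊛ (g ⊛ h)) n ∎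

  serRing : CommutativeRing c ℓ
  serRing = record
    { Carrier = Ser ; _≈_ = _≋_ ; _+_ = _⊕_ ; _*_ = _⊛_ ; -_ = ⊝_ ; 0# = 𝟘 ; 1# = const 1#
    ; isCommutativeRing = record
      { isRing = record
        { +-isAbelianGroup = record
          { isGroup = record
            { isMonoid = record
              { isSemigroup = record
                { isMagma = record
                  { isEquivalence = record
                    { refl = mk≋ λ _ → refl
                    ; sym = λ p → mk≋ λ n → sym (at p n)
                    ; trans = λ p q → mk≋ λ n → trans (at p n) (at q n) }
                  ; ∙-cong = λ p q → mk≋ λ n → +-cong (at p n) (at q n) }
                ; assoc = λ f g h → mk≋ λ n → +-assoc _ _ _ }
              ; identity = (λ f → mk≋ λ n → +-identityˡ _) , (λ f → mk≋ λ n → +-identityʳ _) }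
            ; inverse = (λ f → mk≋ λ n → -‿inverseˡ _) , (λ f → mk≋ λ n → -‿inverseʳ _)
            ; ⁻¹-cong = λ p → mk≋ λ n → -‿cong (at p n) }
          ; comm = λ f g → mk≋ λ n → +-comm _ _ }
        ; *-cong = λ p q → mk≋ (⊛-cong′ (at p) (at q))
        ; *-assoc = λ f g h → mk≋ (⊛-assoc′ f g h)
        ; *-identity = one-⊛ , λ f → mk≋ λ n → trans (⊛-comm′ f _ n) (at (one-⊛ f) n)
        ; distrib = (λ h f g → mk≋ λ n → trans (⊛-comm′ h _ n)
                       (trans (⊛-distribʳ′ h f g n) (+-cong (⊛-comm′ f h n) (⊛-comm′ g h n))))
                  , (λ h f g → mk≋ (⊛-distribʳ′ h f g)) }
      ; *-comm = λ f g → mk≋ (⊛-comm′ f g) } }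
    where
    one-⊛ : ∀ f → (const 1# ⊛ f) ≋ f
    one-⊛ f = mk≋ λ n → trans (const-⊛ 1# f n) (*-identityˡ _)

-- Orders of vanishing and positive lowest coefficients.

module Order {ℓ : Level} (R : RealField ℓ) where
  open RealField R hiding (zero)
  open RealFacts R
  open Series commutativeRing
  open IsTotalOrder isTotalOrder using () renaming (reflexive to ≤-reflexive)
  open import Algebra.Solver.Ring.NaturalCoefficients.Default commutativeSemiring using (solve; _:=_; _:+_; _:*_)
  open import Algebra.Properties.Ring ring using (-0#≈0#)
  module S = CommutativeRing serRing
  open import Algebra.Properties.Semiring.Sum S.semiring using (sum)

  Ord≥ : ℕ → Ser → Set ℓ
  Ord≥ m f = ∀ j → j ℕ.< m → f j ≈ 0#

  IsOrd : Ser → ℕ → Set ℓ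
  IsOrd f k = Ord≥ k f × ¬ (f k ≈ 0#)

  Ord≥-weaken : ∀ {m k f} → k ℕ.≤ m → Ord≥ m f → Ord≥ k f
  Ord≥-weaken p q j r = q j (ℕₚ.≤-trans r p)

  Ord≥-resp : ∀ {m f g} → f ≋ g → Ord≥ m f → Ord≥ m g
  Ord≥-resp e q j r = trans (sym (at e j)) (q j r)

  Ord≥-suc : ∀ {m f} → Ord≥ m f → f m ≈ 0# → Ord≥ (suc m) f
  Ord≥-suc {m} p e j (s≤s r) with ℕₚ.m≤n⇒m<n∨m≡n r
  ... | inj₁ q       = p j q
  ... | inj₂ ≡.refl  = e

  Ord≥-⊕ : ∀ {m f g} → Ord≥ m f → Ord≥ m g → Ord≥ m (f ⊕ g)
  Ord≥-⊕ p q j r = trans (+-cong (p j r) (q j r)) (+-identityˡ _)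

  Ord≥-⊝ : ∀ {m f} → Ord≥ m f → Ord≥ m (⊝ f)
  Ord≥-⊝ p j r = trans (-‿cong (p j r)) -0#≈0#

  Ord≥-𝟘 : ∀ {m} → Ord≥ m 𝟘
  Ord≥-𝟘 j r = refl

  Ord≥-sum : ∀ {m n} (t : Fin n → Ser) → (∀ i → Ord≥ m (t i)) → Ord≥ m (sum t)
  Ord≥-sum {n = zero}  t p = Ord≥-𝟘
  Ord≥-sum {n = suc n} t p = Ord≥-⊕ (p zero) (Ord≥-sum (λ i → t (suc i)) (λ i → p (suc i)))

  private
    Ord≥-⊛₀ : ∀ {b} f {g} → Ord≥ b g → Ord≥ b (f ⊛ g)
    Ord≥-⊛₀ f q zero    r = trans (*-congˡ (q 0 r)) (zeroʳ _)
    Ord≥-⊛₀ f q (suc j) r = trans (+-cong (trans (*-congˡ (q (suc j) r)) (zeroʳ _))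
                                          (Ord≥-⊛₀ (tl f) q j (ℕₚ.<-trans (ℕₚ.n<1+n j) r))) (+-identityˡ _)

    drop-head : ∀ f (g : Ser) n → f 0 ≈ 0# → (f ⊛ g) (suc n) ≈ (tl f ⊛ g) n
    drop-head f g n e = trans (+-congʳ (trans (*-congʳ e) (zeroˡ _))) (+-identityˡ _)

    Ord≥-tl : ∀ {a f} → Ord≥ (suc a) f → Ord≥ a (tl f)
    Ord≥-tl p j r = p (suc j) (s≤s r)

  Ord≥-⊛ : ∀ a b {f g} → Ord≥ a f → Ord≥ b g → Ord≥ (a ℕ.+ b) (f ⊛ g)
  Ord≥-⊛ zero    b {f} p q = Ord≥-⊛₀ f q
  Ord≥-⊛ (suc a) b p q zero    r       = trans (*-congʳ (p 0 (s≤s z≤n))) (zeroˡ _)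
  Ord≥-⊛ (suc a) b {f} {g} p q (suc j) (s≤s r) =
    trans (drop-head f g j (p 0 (s≤s z≤n))) (Ord≥-⊛ a b (Ord≥-tl p) q j r)

  ⊛-lead : ∀ a b {f g} → Ord≥ a f → Ord≥ b g → (f ⊛ g) (a ℕ.+ b) ≈ f a * g b
  ⊛-lead zero    zero    p q = refl
  ⊛-lead zero    (suc b) {f} p q = trans (+-congˡ (Ord≥-⊛₀ (tl f) q b (ℕₚ.n<1+n b))) (+-identityʳ _)
  ⊛-lead (suc a) b {f} {g} p q = trans (drop-head f g (a ℕ.+ b) (p 0 (s≤s z≤n))) (⊛-lead a b (Ord≥-tl p) q)

  IsOrd-⊛ : ∀ {a b f g} → IsOrd f a → IsOrd g b → IsOrd (f ⊛ g) (a ℕ.+ b)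
  IsOrd-⊛ {a} {b} (p , p′) (q , q′) = Ord≥-⊛ a b p q , λ e → *-≉0 p′ q′ (trans (sym (⊛-lead a b p q)) e)

  Ord≥⇒≤ : ∀ {f k m} → IsOrd f k → Ord≥ m f → m ℕ.≤ k
  Ord≥⇒≤ {k = k} {m} (_ , nz) p with m ℕ.≤? k
  ... | yes q = q
  ... | no  q = ⊥-elim (nz (p k (ℕₚ.≰⇒> q)))

  IsOrd-unique : ∀ {f k l} → IsOrd f k → IsOrd f l → k ≡ l
  IsOrd-unique p q = ℕₚ.≤-antisym (Ord≥⇒≤ q (proj₁ p)) (Ord≥⇒≤ p (proj₁ q))

  IsOrd-resp : ∀ {f g k} → f ≋ g → IsOrd f k → IsOrd g k
  IsOrd-resp e (p , q) = Ord≥-resp e p , λ r → q (trans (at e _) r)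

  -- The known nonzero coefficient bounds the search. The invariant of `go` is that all coefficients
  -- below `k` vanish and the one at `d + k` does not.
  find-ord : ∀ f d → ¬ (f d ≈ 0#) → ∃ (IsOrd f)
  find-ord f d nz = go d 0 (λ _ ()) (≡.subst (λ k → ¬ (f k ≈ 0#)) (≡.sym (ℕₚ.+-identityʳ d)) nz)
    where
    go : ∀ d k → Ord≥ k f → ¬ (f (d ℕ.+ k) ≈ 0#) → ∃ (IsOrd f)
    go zero    k p nz = k , p , nz
    go (suc d) k p nz with f k ≈0?
    ... | no  q = k , p , q
    ... | yes q = go d (suc k) (Ord≥-suc p q) (≡.subst (λ k → ¬ (f k ≈ 0#)) (≡.sym (ℕₚ.+-suc d k)) nz)

  -- Doubling by recursion, so that the even and odd cases alternate definitionally.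
  dbl : ℕ → ℕ
  dbl zero    = zero
  dbl (suc j) = suc (suc (dbl j))

  dbl≡+ : ∀ j → dbl j ≡ j ℕ.+ j
  dbl≡+ zero    = ≡.refl
  dbl≡+ (suc j) = ≡.cong suc (≡.trans (≡.cong suc (dbl≡+ j)) (≡.sym (ℕₚ.+-suc j j)))

  -- Satisfied by every sum of squares: the order is even and the lowest coefficient is positive.
  LowNonneg : Ser → Set ℓ
  LowNonneg f = ∀ j → Ord≥ (dbl j) f → (0# ≤ f (dbl j)) × (f (dbl j) ≈ 0# → f (suc (dbl j)) ≈ 0#)

  LowNonneg-even : ∀ {f} → LowNonneg f → ∀ j → Ord≥ (suc (dbl j)) f → Ord≥ (dbl (suc j)) f
  LowNonneg-even F j p = Ord≥-suc p (proj₂ (F j (Ord≥-weaken (ℕₚ.n≤1+n _) p)) (p _ (ℕₚ.n<1+n _)))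

  LowNonneg-resp : ∀ {f g} → f ≋ g → LowNonneg f → LowNonneg g
  LowNonneg-resp e F j p with F j (Ord≥-resp (S.sym e) p)
  ... | nn , nx = ≤-resp refl (at e _) nn , λ z → trans (sym (at e _)) (nx (trans (at e _) z))

  LowNonneg-𝟘 : LowNonneg 𝟘
  LowNonneg-𝟘 j p = ≤-reflexive refl , λ _ → refl

  -- No cancellation in lowest order. At an even index two nonnegative coefficients add up to zero,
  -- so both vanish; the following odd index is then free by `LowNonneg-even`.
  split-even : ∀ {f g} → LowNonneg f → LowNonneg g → ∀ j → Ord≥ (dbl j) (f ⊕ g) → Ord≥ (dbl j) f × Ord≥ (dbl j) g
  split-odd : ∀ {f g} → LowNonneg f → LowNonneg g → ∀ j → Ord≥ (suc (dbl j)) (f ⊕ g) →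
              Ord≥ (suc (dbl j)) f × Ord≥ (suc (dbl j)) g
  split-even F G zero    p = (λ _ ()) , (λ _ ())
  split-even F G (suc j) p with split-odd F G j (Ord≥-weaken (ℕₚ.n≤1+n _) p)
  ... | pf , pg = LowNonneg-even F j pf , LowNonneg-even G j pg
  split-odd F G j p with split-even F G j (Ord≥-weaken (ℕₚ.n≤1+n _) p)
  ... | pf , pg = Ord≥-suc pf (nonneg-sum≈0 nf ng e) , Ord≥-suc pg (nonneg-sum≈0 ng nf (trans (+-comm _ _) e))
    where
    nf = proj₁ (F j pf)
    ng = proj₁ (G j pg)
    e = p (dbl j) (ℕₚ.n<1+n _)

  LowNonneg-⊕ : ∀ {f g} → LowNonneg f → LowNonneg g → LowNonneg (f ⊕ g)
  LowNonneg-⊕ F G j p with split-even F G j p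
  ... | pf , pg = +-nonneg nf ng , λ e → trans
          (+-cong (proj₂ (F j pf) (nonneg-sum≈0 nf ng e))
                  (proj₂ (G j pg) (nonneg-sum≈0 ng nf (trans (+-comm _ _) e)))) (+-identityˡ _)
    where
    nf = proj₁ (F j pf)
    ng = proj₁ (G j pg)

  LowNonneg-sum : ∀ {n} (t : Fin n → Ser) → (∀ i → LowNonneg (t i)) → LowNonneg (sum t)
  LowNonneg-sum {zero}  t p = LowNonneg-𝟘
  LowNonneg-sum {suc n} t p = LowNonneg-⊕ (p zero) (LowNonneg-sum (λ i → t (suc i)) (λ i → p (suc i)))

  -- This is how a bound on a whole sum reaches one chosen summand: the edge term of `E`, or the
  -- diagonal term of the Wronskian.
  sum-odd : ∀ {n} (t : Fin n → Ser) → (∀ i → LowNonneg (t i)) → ∀ j → Ord≥ (suc (dbl j)) (sum t) →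
            ∀ i → Ord≥ (suc (dbl j)) (t i)
  sum-odd {suc n} t p j q i with split-odd (p zero) (LowNonneg-sum _ (λ i → p (suc i))) j q
  sum-odd {suc n} t p j q zero    | q₀ , qs = q₀
  sum-odd {suc n} t p j q (suc i) | q₀ , qs = sum-odd _ (λ i → p (suc i)) j qs i

  square-lead : ∀ {f} j → Ord≥ j f → (f ⊛ f) (dbl j) ≈ f j * f j
  square-lead {f} j p = ≡.subst (λ m → (f ⊛ f) m ≈ f j * f j) (≡.sym (dbl≡+ j)) (⊛-lead j j p p)

  square≈0 : ∀ {x} → x * x ≈ 0# → x ≈ 0#
  square≈0 {x} e with x ≈0?
  ... | yes p = p
  ... | no  p = *-cancel-0 p e

  Ord≥-sqrt : ∀ {f} j → Ord≥ (dbl j) (f ⊛ f) → Ord≥ j f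
  Ord≥-sqrt zero    p = λ _ ()
  Ord≥-sqrt (suc j) p = Ord≥-suc q (square≈0 (trans (sym (square-lead j q)) (p _ (ℕₚ.m≤n⇒m≤1+n ℕₚ.≤-refl))))
    where q = Ord≥-sqrt j (Ord≥-weaken (ℕₚ.m≤n⇒m≤1+n (ℕₚ.n≤1+n _)) p)

  -- A square has even order, so the odd bound 2j + 1 is as good as 2j + 2.
  Ord≥-sqrt-odd : ∀ {f} j → Ord≥ (suc (dbl j)) (f ⊛ f) → Ord≥ (suc j) f
  Ord≥-sqrt-odd j p = Ord≥-suc q (square≈0 (trans (sym (square-lead j q)) (p _ ℕₚ.≤-refl)))
    where q = Ord≥-sqrt j (Ord≥-weaken (ℕₚ.n≤1+n _) p)

  LowNonneg-square : ∀ f → LowNonneg (f ⊛ f)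
  LowNonneg-square f j p =
    ≤-resp refl (sym (square-lead j q)) (square-nonneg (f j)) ,
    λ e → let q′ = Ord≥-suc q (square≈0 (trans (sym (square-lead j q)) e))
          in ≡.subst (λ m → Ord≥ m (f ⊛ f)) (≡.sym (dbl≡+ (suc j))) (Ord≥-⊛ (suc j) (suc j) q′ q′) _ ℕₚ.≤-refl
    where q = Ord≥-sqrt j p

  -- Derivatives, Taylor expansion at θ, and divisibility by powers of x - θ.

  open Poly R

  D : Ser → Ser
  D f n = fromℕ (suc n) * f (suc n)

  D-cong : ∀ {f g} → f ≋ g → D f ≋ D g
  D-cong e = mk≋ λ n → *-congˡ (at e (suc n))

  D-⊕ : ∀ f g → D (f ⊕ g) ≋ D f ⊕ D g
  D-⊕ f g = mk≋ λ n → distribˡ _ _ _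

  D-𝟘 : D 𝟘 ≋ 𝟘
  D-𝟘 = mk≋ λ n → zeroʳ _

  D-sum : ∀ {n} (t : Fin n → Ser) → D (sum t) ≋ sum (λ i → D (t i))
  D-sum {zero}  t = D-𝟘
  D-sum {suc n} t = S.trans (D-⊕ (t zero) (sum (λ i → t (suc i)))) (S.+-congˡ (D-sum (λ i → t (suc i))))

  D-const : ∀ c → D (const c) ≋ 𝟘
  D-const c = mk≋ λ n → zeroʳ _

  Ord≥-D : ∀ {m f} → Ord≥ (suc m) f → Ord≥ m (D f)
  Ord≥-D p j r = trans (*-congˡ (p (suc j) (s≤s r))) (zeroʳ _)

  -- The variable x centred at θ, that is θ + t.
  𝕏 : Carrier → Ser
  𝕏 θ = const θ ⊕ shift (const 1#)

  shift-one : ∀ f → (shift (const 1#) ⊛ f) ≋ shift f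
  shift-one f = mk≋ λ where
    zero    → zeroˡ _
    (suc n) → trans (shift-⊛ (const 1#) f (suc n)) (at (S.*-identityˡ f) n)

  𝕏-⊛ : ∀ θ f n → (𝕏 θ ⊛ f) n ≈ θ * f n + shift f n
  𝕏-⊛ θ f n = trans (at (S.distribʳ f _ _) n) (+-cong (const-⊛ θ f n) (at (shift-one f) n))

  D-𝕏 : ∀ θ f → D (𝕏 θ ⊛ f) ≋ f ⊕ (𝕏 θ ⊛ D f)
  D-𝕏 θ f = mk≋ λ where
    zero    → trans (*-congˡ (𝕏-⊛ θ f 1)) (trans
        (solve 4 (λ z o a b → o :* (z :* a :+ b) := o :* b :+ z :* (o :* a)) refl θ (1# + 0#) (f 1) (f 0))
                 (+-cong (trans (*-congʳ (+-identityʳ 1#)) (*-identityˡ _))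
                     (trans (sym (+-identityʳ _)) (sym (𝕏-⊛ θ (D f) 0)))))
    (suc n) → trans (*-congˡ (𝕏-⊛ θ f (suc (suc n))))
               (trans (trans (solve 5 (λ z o m a b →
                   (o :+ m) :* (z :* a :+ b) := o :* b :+ (z :* ((o :+ m) :* a) :+ m :* b)) refl
                        θ 1# (fromℕ (suc n)) (f (suc (suc n))) (f (suc n)))
                        (+-congʳ (*-identityˡ _)))
                 (+-congˡ (sym (𝕏-⊛ θ (D f) (suc n)))))

  module _ (θ : Carrier) where
    -- Taylor expansion at θ, computed by Horner's scheme.
    T : Pol → Ser
    T []      = 𝟘
    T (a ∷ p) = const a ⊕ (𝕏 θ ⊛ T p)

    const-⊕ : ∀ a b → const (a + b) ≋ const a ⊕ const b
    const-⊕ a b = mk≋ λ where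
      zero    → refl
      (suc n) → sym (+-identityˡ _)

    const-* : ∀ a b → const (a * b) ≋ const a ⊛ const b
    const-* a b = mk≋ λ where
      zero    → refl
      (suc n) → sym (trans (const-⊛ a (const b) (suc n)) (zeroʳ a))

    const-cong : ∀ {a b} → a ≈ b → const a ≋ const b
    const-cong e = mk≋ λ where
      zero    → e
      (suc n) → refl

    const-0 : const 0# ≋ 𝟘
    const-0 = mk≋ λ where
      zero    → refl
      (suc n) → refl

    open import Algebra.Solver.Ring.NaturalCoefficients.Default S.commutativeSemiring
      using () renaming (solve to solveˢ; _:=_ to _:=ˢ_; _:+_ to _:+ˢ_; _:*_ to _:*ˢ_)

    T-+ₚ : ∀ p q → T (p +ₚ q) ≋ T p ⊕ T q
    T-+ₚ []      q       = S.sym (S.+-identityˡ _)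
    T-+ₚ (a ∷ p) []      = S.sym (S.+-identityʳ _)
    T-+ₚ (a ∷ p) (b ∷ q) = S.trans (S.+-cong (const-⊕ a b) (S.*-congˡ (T-+ₚ p q)))
      (solveˢ 5 (λ a b x p q → (a :+ˢ b) :+ˢ x :*ˢ (p :+ˢ q) :=ˢ (a :+ˢ x :*ˢ p) :+ˢ (b :+ˢ x :*ˢ q)) S.refl _ _ _ _
          _)

    T-scale : ∀ c p → T (scale c p) ≋ const c ⊛ T p
    T-scale c []      = S.sym (S.zeroʳ _)
    T-scale c (a ∷ p) = S.trans (S.+-cong (const-* c a) (S.*-congˡ (T-scale c p)))
      (solveˢ 4 (λ c a x p → c :*ˢ a :+ˢ x :*ˢ (c :*ˢ p) :=ˢ c :*ˢ (a :+ˢ x :*ˢ p)) S.refl _ _ _ _)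

    T-0∷ : ∀ p → T (0# ∷ p) ≋ 𝕏 θ ⊛ T p
    T-0∷ p = S.trans (S.+-congʳ const-0) (S.+-identityˡ _)

    T-*ₚ : ∀ p q → T (p *ₚ q) ≋ T p ⊛ T q
    T-*ₚ []      q = S.sym (S.zeroˡ _)
    T-*ₚ (a ∷ p) q = S.trans (T-+ₚ (scale a q) (0# ∷ (p *ₚ q)))
      (S.trans (S.+-cong (T-scale a q) (S.trans (T-0∷ (p *ₚ q)) (S.*-congˡ (T-*ₚ p q))))
        (solveˢ 4 (λ a q x p → a :*ˢ q :+ˢ x :*ˢ (p :*ˢ q) :=ˢ (a :+ˢ x :*ˢ p) :*ˢ q) S.refl _ _ _ _))

    T-≈0 : ∀ p → p ≈ₚ [] → T p ≋ 𝟘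
    T-≈0 []      e = S.refl
    T-≈0 (a ∷ p) e = S.trans (S.+-cong (S.trans (const-cong (e 0)) const-0)
                                       (S.trans (S.*-congˡ (T-≈0 p (λ i → e (suc i)))) (S.zeroʳ _))) (S.+-identityˡ _)

    T-cong : ∀ p q → p ≈ₚ q → T p ≋ T q
    T-cong []      q       e = S.sym (T-≈0 q (λ i → sym (e i)))
    T-cong (a ∷ p) []      e = T-≈0 (a ∷ p) e
    T-cong (a ∷ p) (b ∷ q) e = S.+-cong (const-cong (e 0)) (S.*-congˡ (T-cong p q (λ i → e (suc i))))

    -- Synthetic division by x - θ: the coefficients of the quotient are the values at θ of the
    -- successive tails. On Taylor series it is the shift by one place (`T-quo`).
    quo : Pol → Pol
    quo []      = []
    quo (a ∷ p) = T p 0 ∷ quo p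

    T-suc : ∀ a p n → T (a ∷ p) (suc n) ≈ θ * T p (suc n) + T p n
    T-suc a p n = trans (+-identityˡ _) (𝕏-⊛ θ (T p) (suc n))

    T-zero : ∀ a p → T (a ∷ p) 0 ≈ a + θ * T p 0
    T-zero a p = +-congˡ (trans (𝕏-⊛ θ (T p) 0) (+-identityʳ _))

    T-quo : ∀ p n → T (quo p) n ≈ T p (suc n)
    T-quo []      n       = refl
    T-quo (a ∷ p) zero    = trans (T-zero (T p 0) (quo p))
      (trans (+-congˡ (*-congˡ (T-quo p 0))) (trans (+-comm _ _) (sym (T-suc a p 0))))
    T-quo (a ∷ p) (suc n) = trans (T-suc (T p 0) (quo p) n)
      (trans (+-cong (*-congˡ (T-quo p (suc n))) (T-quo p n)) (sym (T-suc a p (suc n))))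

  -- Expansion at 0 returns the coefficients, so laws of `_*ₚ_` can be borrowed from the ring of
  -- series.
  T0-coeff : ∀ p → T 0# p ≋ coeff p
  T0-coeff []      = S.refl
  T0-coeff (a ∷ p) = mk≋ λ where
    zero    → trans (T-zero 0# a p) (trans (+-congˡ (zeroˡ _)) (+-identityʳ a))
    (suc n) → trans (T-suc 0# a p n) (trans (+-cong (zeroˡ _) (at (T0-coeff p) n)) (+-identityˡ _))

  T0-inj : ∀ p q → T 0# p ≋ T 0# q → p ≈ₚ q
  T0-inj p q e = at (S.trans (S.sym (T0-coeff p)) (S.trans e (T0-coeff q)))

  *ₚ-assoc : ∀ p q r → ((p *ₚ q) *ₚ r) ≈ₚ (p *ₚ (q *ₚ r))
  *ₚ-assoc p q r = T0-inj ((p *ₚ q) *ₚ r) (p *ₚ (q *ₚ r))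
      (S.trans (T-*ₚ 0# (p *ₚ q) r) (S.trans (S.*-congʳ (T-*ₚ 0# p q))
    (S.trans (S.*-assoc _ _ _) (S.sym (S.trans (T-*ₚ 0# p (q *ₚ r)) (S.*-congˡ (T-*ₚ 0# q r)))))))

  *ₚ-congˡ : ∀ p q r → q ≈ₚ r → (p *ₚ q) ≈ₚ (p *ₚ r)
  *ₚ-congˡ p q r e = T0-inj (p *ₚ q) (p *ₚ r)
    (S.trans (T-*ₚ 0# p q) (S.trans (S.*-congˡ (T-cong 0# q r e)) (S.sym (T-*ₚ 0# p r))))

  *ₚ-identityˡ : ∀ p → ((1# ∷ []) *ₚ p) ≈ₚ p
  *ₚ-identityˡ p = T0-inj ((1# ∷ []) *ₚ p) p (S.trans (T-*ₚ 0# (1# ∷ []) p)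
    (S.trans (S.*-congʳ (S.trans (S.+-congˡ (S.zeroʳ _)) (S.+-identityʳ _))) (S.*-identityˡ _)))

  module _ (θ : Carrier) where
    T0-lin : T 0# (lin θ) ≋ const (- θ) ⊕ shift (const 1#)
    T0-lin = S.+-congˡ (mk≋ λ n → trans (𝕏-⊛ 0# (T 0# (1# ∷ [])) n)
        (trans (+-congʳ (zeroˡ _)) (trans (+-identityˡ _) (lem n))))
      where
      lem : ∀ n → shift (T 0# (1# ∷ [])) n ≈ shift (const 1#) n
      lem zero    = refl
      lem (suc n) = at (S.trans (S.+-congˡ (S.zeroʳ _)) (S.+-identityʳ (const 1#))) n

    coeff-lin : ∀ q n → coeff (lin θ *ₚ q) n ≈ (- θ) * coeff q n + shift (coeff q) n
    coeff-lin q n = at (S.trans (S.sym (T0-coeff (lin θ *ₚ q))) (S.trans (T-*ₚ 0# (lin θ) q)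
      (S.trans (S.*-cong T0-lin (T0-coeff q)) (S.trans (S.distribʳ _ _ _)
        (S.+-cong (mk≋ (const-⊛ (- θ) (coeff q))) (shift-one (coeff q))))))) n

    cancel : ∀ a b → (- θ) * b + (a + θ * b) ≈ a
    cancel a b = trans (solve 4 (λ t m b a → m :* b :+ (a :+ t :* b) := a :+ (m :+ t) :* b) refl θ (- θ) b a)
      (trans (+-congˡ (trans (*-congʳ (-‿inverseˡ θ)) (zeroˡ b))) (+-identityʳ a))

    -- Division with remainder, p = (x - θ) q + p(θ), read coefficient by coefficient.
    quo-spec : ∀ p n → coeff p n ≈ ((- θ) * coeff (quo θ p) n + shift (coeff (quo θ p)) n) + const (T θ p 0) n
    quo-spec []      zero    = sym (trans (+-identityʳ _) (trans (+-identityʳ _) (zeroʳ _)))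
    quo-spec []      (suc n) = sym (trans (+-identityʳ _) (trans (+-identityʳ _) (zeroʳ _)))
    quo-spec (a ∷ p) zero    = sym (trans (+-cong (+-identityʳ _) (T-zero θ a p)) (cancel a (T θ p 0)))
    quo-spec (a ∷ p) (suc zero)    = trans (quo-spec p 0) (trans (+-congʳ (+-identityʳ _)) (sym (+-identityʳ _)))
    quo-spec (a ∷ p) (suc (suc n)) = quo-spec p (suc n)

    lin-quo : ∀ p → T θ p 0 ≈ 0# → (lin θ *ₚ quo θ p) ≈ₚ p
    lin-quo p e n = trans (coeff-lin (quo θ p) n)
      (sym (trans (quo-spec p n) (trans (+-congˡ (lem n)) (+-identityʳ _))))
      where
      lem : ∀ n → const (T θ p 0) n ≈ 0#
      lem zero    = e
      lem (suc n) = refl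

    -- Order at least `suc k` means a zero remainder together with order at least `k` for the
    -- quotient, so repeated division extracts the power.
    Ord≥⇒∣ : ∀ k p → Ord≥ k (T θ p) → (lin θ ^ₚ k) ∣ₚ p
    Ord≥⇒∣ zero    p o = p , *ₚ-identityˡ p
    Ord≥⇒∣ (suc k) p o with Ord≥⇒∣ k (quo θ p) (λ j r → trans (T-quo θ p j) (o (suc j) (s≤s r)))
    ... | q , e = q , λ i → trans (*ₚ-assoc (lin θ) (lin θ ^ₚ k) q i)
                    (trans (*ₚ-congˡ (lin θ) ((lin θ ^ₚ k) *ₚ q) (quo θ p) e i) (lin-quo p (o 0 (s≤s z≤n)) i))

    Ord≥-lin : Ord≥ 1 (T θ (lin θ))
    Ord≥-lin zero (s≤s z≤n) = trans (T-zero θ (- θ) (1# ∷ []))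
      (trans (+-congˡ (trans (*-congˡ (trans (T-zero θ 1# []) (trans (+-congˡ (zeroʳ θ)) (+-identityʳ 1#))))
          (*-identityʳ θ)))
        (-‿inverseˡ θ))

    Ord≥-lin^ : ∀ k → Ord≥ k (T θ (lin θ ^ₚ k))
    Ord≥-lin^ zero    = λ _ ()
    Ord≥-lin^ (suc k) = Ord≥-resp (S.sym (T-*ₚ θ (lin θ) (lin θ ^ₚ k))) (Ord≥-⊛ 1 k Ord≥-lin (Ord≥-lin^ k))

    ∣⇒Ord≥ : ∀ k p → (lin θ ^ₚ k) ∣ₚ p → Ord≥ k (T θ p)
    ∣⇒Ord≥ k p (q , e) = Ord≥-resp (S.trans (S.sym (T-*ₚ θ (lin θ ^ₚ k) q)) (T-cong θ ((lin θ ^ₚ k) *ₚ q) p e))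
      (≡.subst (λ m → Ord≥ m (T θ (lin θ ^ₚ k) ⊛ T θ q)) (ℕₚ.+-identityʳ k) (Ord≥-⊛ k 0 (Ord≥-lin^ k) (λ _ ())))

    IsOrd⇒Mult : ∀ {k} p → IsOrd (T θ p) k → Mult θ p k
    IsOrd⇒Mult {k} p (o , nz) = Ord≥⇒∣ k p o , λ d → nz (∣⇒Ord≥ (suc k) p d k ℕₚ.≤-refl)

    Mult⇒IsOrd : ∀ {k} p → Mult θ p k → IsOrd (T θ p) k
    Mult⇒IsOrd {k} p (d , nd) = ∣⇒Ord≥ k p d , λ e → nd (Ord≥⇒∣ (suc k) p (Ord≥-suc (∣⇒Ord≥ k p d) e))

-- Subsets

x∈p─q⁻ : ∀ {n} {x : Fin n} (p q : Subset n) → x ∈ p ─ q → x ∈ p × x ∉ q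
x∈p─q⁻ (true ∷ p)  (false ∷ q) here      = here , λ ()
x∈p─q⁻ (true ∷ p)  (false ∷ q) (there m) = let a , b = x∈p─q⁻ p q m in there a , λ { (there c) → b c }
x∈p─q⁻ (false ∷ p) (false ∷ q) (there m) = let a , b = x∈p─q⁻ p q m in there a , λ { (there c) → b c }
x∈p─q⁻ (s ∷ p)     (true ∷ q)  (there m) = let a , b = x∈p─q⁻ p q m in there a , λ { (there c) → b c }

x∈p-y⁻ : ∀ {n} {x : Fin n} (p : Subset n) y → x ∈ p - y → x ∈ p × x ≢ y
x∈p-y⁻ p y m = let a , b = x∈p─q⁻ p ⁅ y ⁆ m in a , λ { ≡.refl → b (x∈⁅x⁆ y) }

x∉p-x : ∀ {m} (p : Subset m) x → x ∉ p - x
x∉p-x p x m = proj₂ (x∈p-y⁻ p x m) ≡.refl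

lookup-∉ : ∀ {m} {x : Fin m} {p : Subset m} → x ∉ p → lookup p x ≡ false
lookup-∉ {x = x} {p} x∉p with lookup p x in eq
... | false = ≡.refl
... | true  = ⊥-elim (x∉p (lookup⇒[]= x p eq))

card-remove : ∀ {n} {u : Fin n} {X} → u ∈ X → ∣ X ∣ ≡ suc ∣ X - u ∣
card-remove {X = _ ∷ X} here = ≡.cong (suc ∘ ∣_∣) (≡.sym (p─⊥≡p X))
card-remove {X = true ∷ X}  (there m) = ≡.cong suc (card-remove m)
card-remove {X = false ∷ X} (there m) = card-remove m

⊆-ext : ∀ {m} {p q : Subset m} → (∀ x → x ∈ p → x ∈ q) → (∀ x → x ∈ q → x ∈ p) → p ≡ q
⊆-ext f g = ⊆-antisym (λ {x} → f x) (λ {x} → g x)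

∩-minus : ∀ {m} (Y X : Subset m) u → (Y - u) ∩ X ≡ (Y ∩ X) - u
∩-minus Y X u = ⊆-ext
  (λ x m → let a , b = x∈p∩q⁻ (Y - u) X m ; c , d = x∈p-y⁻ Y u a in x∈p∧x≢y⇒x∈p-y (x∈p∩q⁺ (c , b)) d)
  (λ x m → let a , b = x∈p-y⁻ (Y ∩ X) u m ; c , d = x∈p∩q⁻ Y X a in x∈p∩q⁺ (x∈p∧x≢y⇒x∈p-y c b , d))

─-minus-∈ : ∀ {m} (Y X : Subset m) u → u ∈ X → (Y - u) ─ X ≡ Y ─ X
─-minus-∈ Y X u u∈X = ⊆-ext
  (λ x m → let a , b = x∈p─q⁻ (Y - u) X m in x∈p∧x∉q⇒x∈p─q (proj₁ (x∈p-y⁻ Y u a)) b)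
  (λ x m → let a , b = x∈p─q⁻ Y X m in x∈p∧x∉q⇒x∈p─q (x∈p∧x≢y⇒x∈p-y a λ { ≡.refl → b u∈X }) b)

minus-∉ : ∀ {m} (Y : Subset m) u → u ∉ Y → Y - u ≡ Y
minus-∉ Y u u∉Y = ⊆-ext (λ x m → proj₁ (x∈p-y⁻ Y u m)) (λ x m → x∈p∧x≢y⇒x∈p-y m λ { ≡.refl → u∉Y m })

∩-minus-∉ : ∀ {m} (Y X : Subset m) u → u ∉ X → (Y - u) ∩ X ≡ Y ∩ X
∩-minus-∉ Y X u u∉X = ≡.trans (∩-minus Y X u) (minus-∉ (Y ∩ X) u (u∉X ∘ proj₂ ∘ x∈p∩q⁻ Y X))

-- No edge of G[Y] leaves X; for symmetric G this makes X ∩ Y a union of components of G[Y].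
Separates : ∀ {n} → Graph n → Subset n → Subset n → Set
Separates G X Y = ∀ i j → i ∈ Y → j ∈ Y → i ∈ X → G i j ≡ true → j ∈ X

Separates-minus : ∀ {n} {G : Graph n} {X Y} u → Separates G X Y → Separates G X (Y - u)
Separates-minus {Y = Y} u s i j a b = s i j (proj₁ (x∈p-y⁻ Y u a)) (proj₁ (x∈p-y⁻ Y u b))

-- Vertex-weighted matching sums

bool-ext : ∀ {a b} → (a ≡ true → b ≡ true) → (b ≡ true → a ≡ true) → a ≡ b
bool-ext {true}  {b}     f g = ≡.sym (f ≡.refl)
bool-ext {false} {true}  f g = g ≡.refl
bool-ext {false} {false} f g = ≡.refl

∧-true⁻ : ∀ {a b} → a ∧ b ≡ true → a ≡ true × b ≡ true
∧-true⁻ {true} {true} _ = ≡.refl , ≡.refl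

∧-true⁺ : ∀ {a b} → a ≡ true → b ≡ true → a ∧ b ≡ true
∧-true⁺ ≡.refl ≡.refl = ≡.refl

does-true⁻ : ∀ {p} {P : Set p} (d : Dec P) → does d ≡ true → P
does-true⁻ (yes p) _ = p

does-false⁻ : ∀ {p} {P : Set p} (d : Dec P) → does d ≡ false → ¬ P
does-false⁻ (no p) _ = p

Edge : ℕ → Set
Edge n = Fin n × Fin n

row : ∀ {n} → Fin n → List (Edge n)
row {n} i = map (i ,_) (filter (λ j → toℕ i ℕ.<? toℕ j) (allFin n))

ok : ∀ {n} → Graph n → Subset n → Edge n → Bool
ok G X (i , j) = G i j ∧ lookup X i ∧ lookup X j

del : ∀ {n} → Subset n → Edge n → Subset n
del X (i , j) = X - i - j

ok⁻ : ∀ {n} (G : Graph n) X e → ok G X e ≡ true → G (proj₁ e) (proj₂ e) ≡ true × proj₁ e ∈ X × proj₂ e ∈ X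
ok⁻ G X (i , j) p = let a , b = ∧-true⁻ p ; c , d = ∧-true⁻ b in a , lookup⇒[]= i X c , lookup⇒[]= j X d

ok⁺ : ∀ {n} (G : Graph n) X e → G (proj₁ e) (proj₂ e) ≡ true → proj₁ e ∈ X → proj₂ e ∈ X → ok G X e ≡ true
ok⁺ G X (i , j) a b c = ∧-true⁺ a (∧-true⁺ ([]=⇒lookup b) ([]=⇒lookup c))

del⁻ : ∀ {n} {x : Fin n} X e → x ∈ del X e → x ∈ X × x ≢ proj₁ e × x ≢ proj₂ e
del⁻ X (i , j) m = let a , b = x∈p-y⁻ (X - i) j m ; c , d = x∈p-y⁻ X i a in c , d , b

del⁺ : ∀ {n} {x : Fin n} X e → x ∈ X → x ≢ proj₁ e → x ≢ proj₂ e → x ∈ del X e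
del⁺ X (i , j) a b c = x∈p∧x≢y⇒x∈p-y (x∈p∧x≢y⇒x∈p-y a b) c

del-minus : ∀ {n} (X : Subset n) e u → del (X - u) e ≡ del X e - u
del-minus X (i , j) u = ≡.trans (≡.cong (_- j) (p─x─y≡p─y─x X u i)) (p─x─y≡p─y─x (X - i) u j)

del-comm : ∀ {n} (X : Subset n) e f → del (del X e) f ≡ del (del X f) e
del-comm X e (i , j) = ≡.trans (≡.cong (_- j) (≡.sym (del-minus X e i))) (≡.sym (del-minus (X - i) e j))

-- Both sides say that `e` and `f` are edges of G[X] without a common vertex.
ok-swap : ∀ {n} (G : Graph n) X e f → ok G X e ∧ ok G (del X e) f ≡ ok G X f ∧ ok G (del X f) e
ok-swap G X e f = bool-ext (half e f) (half f e)
  where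
  half : ∀ e f → ok G X e ∧ ok G (del X e) f ≡ true → ok G X f ∧ ok G (del X f) e ≡ true
  half e f p =
    let p₁ , p₂ = ∧-true⁻ p
        ge , e1 , e2 = ok⁻ G X e p₁
        gf , f1 , f2 = ok⁻ G (del X e) f p₂
        f1X , f1≢e1 , f1≢e2 = del⁻ X e f1
        f2X , f2≢e1 , f2≢e2 = del⁻ X e f2
    in ∧-true⁺ (ok⁺ G X f gf f1X f2X)
         (ok⁺ G (del X f) e ge (del⁺ X f e1 (f1≢e1 ∘ ≡.sym) (f2≢e1 ∘ ≡.sym))
                               (del⁺ X f e2 (f1≢e2 ∘ ≡.sym) (f2≢e2 ∘ ≡.sym)))

module MatchingSum {c ℓ : Level} (C : CommutativeRing c ℓ) where
  open CommutativeRing C hiding (zero; _-_)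
  open import Algebra.Properties.Semiring.Sum semiring using (sum; sum-cong-≋; ∑-distrib-+; sum-replicate-zero)
  open import Algebra.Properties.Ring ring using (-‿+-comm; -‿distribʳ-*; -0#≈0#)
  open import Algebra.Solver.Ring.NaturalCoefficients.Default commutativeSemiring using (solve; _:=_; _:+_; _:*_)
  open import Relation.Binary.Reasoning.Setoid setoid

  when : Bool → Carrier → Carrier
  when true  a = a
  when false a = 0#

  when-cong : ∀ b {x y} → x ≈ y → when b x ≈ when b y
  when-cong true  e = e
  when-cong false e = refl

  when-≡ : ∀ {a b} x → a ≡ b → when a x ≈ when b x
  when-≡ x ≡.refl = refl

  when-nest : ∀ a b c d x → a ∧ b ≡ c ∧ d → when a (when b x) ≡ when c (when d x)
  when-nest true  b     true  d     x ≡.refl = ≡.refl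
  when-nest true  true  false d     x ()
  when-nest true  false false d     x p      = ≡.refl
  when-nest false b     true  true  x ()
  when-nest false b     true  false x p      = ≡.refl
  when-nest false b     false d     x p      = ≡.refl

  when-+ : ∀ b x y → when b (x + y) ≈ when b x + when b y
  when-+ true  x y = refl
  when-+ false x y = sym (+-identityˡ _)

  when-neg : ∀ b x → when b (- x) ≈ - when b x
  when-neg true  x = refl
  when-neg false x = sym -0#≈0#

  when-* : ∀ b x y → when b (x * y) ≈ x * when b y
  when-* true  x y = refl
  when-* false x y = sym (zeroʳ x)

  sum-≈0 : ∀ {n} (t : Fin n → Carrier) → (∀ i → t i ≈ 0#) → sum t ≈ 0#
  sum-≈0 {n} t e = trans (sum-cong-≋ e) (sum-replicate-zero n)

  sum-delta : ∀ {n} (u : Fin n) (g : Fin n → Carrier) → sum (λ i → when (does (i ≟ u)) (g i)) ≈ g u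
  sum-delta {suc n} zero g = trans (+-congˡ (sum-≈0 {n} (λ _ → 0#) (λ i → refl))) (+-identityʳ _)
  sum-delta (suc u) g = trans (+-identityˡ _) (sum-delta u (g ∘ suc))

  sum-when : ∀ b {m} (g : Fin m → Carrier) → sum (λ j → when b (g j)) ≈ when b (sum g)
  sum-when true      g = refl
  sum-when false {m} g = sum-≈0 {m} (λ _ → 0#) (λ _ → refl)

  sumL : ∀ {A : Set} → (A → Carrier) → List A → Carrier
  sumL f []       = 0#
  sumL f (x ∷ xs) = f x + sumL f xs

  sumL-cong : ∀ {A : Set} {f g : A → Carrier} → (∀ x → f x ≈ g x) → ∀ xs → sumL f xs ≈ sumL g xs
  sumL-cong e []       = refl
  sumL-cong e (x ∷ xs) = +-cong (e x) (sumL-cong e xs)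

  sumL-+ : ∀ {A : Set} (f g : A → Carrier) xs → sumL (λ x → f x + g x) xs ≈ sumL f xs + sumL g xs
  sumL-+ f g []       = sym (+-identityˡ _)
  sumL-+ f g (x ∷ xs) = trans (+-congˡ (sumL-+ f g xs))
    (solve 4 (λ a b p q → (a :+ b) :+ (p :+ q) := (a :+ p) :+ (b :+ q)) refl _ _ _ _)

  sumL-neg : ∀ {A : Set} (f : A → Carrier) xs → sumL (λ x → - f x) xs ≈ - sumL f xs
  sumL-neg f []       = sym -0#≈0#
  sumL-neg f (x ∷ xs) = trans (+-congˡ (sumL-neg f xs)) (-‿+-comm _ _)

  sumL-when : ∀ {A : Set} b (f : A → Carrier) xs → sumL (λ x → when b (f x)) xs ≈ when b (sumL f xs)
  sumL-when true  f xs       = refl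
  sumL-when false f []       = refl
  sumL-when false f (x ∷ xs) = trans (+-identityˡ _) (sumL-when false f xs)

  sumL-++ : ∀ {A : Set} (f : A → Carrier) xs ys → sumL f (xs ++ ys) ≈ sumL f xs + sumL f ys
  sumL-++ f []       ys = sym (+-identityˡ _)
  sumL-++ f (x ∷ xs) ys = trans (+-congˡ (sumL-++ f xs ys)) (sym (+-assoc _ _ _))

  sumL-map : ∀ {A B : Set} (f : B → Carrier) (h : A → B) xs → sumL f (map h xs) ≈ sumL (f ∘ h) xs
  sumL-map f h []       = refl
  sumL-map f h (x ∷ xs) = +-congˡ (sumL-map f h xs)

  sumL-concatMap : ∀ {A B : Set} (f : B → Carrier) (h : A → List B) xs →
                   sumL f (concatMap h xs) ≈ sumL (λ x → sumL f (h x)) xs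
  sumL-concatMap f h []       = refl
  sumL-concatMap f h (x ∷ xs) = trans (sumL-++ f (h x) (concatMap h xs)) (+-congˡ (sumL-concatMap f h xs))

  sumL-filter : ∀ {A : Set} {P : A → Set} (P? : ∀ x → Dec (P x)) (f : A → Carrier) xs →
                sumL f (filter P? xs) ≈ sumL (λ x → when (does (P? x)) (f x)) xs
  sumL-filter P? f []       = refl
  sumL-filter P? f (x ∷ xs) with does (P? x)
  ... | true  = +-congˡ (sumL-filter P? f xs)
  ... | false = trans (sumL-filter P? f xs) (sym (+-identityˡ _))

  sumL-tabulate : ∀ {A : Set} {n} (f : A → Carrier) (g : Fin n → A) → sumL f (tabulate g) ≈ sum (f ∘ g)
  sumL-tabulate {n = zero}  f g = refl
  sumL-tabulate {n = suc n} f g = +-congˡ (sumL-tabulate f (g ∘ suc))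

  sumL-allPairs : ∀ n (f : Edge n → Carrier) →
    sumL f (allPairs n) ≈ sum (λ i → sum (λ j → when (does (toℕ i ℕ.<? toℕ j)) (f (i , j))))
  sumL-allPairs n f = trans (sumL-concatMap f row (allFin n))
      (trans (sumL-tabulate (λ i → sumL f (row i)) id) (sum-cong-≋ λ i →
    trans (sumL-map f (i ,_) (filter (λ j → toℕ i ℕ.<? toℕ j) (allFin n)))
      (trans (sumL-filter (λ j → toℕ i ℕ.<? toℕ j) (λ j → f (i , j)) (allFin n))
             (sumL-tabulate (λ j → when (does (toℕ i ℕ.<? toℕ j)) (f (i , j))) id))))

  ∏ : ∀ {n} → Subset n → (Fin n → Carrier) → Carrier
  ∏ []      y = 1#
  ∏ (b ∷ X) y = (if b then y zero else 1#) * ∏ X (y ∘ suc)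

  ∏-remove : ∀ {n} {u : Fin n} {X} y → u ∈ X → ∏ X y ≈ y u * ∏ (X - u) y
  ∏-remove {X = _ ∷ X} y here = *-congˡ (sym (trans (*-identityˡ _)
      (reflexive (≡.cong (λ Z → ∏ Z (y ∘ suc)) (p─⊥≡p X)))))
  ∏-remove {X = b ∷ X} y (there m) = trans (*-congˡ (∏-remove (y ∘ suc) m))
    (solve 3 (λ a b c → a :* (b :* c) := b :* (a :* c)) refl _ _ _)

  ∏-cong : ∀ {n} (X : Subset n) {y y′} → (∀ z → z ∈ X → y z ≈ y′ z) → ∏ X y ≈ ∏ X y′
  ∏-cong []          e = refl
  ∏-cong (true ∷ X)  e = *-cong (e zero here) (∏-cong X λ z m → e (suc z) (there m))
  ∏-cong (false ∷ X) e = *-congˡ (∏-cong X λ z m → e (suc z) (there m))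

  -- The multivariate matching polynomial: the sum over matchings M of G[X] with edges from the list
  -- of (-1)^|M| times the product of `y` over the uncovered vertices. The recursion decides for
  -- each listed edge whether M uses it.
  Φ : ∀ {n} → Graph n → (Fin n → Carrier) → List (Edge n) → Subset n → Carrier
  Φ G y []      X = ∏ X y
  Φ G y (e ∷ L) X = Φ G y L X + - when (ok G X e) (Φ G y L (del X e))

  Φ-cong : ∀ {n} {G G′ : Graph n} {y y′} L X →
           (∀ i j → i ∈ X → j ∈ X → G i j ≡ G′ i j) → (∀ z → z ∈ X → y z ≈ y′ z) →
           Φ G y L X ≈ Φ G′ y′ L X
  Φ-cong []      X eG ey = ∏-cong X ey
  Φ-cong {G = G} {G′} (e ∷ L) X eG ey = +-cong (Φ-cong L X eG ey) (-‿cong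
    (trans (when-cong (ok G X e) (Φ-cong L (del X e)
              (λ i j a b → eG i j (proj₁ (del⁻ X e a)) (proj₁ (del⁻ X e b)))
              (λ z m → ey z (proj₁ (del⁻ X e m)))))
           (when-≡ _ (bool-ext
             (λ p → let a , b , c = ok⁻ G X e p in ok⁺ G′ X e (≡.trans (≡.sym (eG _ _ b c)) a) b c)
             (λ p → let a , b , c = ok⁻ G′ X e p in ok⁺ G X e (≡.trans (eG _ _ b c) a) b c)))))

  module _ {n : ℕ} (G : Graph n) (u : Fin n) where

    touches : Edge n → Bool
    touches (i , j) = does (i ≟ u) ∨ does (j ≟ u)

    -- `φ` is kept abstract because in the induction the list that is summed over becomes shorter
    -- than the list inside `Φ`.
    incident : Subset n → (Subset n → Carrier) → Edge n → Carrier
    incident X φ e = when (ok G X e ∧ touches e) (φ (del X e))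

    touches⁻ : ∀ e → touches e ≡ true → proj₁ e ≡ u ⊎ proj₂ e ≡ u
    touches⁻ (i , j) p with i ≟ u
    ... | yes q = inj₁ q
    ... | no  q = inj₂ (does-true⁻ (j ≟ u) p)

    touches-false⁻ : ∀ e → touches e ≡ false → proj₁ e ≢ u × proj₂ e ≢ u
    touches-false⁻ (i , j) p with i ≟ u | j ≟ u
    ... | no q | no r = q , r

    ok-avoid : ∀ X e → touches e ≡ true → u ∉ X → ok G X e ≡ false
    ok-avoid X e t u∉X with ok G X e in eq
    ... | false = ≡.refl
    ... | true with ok⁻ G X e eq | touches⁻ e t
    ...   | _ , a , b | inj₁ ≡.refl = ⊥-elim (u∉X a)
    ...   | _ , a , b | inj₂ ≡.refl = ⊥-elim (u∉X b)

    Φ-avoid : ∀ y L X e → touches e ≡ true → u ∉ X → Φ G y (e ∷ L) X ≈ Φ G y L X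
    Φ-avoid y L X e t u∉X = trans (+-congˡ (trans (-‿cong (when-≡ (Φ G y L (del X e)) (ok-avoid X e t u∉X)))
        -0#≈0#)) (+-identityʳ _)

    u∉del : ∀ X e → touches e ≡ true → u ∉ del X e
    u∉del X e t m with del⁻ X e m | touches⁻ e t
    ... | _ , a , b | inj₁ p = a (≡.sym p)
    ... | _ , a , b | inj₂ p = b (≡.sym p)

    incident-cong : ∀ X φ ψ e → (u ∉ del X e → φ (del X e) ≈ ψ (del X e)) → incident X φ e ≈ incident X ψ e
    incident-cong X φ ψ e p with touches e in eq
    ... | true  = when-cong (ok G X e ∧ true) (p (u∉del X e eq))
    ... | false with ok G X e
    ...   | true  = refl
    ...   | false = refl

    -- Induction on the edge list. If `e` touches `u`, its term in `Φ` cancels the new incident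
    -- term, and all other terms ignore `e` since `u` has gone from their sets. Otherwise the
    -- induction hypothesis is used twice, for `X` and for `del X e`.
    Φ-vertexL : ∀ y L X → u ∈ X → Φ G y L X + sumL (incident X (Φ G y L)) L ≈ y u * Φ G y L (X - u)
    Φ-vertexL y []      X u∈X = trans (+-identityʳ _) (∏-remove y u∈X)
    Φ-vertexL y (e ∷ L) X u∈X with touches e in eq
    ... | true = begin
      (A + (- B)) + (when (ok G X e ∧ true) (Φ G y (e ∷ L) (del X e)) + sumL (incident X (Φ G y (e ∷ L))) L)
        ≈⟨ +-congˡ (+-cong (trans (when-≡ (Φ G y (e ∷ L) (del X e)) (∧-identityʳ (ok G X e)))
            (when-cong (ok G X e) (Φ-avoid y L _ e eq (u∉del X e eq))))
                           (sumL-cong (λ f → incident-cong X (Φ G y (e ∷ L)) (Φ G y L) f (Φ-avoid y L _ e eq)) L)) ⟩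
      (A + (- B)) + (B + I)
        ≈⟨ solve 4 (λ a m b i → (a :+ m) :+ (b :+ i) := (a :+ i) :+ (b :+ m)) refl A (- B) B I ⟩
      (A + I) + (B + (- B))  ≈⟨ trans (+-congˡ (-‿inverseʳ B)) (+-identityʳ _) ⟩
      A + I                  ≈⟨ Φ-vertexL y L X u∈X ⟩
      y u * Φ G y L (X - u)  ≈⟨ *-congˡ (sym (Φ-avoid y L (X - u) e eq (λ m → proj₂ (x∈p-y⁻ X u m) ≡.refl))) ⟩
      y u * Φ G y (e ∷ L) (X - u) ∎
      where
      A = Φ G y L X
      B = when (ok G X e) (Φ G y L (del X e))
      I = sumL (incident X (Φ G y L)) L
    ... | false = begin
      (A + (- B)) + (when (ok G X e ∧ false) _ + sumL (incident X (Φ G y (e ∷ L))) L)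
        ≈⟨ +-congˡ (+-cong (when-≡ (Φ G y (e ∷ L) (del X e)) (∧-zeroʳ (ok G X e))) swap) ⟩
      (A + (- B)) + (0# + (I + (- when (ok G X e) J)))
        ≈⟨ trans (+-congˡ (+-identityˡ _)) (solve 4 (λ a b i j → (a :+ b) :+ (i :+ j) := (a :+ i) :+ (b :+ j)) refl
            A (- B) I _) ⟩
      (A + I) + ((- B) + (- when (ok G X e) J))
        ≈⟨ +-cong (Φ-vertexL y L X u∈X) (trans (-‿+-comm _ _) (-‿cong (trans (sym (when-+ (ok G X e) _ _))
              (trans (when-cong (ok G X e) (Φ-vertexL y L (del X e) u∈del)) (when-* (ok G X e) _ _))))) ⟩
      y u * Φ G y L (X - u) + (- (y u * when (ok G X e) (Φ G y L (del X e - u))))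
        ≈⟨ +-congˡ (-‿cong (*-congˡ (reflexive
            (≡.cong₂ (λ b Z → when b (Φ G y L Z)) ok-minus (≡.sym (del-minus X e u)))))) ⟩
      y u * Φ G y L (X - u) + (- (y u * B′))   ≈⟨ +-congˡ (-‿distribʳ-* _ _) ⟩
      y u * Φ G y L (X - u) + y u * (- B′)     ≈⟨ sym (distribˡ _ _ _) ⟩
      y u * (Φ G y L (X - u) + (- B′)) ∎
      where
      A = Φ G y L X
      B = when (ok G X e) (Φ G y L (del X e))
      B′ = when (ok G (X - u) e) (Φ G y L (del (X - u) e))
      I = sumL (incident X (Φ G y L)) L
      J = sumL (incident (del X e) (Φ G y L)) L
      u≢e = touches-false⁻ e eq
      u∈del : u ∈ del X e
      u∈del = del⁺ X e u∈X (proj₁ u≢e ∘ ≡.sym) (proj₂ u≢e ∘ ≡.sym)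
      ok-minus : ok G X e ≡ ok G (X - u) e
      ok-minus = bool-ext
        (λ p → let a , b , c = ok⁻ G X e p
            in ok⁺ G (X - u) e a (x∈p∧x≢y⇒x∈p-y b (proj₁ u≢e)) (x∈p∧x≢y⇒x∈p-y c (proj₂ u≢e)))
        (λ p → let a , b , c = ok⁻ G (X - u) e p in ok⁺ G X e a (proj₁ (x∈p-y⁻ X u b)) (proj₁ (x∈p-y⁻ X u c)))
      regroup : ∀ a b c d x → a ∧ b ≡ c ∧ d → ∀ t → when (a ∧ t) (when b x) ≡ when c (when (d ∧ t) x)
      regroup true  true  true  true  x p t     = ≡.refl
      regroup true  false false d     x p true  = ≡.refl
      regroup true  false false d     x p false = ≡.refl
      regroup true  false true  false x p true  = ≡.refl
      regroup true  false true  false x p false = ≡.refl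
      regroup false b     true  false x p t     = ≡.refl
      regroup false b     false d     x p t     = ≡.refl
      term : ∀ f → incident X (Φ G y (e ∷ L)) f ≈ incident X (Φ G y L) f +
          (- when (ok G X e) (incident (del X e) (Φ G y L) f))
      term f = trans (when-+ (ok G X f ∧ touches f) _ _)
          (+-congˡ (trans (when-neg (ok G X f ∧ touches f) _) (-‿cong (reflexive (≡.trans
        (≡.cong (λ Z → when (ok G X f ∧ touches f) (when (ok G (del X f) e) (Φ G y L Z))) (del-comm X f e))
        (regroup (ok G X f) _ (ok G X e) _ _ (ok-swap G X f e) (touches f)))))))
      -- Using `f` and then `e` amounts to using `e` and then `f`, so what `e` contributes to the
      -- incident terms is the incident sum of `del X e`.
      swap : sumL (incident X (Φ G y (e ∷ L))) L ≈ I + (- when (ok G X e) J)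
      swap = trans (sumL-cong term L) (trans (sumL-+ _ _ L)
          (+-congˡ (trans (sumL-neg _ L) (-‿cong (sumL-when (ok G X e) _ L)))))

  μΦ : ∀ {n} → Graph n → (Fin n → Carrier) → Subset n → Carrier
  μΦ {n} G y = Φ G y (allPairs n)

  nbr : ∀ {n} → Graph n → Subset n → Fin n → Fin n → Bool
  nbr G X u z = lookup X z ∧ G u z

  nbr⁻ : ∀ {n} (G : Graph n) X u z → nbr G X u z ≡ true → z ∈ X × G u z ≡ true
  nbr⁻ G X u z p = let a , b = ∧-true⁻ p in lookup⇒[]= z X a , b

  nbr⁺ : ∀ {n} (G : Graph n) X u z → z ∈ X → G u z ≡ true → nbr G X u z ≡ true
  nbr⁺ G X u z a b = ∧-true⁺ ([]=⇒lookup a) b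

  module _ {n : ℕ} (G : Graph n) (G-sym : ∀ i j → G i j ≡ G j i) (X : Subset n) (u : Fin n) (u∈X : u ∈ X)
      (φ : Subset n → Carrier) where

    private
      h : Fin n → Carrier
      h z = when (nbr G (X - u) u z) (φ (X - u - z))

      hu≈0 : h u ≈ 0#
      hu≈0 with nbr G (X - u) u u in eq
      ... | false = refl
      ... | true  = ⊥-elim (proj₂ (x∈p-y⁻ X u (proj₁ (nbr⁻ G (X - u) u u eq))) ≡.refl)

      lt : Fin n → Fin n → Bool
      lt i j = does (toℕ i ℕ.<? toℕ j)

      lt⁻ : ∀ i j → lt i j ≡ true → toℕ i ℕ.< toℕ j
      lt⁻ i j = does-true⁻ (toℕ i ℕ.<? toℕ j)

      lt-false⁻ : ∀ i j → lt i j ≡ false → toℕ j ℕ.≤ toℕ i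
      lt-false⁻ i j p = ℕₚ.≮⇒≥ (does-false⁻ (toℕ i ℕ.<? toℕ j) p)

      ok-left : ∀ j → u ≢ j → ok G X (u , j) ≡ nbr G (X - u) u j
      ok-left j u≢j = bool-ext
        (λ p → let a , b , c = ok⁻ G X (u , j) p in nbr⁺ G (X - u) u j (x∈p∧x≢y⇒x∈p-y c (u≢j ∘ ≡.sym)) a)
        (λ p → let a , b = nbr⁻ G (X - u) u j p in ok⁺ G X (u , j) b u∈X (proj₁ (x∈p-y⁻ X u a)))

      ok-right : ∀ i → u ≢ i → ok G X (i , u) ≡ nbr G (X - u) u i
      ok-right i u≢i = bool-ext
        (λ p → let a , b , c = ok⁻ G X (i , u) p
            in nbr⁺ G (X - u) u i (x∈p∧x≢y⇒x∈p-y b (u≢i ∘ ≡.sym)) (≡.trans (G-sym u i) a))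
        (λ p → let a , b = nbr⁻ G (X - u) u i p in ok⁺ G X (i , u) (≡.trans (G-sym i u) b) (proj₁ (x∈p-y⁻ X u a)) u∈X)

      -- `allPairs` lists each pair once, smaller vertex first, so an edge at `u` occurs either as
      -- (u , j) or as (i , u); the two deltas record which.
      pair : ∀ i j → when (lt i j) (incident G u X φ (i , j)) ≈
                     when (does (i ≟ u)) (when (lt u j) (h j)) + when (does (j ≟ u)) (when (lt i u) (h i))
      pair i j with i ≟ u | j ≟ u
      ... | yes ≡.refl | yes ≡.refl with lt u u in eq
      ...   | true  = ⊥-elim (ℕₚ.<-irrefl ≡.refl (lt⁻ u u eq))
      ...   | false = sym (+-identityˡ _)
      pair i j | yes ≡.refl | no q = trans (when-cong (lt i j) (reflexive (≡.trans
        (≡.cong (λ b → when b (φ (X - u - j))) (∧-identityʳ (ok G X (u , j))))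
            (≡.cong (λ b → when b (φ (X - u - j))) (ok-left j (q ∘ ≡.sym)))))) (sym (+-identityʳ _))
      pair i j | no p | yes ≡.refl = trans (when-cong (lt i j) (reflexive (≡.trans
        (≡.cong (λ b → when b (φ (X - i - u))) (∧-identityʳ (ok G X (i , u))))
            (≡.cong₂ (λ b Z → when b (φ Z)) (ok-right i (p ∘ ≡.sym)) (p─x─y≡p─y─x X i u))))) (sym (+-identityˡ _))
      pair i j | no p | no q = trans (when-cong (lt i j) (when-≡ (φ (X - i - j)) (∧-zeroʳ (ok G X (i , j)))))
          (trans (lem (lt i j)) (sym (+-identityˡ _)))
        where
        lem : ∀ b → when b 0# ≈ 0#
        lem true  = refl
        lem false = refl

      tri : ∀ z → when (lt u z) (h z) + when (lt z u) (h z) ≈ h z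
      tri z with lt u z in p | lt z u in q
      ... | true  | true  = ⊥-elim (ℕₚ.<-asym (lt⁻ u z p) (lt⁻ z u q))
      ... | true  | false = +-identityʳ _
      ... | false | true  = +-identityˡ _
      ... | false | false with Finₚ.toℕ-injective (ℕₚ.≤-antisym (lt-false⁻ u z p) (lt-false⁻ z u q))
      -- Neither order holds only for z = u, and `u` does not lie in `X - u`.
      ...   | ≡.refl = trans (+-identityˡ _) (sym hu≈0)

      sum-swap-delta : ∀ (g : Fin n → Carrier) → sum (λ i → sum (λ j → when (does (i ≟ u)) (g j))) ≈ sum g
      sum-swap-delta g = trans (sum-cong-≋ λ i → sum-when (does (i ≟ u)) g) (sum-delta u (λ _ → sum g))

    incident-sum : sumL (incident G u X φ) (allPairs n) ≈ sum h
    incident-sum = begin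
      sumL (incident G u X φ) (allPairs n)
        ≈⟨ sumL-allPairs n _ ⟩
      sum (λ i → sum (λ j → when (lt i j) (incident G u X φ (i , j))))
        ≈⟨ sum-cong-≋ (λ i → trans (sum-cong-≋ (λ j → pair i j)) (∑-distrib-+ {n} _ _)) ⟩
      sum (λ i → sum (λ j → when (does (i ≟ u)) (when (lt u j) (h j))) + sum
          (λ j → when (does (j ≟ u)) (when (lt i u) (h i))))
        ≈⟨ ∑-distrib-+ {n} _ _ ⟩
      sum (λ i → sum (λ j → when (does (i ≟ u)) (when (lt u j) (h j)))) + sum
          (λ i → sum (λ j → when (does (j ≟ u)) (when (lt i u) (h i))))
        ≈⟨ +-cong (sum-swap-delta (λ j → when (lt u j) (h j)))
            (sum-cong-≋ λ i → sum-delta u (λ _ → when (lt i u) (h i))) ⟩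
      sum (λ j → when (lt u j) (h j)) + sum (λ i → when (lt i u) (h i))
        ≈⟨ sym (∑-distrib-+ {n} _ _) ⟩
      sum (λ z → when (lt u z) (h z) + when (lt z u) (h z))
        ≈⟨ sum-cong-≋ tri ⟩
      sum h ∎

  μΦ-vertex : ∀ {n} (G : Graph n) → (∀ i j → G i j ≡ G j i) → ∀ y X u → u ∈ X →
    μΦ G y X + sum (λ z → when (nbr G (X - u) u z) (μΦ G y (X - u - z))) ≈ y u * μΦ G y (X - u)
  μΦ-vertex {n} G G-sym y X u u∈X = trans (+-congˡ (sym (incident-sum G G-sym X u u∈X (μΦ G y))))
    (Φ-vertexL G u y (allPairs n) X u∈X)

-- The matching polynomial as a matching sum

card-del : ∀ {n} (X : Subset n) e → proj₁ e ≢ proj₂ e → proj₁ e ∈ X → proj₂ e ∈ X → ∣ X ∣ ≡ suc (suc ∣ del X e ∣)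
card-del X (i , j) i≢j i∈X j∈X = ≡.trans (card-remove i∈X)
    (≡.cong suc (card-remove (x∈p∧x≢y⇒x∈p-y j∈X (i≢j ∘ ≡.sym))))

cnt : {A : Set} → (A → Bool) → List A → ℕ
cnt p []       = 0
cnt p (x ∷ xs) = (if p x then 1 else 0) ℕ.+ cnt p xs

length-filter≡cnt : ∀ {A : Set} (p : A → Bool) xs → length (filter (λ x → p x Bool.≟ true) xs) ≡ cnt p xs
length-filter≡cnt p []       = ≡.refl
length-filter≡cnt p (x ∷ xs) with p x
... | true  = ≡.cong suc (length-filter≡cnt p xs)
... | false = length-filter≡cnt p xs

cnt-++ : ∀ {A : Set} (p : A → Bool) xs ys → cnt p (xs ++ ys) ≡ cnt p xs ℕ.+ cnt p ys
cnt-++ p []       ys = ≡.refl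
cnt-++ p (x ∷ xs) ys = ≡.trans (≡.cong (b ℕ.+_) (cnt-++ p xs ys)) (≡.sym (ℕₚ.+-assoc b _ _))
  where b = if p x then 1 else 0

cnt-map : ∀ {A B : Set} (p : B → Bool) (f : A → B) xs → cnt p (map f xs) ≡ cnt (p ∘ f) xs
cnt-map p f []       = ≡.refl
cnt-map p f (x ∷ xs) = ≡.cong ((if p (f x) then 1 else 0) ℕ.+_) (cnt-map p f xs)

cnt-cong : ∀ {A : Set} {p q : A → Bool} → (∀ x → p x ≡ q x) → ∀ xs → cnt p xs ≡ cnt q xs
cnt-cong e []       = ≡.refl
cnt-cong e (x ∷ xs) = ≡.cong₂ (λ b m → (if b then 1 else 0) ℕ.+ m) (e x) (cnt-cong e xs)

cnt-false : ∀ {A : Set} (xs : List A) → cnt (λ _ → false) xs ≡ 0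
cnt-false []       = ≡.refl
cnt-false (x ∷ xs) = cnt-false xs

∨-false⁻ : ∀ {a b} → a ∨ b ≡ false → a ≡ false × b ≡ false
∨-false⁻ {false} {false} _ = ≡.refl , ≡.refl

∨-false⁺ : ∀ {a b} → a ≡ false → b ≡ false → a ∨ b ≡ false
∨-false⁺ ≡.refl ≡.refl = ≡.refl

not-true⁻ : ∀ {a} → not a ≡ true → a ≡ false
not-true⁻ {false} _ = ≡.refl

module _ {n : ℕ} (G : Graph n) where

  allᵇ-del⁺ : ∀ X e E → allᵇ (ok G X) E ≡ true → elemᵇ (proj₁ e) (endpoints E) ≡ false → elemᵇ (proj₂ e)
      (endpoints E) ≡ false →
              allᵇ (ok G (del X e)) E ≡ true
  allᵇ-del⁺ X e []      p q r = ≡.refl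
  allᵇ-del⁺ X e (f ∷ E) p q r =
    let p₁ , p₂ = ∧-true⁻ p
        q₁ , q′ = ∨-false⁻ q
        q₂ , q₃ = ∨-false⁻ q′
        r₁ , r′ = ∨-false⁻ r
        r₂ , r₃ = ∨-false⁻ r′
        g , f₁ , f₂ = ok⁻ G X f p₁
    in ∧-true⁺ (ok⁺ G (del X e) f g
                  (del⁺ X e f₁ (does-false⁻ (_ ≟ _) q₁ ∘ ≡.sym) (does-false⁻ (_ ≟ _) r₁ ∘ ≡.sym))
                  (del⁺ X e f₂ (does-false⁻ (_ ≟ _) q₂ ∘ ≡.sym) (does-false⁻ (_ ≟ _) r₂ ∘ ≡.sym)))
               (allᵇ-del⁺ X e E p₂ q₃ r₃)

  allᵇ-del⁻ : ∀ X e E → allᵇ (ok G (del X e)) E ≡ true →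
              allᵇ (ok G X) E ≡ true × elemᵇ (proj₁ e) (endpoints E) ≡ false × elemᵇ (proj₂ e) (endpoints E) ≡ false
  allᵇ-del⁻ X e []      p = ≡.refl , ≡.refl , ≡.refl
  allᵇ-del⁻ X e (f ∷ E) p =
    let p₁ , p₂ = ∧-true⁻ p
        g , f₁ , f₂ = ok⁻ G (del X e) f p₁
        a , b , c = allᵇ-del⁻ X e E p₂
        x₁ , y₁ , z₁ = del⁻ X e f₁
        x₂ , y₂ , z₂ = del⁻ X e f₂
    in ∧-true⁺ (ok⁺ G X f g x₁ x₂) a ,
       ∨-false⁺ (dec-false (_ ≟ _) (y₁ ∘ ≡.sym)) (∨-false⁺ (dec-false (_ ≟ _) (y₂ ∘ ≡.sym)) b) ,
       ∨-false⁺ (dec-false (_ ≟ _) (z₁ ∘ ≡.sym)) (∨-false⁺ (dec-false (_ ≟ _) (z₂ ∘ ≡.sym)) c)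

  isMatching-zero : ∀ X e E → isMatchingᵇ G X 0 (e ∷ E) ≡ false
  isMatching-zero X e E with isMatchingᵇ G X 0 (e ∷ E) in eq
  ... | false = ≡.refl
  ... | true with ∧-true⁻ {allᵇ (ok G X) (e ∷ E)} eq
  ...   | _ , q with ∧-true⁻ {noDupᵇ (endpoints (e ∷ E))} q
  ...     | _ , ()

  -- Removing the ends of `e` turns freedom from duplicates into membership: later edges avoid `e`
  -- exactly when their ends survive in `del X e`.
  isMatching-suc : ∀ X e r E → proj₁ e ≢ proj₂ e →
                   isMatchingᵇ G X (suc r) (e ∷ E) ≡ ok G X e ∧ isMatchingᵇ G (del X e) r E
  isMatching-suc X e r E i≢j = bool-ext fwd bwd
    where
    fwd : isMatchingᵇ G X (suc r) (e ∷ E) ≡ true → ok G X e ∧ isMatchingᵇ G (del X e) r E ≡ true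
    fwd p =
      let a , b = ∧-true⁻ {allᵇ (ok G X) (e ∷ E)} p
          a₁ , a₂ = ∧-true⁻ {ok G X e} a
          c , d = ∧-true⁻ {noDupᵇ (endpoints (e ∷ E))} b
          c₁ , c′ = ∧-true⁻ {not (elemᵇ (proj₁ e) (proj₂ e ∷ endpoints E))} c
          c₂ , c₃ = ∧-true⁻ {not (elemᵇ (proj₂ e) (endpoints E))} c′
      in ∧-true⁺ a₁ (∧-true⁺ (allᵇ-del⁺ X e E a₂ (proj₂ (∨-false⁻ {does (proj₁ e ≟ proj₂ e)} (not-true⁻ c₁)))
          (not-true⁻ c₂)) (∧-true⁺ c₃ d))
    bwd : ok G X e ∧ isMatchingᵇ G (del X e) r E ≡ true → isMatchingᵇ G X (suc r) (e ∷ E) ≡ true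
    bwd p =
      let a₁ , b = ∧-true⁻ {ok G X e} p
          b₁ , b′ = ∧-true⁻ {allᵇ (ok G (del X e)) E} b
          c₃ , d = ∧-true⁻ {noDupᵇ (endpoints E)} b′
          a₂ , c₁ , c₂ = allᵇ-del⁻ X e E b₁
      in ∧-true⁺ (∧-true⁺ a₁ a₂) (∧-true⁺ (∧-true⁺ (≡.cong not (∨-false⁺ (dec-false (_ ≟ _) i≢j) c₁))
          (∧-true⁺ (≡.cong not c₂) c₃)) d)

  count : List (Edge n) → Subset n → ℕ → ℕ
  count L X r = cnt (isMatchingᵇ G X r) (sublists L)

  numMatchings≡count : ∀ X r → numMatchings G X r ≡ count (allPairs n) X r
  numMatchings≡count X r = length-filter≡cnt (isMatchingᵇ G X r) (sublists (allPairs n))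

  count-zero : ∀ e L X → count (e ∷ L) X 0 ≡ count L X 0
  count-zero e L X = ≡.trans (cnt-++ _ (sublists L) _) (≡.trans (≡.cong (count L X 0 ℕ.+_)
    (≡.trans (cnt-map _ (e ∷_) (sublists L)) (≡.trans (cnt-cong (isMatching-zero X e) (sublists L))
        (cnt-false (sublists L)))))
    (ℕₚ.+-identityʳ _))

  -- Sublists without `e` and sublists with `e`: the dichotomy that defines `Φ`.
  count-suc : ∀ e L X r → proj₁ e ≢ proj₂ e →
    count (e ∷ L) X (suc r) ≡ count L X (suc r) ℕ.+ (if ok G X e then count L (del X e) r else 0)
  count-suc e L X r i≢j = ≡.trans (cnt-++ _ (sublists L) _) (≡.cong (count L X (suc r) ℕ.+_)
    (≡.trans (cnt-map _ (e ∷_) (sublists L)) (≡.trans (cnt-cong (λ E → isMatching-suc X e r E i≢j) (sublists L))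
        (lem (ok G X e)))))
    where
    lem : ∀ b → cnt (λ E → b ∧ isMatchingᵇ G (del X e) r E) (sublists L) ≡ (if b then count L (del X e) r else 0)
    lem true  = ≡.refl
    lem false = cnt-false (sublists L)

allPairs-distinct : ∀ n → All (λ e → proj₁ e ≢ proj₂ e) (allPairs n)
allPairs-distinct n = concat⁺ {xss = map row (allFin n)} (map⁺ {f = row} (tabulate⁺ {f = id} λ i →
  map⁺ {f = i ,_} (All.map (λ { p ≡.refl → ℕₚ.<-irrefl ≡.refl p }) (all-filter (λ j → toℕ i ℕ.<? toℕ j) (allFin n)))))

module Link {ℓ : Level} (R : RealField ℓ) (θ : RealField.Carrier R) where
  open RealField R hiding (zero; _-_)
  open Series commutativeRing
  open Order R
  open MatchingSum serRing using (Φ; μΦ; ∏; when)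
  open Matching R
  open import Algebra.Properties.Ring ring using (-‿distribˡ-*; -0#≈0#)
  open import Algebra.Properties.Ring S.ring using () renaming
      (-‿distribˡ-* to ⊝-distribˡ; -‿+-comm to ⊝-⊕-comm; -0#≈0# to ⊝𝟘≋𝟘)
  open import Algebra.Solver.Ring.NaturalCoefficients.Default S.commutativeSemiring using (solve; _:=_; _:+_; _:*_)

  infixr 8 𝕏^_
  𝕏^_ : ℕ → Ser
  𝕏^ zero  = const 1#
  𝕏^ suc d = 𝕏 θ ⊛ (𝕏^ d)

  T-monomial : ∀ d c → T θ (monomial d c) ≋ const c ⊛ (𝕏^ d)
  T-monomial zero    c = S.trans (S.+-congˡ (S.zeroʳ _)) (S.trans (S.+-identityʳ _) (S.sym (S.*-identityʳ _)))
  T-monomial (suc d) c = S.trans (T-0∷ θ (monomial d c)) (S.trans (S.*-congˡ (T-monomial d c))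
    (solve 3 (λ x c p → x :* (c :* p) := c :* (x :* p)) S.refl _ _ _))

  sumN : (ℕ → Ser) → ℕ → Ser
  sumN h zero    = 𝟘
  sumN h (suc m) = h 0 ⊕ sumN (h ∘ suc) m

  sumN-cong : ∀ {h k} → (∀ r → h r ≋ k r) → ∀ m → sumN h m ≋ sumN k m
  sumN-cong e zero    = S.refl
  sumN-cong e (suc m) = S.+-cong (e 0) (sumN-cong (e ∘ suc) m)

  sumN-⊕ : ∀ h k m → sumN (λ r → h r ⊕ k r) m ≋ sumN h m ⊕ sumN k m
  sumN-⊕ h k zero    = S.sym (S.+-identityˡ _)
  sumN-⊕ h k (suc m) = S.trans (S.+-congˡ (sumN-⊕ (h ∘ suc) (k ∘ suc) m))
    (solve 4 (λ a b p q → (a :+ b) :+ (p :+ q) := (a :+ p) :+ (b :+ q)) S.refl _ _ _ _)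

  sumN-⊝ : ∀ h m → sumN (λ r → ⊝ h r) m ≋ ⊝ sumN h m
  sumN-⊝ h zero    = S.sym ⊝𝟘≋𝟘
  sumN-⊝ h (suc m) = S.trans (S.+-congˡ (sumN-⊝ (h ∘ suc) m)) (⊝-⊕-comm _ _)

  sumN-𝟘 : ∀ m → sumN (λ _ → 𝟘) m ≋ 𝟘
  sumN-𝟘 zero    = S.refl
  sumN-𝟘 (suc m) = S.trans (S.+-identityˡ _) (sumN-𝟘 m)

  T-foldr : ∀ (g : ℕ → Pol) f m → T θ (foldr _+ₚ_ [] (map g (applyUpTo f m))) ≋ sumN (T θ ∘ g ∘ f) m
  T-foldr g f zero    = S.refl
  T-foldr g f (suc m) = S.trans (T-+ₚ θ (g (f 0)) _) (S.+-congˡ (T-foldr g (f ∘ suc) m))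

  -- The size `s` is a separate argument because `X` and `del X e`, whose sizes differ by two, have
  -- to be compared.
  term : ℕ → ℕ → ℕ → Ser
  term s r c = if does (2 ℕ.* r ℕ.≤? s) then const (sign r * fromℕ c) ⊛ (𝕏^ (s ℕ.∸ 2 ℕ.* r)) else 𝟘

  fromℕ-+ : ∀ a b → fromℕ (a ℕ.+ b) ≈ fromℕ a + fromℕ b
  fromℕ-+ zero    b = sym (+-identityˡ _)
  fromℕ-+ (suc a) b = trans (+-congˡ (fromℕ-+ a b)) (sym (+-assoc _ _ _))

  term-+ : ∀ s r c c′ → term s r (c ℕ.+ c′) ≋ term s r c ⊕ term s r c′
  term-+ s r c c′ with does (2 ℕ.* r ℕ.≤? s)
  ... | false = S.sym (S.+-identityˡ _)
  ... | true  = S.trans (S.*-congʳ (S.trans (const-cong θ (trans (*-congˡ (fromℕ-+ c c′)) (distribˡ _ _ _)))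
      (const-⊕ θ _ _))) (S.distribʳ _ _ _)

  term-0 : ∀ s r → term s r 0 ≋ 𝟘
  term-0 s r with does (2 ℕ.* r ℕ.≤? s)
  ... | false = S.refl
  ... | true  = S.trans (S.*-congʳ (S.trans (const-cong θ (zeroʳ _)) (const-0 θ))) (S.zeroˡ _)

  const-neg : ∀ a → const (- a) ≋ ⊝ const a
  const-neg a = mk≋ λ where
    zero    → refl
    (suc n) → sym -0#≈0#

  -- The exponent s - 2r does not change, so only the sign flips.
  term-suc : ∀ s r c → term (suc (suc s)) (suc r) c ≋ ⊝ term s r c
  term-suc s r c = S.trans (S.reflexive (≡.cong
      (λ m → if does (m ℕ.≤? suc (suc s)) then const (sign (suc r) * fromℕ c) ⊛ (𝕏^ (suc (suc s) ℕ.∸ m)) else 𝟘)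
      (ℕₚ.*-suc 2 r)))
    (S.trans (S.reflexive (≡.cong (λ b → if b then const (sign (suc r) * fromℕ c) ⊛ (𝕏^ (s ℕ.∸ 2 ℕ.* r)) else 𝟘)
        le)) (lem (does (2 ℕ.* r ℕ.≤? s))))
    where
    le : does (suc (suc (2 ℕ.* r)) ℕ.≤? suc (suc s)) ≡ does (2 ℕ.* r ℕ.≤? s)
    le = bool-ext (λ p → dec-true (2 ℕ.* r ℕ.≤? s)
        (ℕₚ.≤-pred (ℕₚ.≤-pred (does-true⁻ (suc (suc (2 ℕ.* r)) ℕ.≤? suc (suc s)) p))))
                  (λ p → dec-true (suc (suc (2 ℕ.* r)) ℕ.≤? suc (suc s)) (s≤s (s≤s (does-true⁻ (2 ℕ.* r ℕ.≤? s) p))))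
    lem : ∀ b → (if b then const ((- sign r) * fromℕ c) ⊛ (𝕏^ (s ℕ.∸ 2 ℕ.* r)) else 𝟘) ≋ ⊝
        (if b then const (sign r * fromℕ c) ⊛ (𝕏^ (s ℕ.∸ 2 ℕ.* r)) else 𝟘)
    lem false = S.sym ⊝𝟘≋𝟘
    lem true  = S.trans (S.*-congʳ (S.trans (const-cong θ (sym (-‿distribˡ-* _ _))) (const-neg _)))
        (S.sym (⊝-distribˡ _ _))

  ∏-𝕏 : ∀ {n} (X : Subset n) → ∏ X (λ _ → 𝕏 θ) ≋ 𝕏^ ∣ X ∣
  ∏-𝕏 []          = S.refl
  ∏-𝕏 (true ∷ X)  = S.*-congˡ (∏-𝕏 X)
  ∏-𝕏 (false ∷ X) = S.trans (S.*-identityˡ _) (∏-𝕏 X)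

  module _ {n : ℕ} (G : Graph n) where

    -- The bound `M` is left free: using an edge lowers the size by two but shortens the range of
    -- summation only by one.
    sumN-count : ∀ L → All (λ e → proj₁ e ≢ proj₂ e) L → ∀ X M → ∣ X ∣ ℕ.< M →
                 sumN (λ r → term ∣ X ∣ r (count G L X r)) M ≋ Φ G (λ _ → 𝕏 θ) L X
    sumN-count [] [] X (suc M) _ = S.trans (S.+-cong first
        (S.trans (sumN-cong (λ r → term-0 ∣ X ∣ (suc r)) M) (sumN-𝟘 M)))
      (S.trans (S.+-identityʳ _) (S.sym (∏-𝕏 X)))
      where
      first : term ∣ X ∣ 0 1 ≋ 𝕏^ ∣ X ∣
      first = S.trans (S.*-congʳ (const-cong θ (trans (*-identityˡ _) (+-identityʳ 1#)))) (S.*-identityˡ _)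
    sumN-count (e ∷ L) (i≢j ∷ ds) X (suc M) (s≤s lt) =
      S.trans (S.+-cong (S.reflexive (≡.cong (term s 0) (count-zero G e L X)))
                        (S.trans (sumN-cong (λ r →
                            S.trans (S.reflexive (≡.cong (term s (suc r)) (count-suc G e L X r i≢j)))
                            (term-+ s (suc r) (count G L X (suc r))
                            (if ok G X e then count G L (del X e) r else 0))) M)
                                 (sumN-⊕ (λ r → term s (suc r) (count G L X (suc r))) _ M)))
        (S.trans (S.sym (S.+-assoc _ _ _)) (S.+-cong (sumN-count L ds X (suc M) (s≤s lt)) rest))
      where
      s = ∣ X ∣
      rest : sumN (λ r → term s (suc r) (if ok G X e then count G L (del X e) r else 0)) M
             ≋ ⊝ when (ok G X e) (Φ G (λ _ → 𝕏 θ) L (del X e))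
      rest with ok G X e in eq
      ... | false = S.trans (S.trans (sumN-cong (λ r → term-0 s (suc r)) M) (sumN-𝟘 M)) (S.sym ⊝𝟘≋𝟘)
      ... | true  = S.trans (sumN-cong (λ r →
          S.trans (S.reflexive (≡.cong (λ m → term m (suc r) (count G L (del X e) r)) card))
                                                      (term-suc ∣ del X e ∣ r (count G L (del X e) r))) M)
                      (S.trans (sumN-⊝ (λ r → term ∣ del X e ∣ r (count G L (del X e) r)) M)
                          (S.-‿cong (sumN-count L ds (del X e) M
                         (ℕₚ.≤-trans (ℕₚ.n≤1+n _) (≡.subst (ℕ._≤ M) card lt)))))
        where
        card : s ≡ suc (suc ∣ del X e ∣)
        card = let _ , a , b = ok⁻ G X e eq in card-del X e i≢j a b

    T-μ : ∀ X → T θ (μ G X) ≋ μΦ G (λ _ → 𝕏 θ) X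
    T-μ X = S.trans (T-foldr summand id (suc ∣ X ∣)) (S.trans (sumN-cong T-term (suc ∣ X ∣))
      (sumN-count (allPairs n) (allPairs-distinct n) X (suc ∣ X ∣) (ℕₚ.n<1+n _)))
      where
      summand : ℕ → Pol
      summand r = if does (2 ℕ.* r ℕ.≤? ∣ X ∣) then monomial (∣ X ∣ ℕ.∸ 2 ℕ.* r)
          (sign r * fromℕ (numMatchings G X r)) else []
      T-term : ∀ r → T θ (summand r) ≋ term ∣ X ∣ r (count G (allPairs n) X r)
      T-term r with does (2 ℕ.* r ℕ.≤? ∣ X ∣)
      ... | false = S.refl
      ... | true  = S.trans (T-monomial (∣ X ∣ ℕ.∸ 2 ℕ.* r) _)
                      (S.reflexive (≡.cong (λ c → const (sign r * fromℕ c) ⊛ (𝕏^ (∣ X ∣ ℕ.∸ 2 ℕ.* r)))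
                          (numMatchings≡count G X r)))

-- Heilmann–Lieb positivity

module Weighted {ℓ : Level} (R : RealField ℓ) {n : ℕ} (G : Graph n) (G-sym : ∀ i j → G i j ≡ G j i) where
  open RealField R hiding (zero; _-_)
  open Series commutativeRing
  open Order R
  open MatchingSum serRing
  open import Algebra.Properties.Ring S.ring using () renaming
      (-‿+-comm to ⊝-⊕-comm; -0#≈0# to ⊝𝟘≋𝟘)
  open import Algebra.Properties.Group S.+-group using (∙-cancelʳ)
  open import Algebra.Properties.Semiring.Sum S.semiring using
      (sum; sum-cong-≋; ∑-distrib-+; *-distribˡ-sum; *-distribʳ-sum)
  open import Algebra.Solver.Ring.NaturalCoefficients.Default S.commutativeSemiring using (solve; _:=_; _:+_; _:*_)
  open import Relation.Binary.Reasoning.Setoid S.setoid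

  transpose : ∀ p q r s → p ⊕ q ≋ r ⊕ s → p ⊕ ⊝ r ≋ s ⊕ ⊝ q
  transpose p q r s e = begin
    p ⊕ ⊝ r                        ≈⟨ S.sym (S.trans (S.+-congˡ (S.-‿inverseʳ q)) (S.+-identityʳ _)) ⟩
    (p ⊕ ⊝ r) ⊕ (q ⊕ ⊝ q)          ≈⟨ solve 4 (λ p r q m → (p :+ r) :+ (q :+ m) := (p :+ q) :+ (r :+ m)) S.refl p
        (⊝ r) q (⊝ q) ⟩
    (p ⊕ q) ⊕ (⊝ r ⊕ ⊝ q)          ≈⟨ S.+-congʳ e ⟩
    (r ⊕ s) ⊕ (⊝ r ⊕ ⊝ q)          ≈⟨ solve 4 (λ r s m q → (r :+ s) :+ (m :+ q) := (s :+ q) :+ (r :+ m)) S.refl r s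
        (⊝ r) (⊝ q) ⟩
    (s ⊕ ⊝ q) ⊕ (r ⊕ ⊝ r)          ≈⟨ S.trans (S.+-congˡ (S.-‿inverseʳ r)) (S.+-identityʳ _) ⟩
    s ⊕ ⊝ q ∎

  sum-⊝ : ∀ {m} (t : Fin m → Ser) → sum (λ i → ⊝ t i) ≋ ⊝ sum t
  sum-⊝ {zero}  t = S.sym ⊝𝟘≋𝟘
  sum-⊝ {suc m} t = S.trans (S.+-congˡ (sum-⊝ (λ i → t (suc i)))) (⊝-⊕-comm _ _)

  sum-diff : ∀ {m} (s t : Fin m → Ser) → sum (λ i → s i ⊕ ⊝ t i) ≋ sum s ⊕ ⊝ sum t
  sum-diff {m} s t = S.trans (∑-distrib-+ {m} s (λ i → ⊝ t i)) (S.+-congˡ (sum-⊝ t))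

  minus-𝟘 : ∀ {a b c} → a ≋ b → c ≋ 𝟘 → a ⊕ ⊝ c ≋ b
  minus-𝟘 p q = S.trans (S.+-cong p (S.trans (S.-‿cong q) ⊝𝟘≋𝟘)) (S.+-identityʳ _)

  module _ (y : Fin n → Ser) where

    F : Subset n → Ser
    F = μΦ G y

    -- The sum of F(X∖P)² over all paths P from u to v.
    E : Subset n → Fin n → Fin n → Ser
    E X u v = F (X - u) ⊛ F (X - v) ⊕ ⊝ (F X ⊛ F (X - u - v))

    -- The paths whose second vertex is z. For a neighbour z ≠ v of u it equals `E (X - u) z v`; for
    -- z = v it is the square of F(X∖u∖v), which stands for the path that is the edge uv alone.
    E-term : Subset n → Fin n → Fin n → Fin n → Ser
    E-term X u v z = when (nbr G (X - u) u z) (F (X - u - z)) ⊛ F (X - u - v)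
                     ⊕ ⊝ (F (X - u) ⊛ when (nbr G (X - v - u) u z) (F (X - v - u - z)))

    -- The vertex recursion at `u` is applied both to F(X) and to F(X∖v); the two products that
    -- contain the weight of `u` coincide and cancel.
    E-expand : ∀ X u v → u ≢ v → u ∈ X → v ∈ X → E X u v ≋ sum (E-term X u v)
    E-expand X u v u≢v u∈X v∈X = S.trans
      (transpose (F (X - u) ⊛ F (X - v)) (F (X - u) ⊛ sum a) (F X ⊛ F (X - u - v)) (sum b ⊛ F (X - u - v)) both)
      (S.trans (S.+-cong (*-distribʳ-sum (F (X - u - v)) b) (S.-‿cong (*-distribˡ-sum (F (X - u)) a)))
        (S.sym (sum-diff (λ z → b z ⊛ F (X - u - v)) (λ z → F (X - u) ⊛ a z))))
      where
      a b : Fin n → Ser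
      a z = when (nbr G (X - v - u) u z) (F (X - v - u - z))
      b z = when (nbr G (X - u) u z) (F (X - u - z))
      both : F (X - u) ⊛ F (X - v) ⊕ F (X - u) ⊛ sum a ≋ F X ⊛ F (X - u - v) ⊕ sum b ⊛ F (X - u - v)
      both = begin
        F (X - u) ⊛ F (X - v) ⊕ F (X - u) ⊛ sum a  ≈⟨ S.sym (S.distribˡ _ _ _) ⟩
        F (X - u) ⊛ (F (X - v) ⊕ sum a)
          ≈⟨ S.*-congˡ (μΦ-vertex G G-sym y (X - v) u (x∈p∧x≢y⇒x∈p-y u∈X u≢v)) ⟩
        F (X - u) ⊛ (y u ⊛ F (X - v - u))
          ≈⟨ S.*-congˡ (S.*-congˡ (S.reflexive (≡.cong F (p─x─y≡p─y─x X v u)))) ⟩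
        F (X - u) ⊛ (y u ⊛ F (X - u - v))
          ≈⟨ solve 3 (λ f y g → f :* (y :* g) := (y :* f) :* g) S.refl (F (X - u)) (y u) (F (X - u - v)) ⟩
        (y u ⊛ F (X - u)) ⊛ F (X - u - v)
          ≈⟨ S.*-congʳ (S.sym (μΦ-vertex G G-sym y X u u∈X)) ⟩
        (F X ⊕ sum b) ⊛ F (X - u - v) ≈⟨ S.distribʳ _ _ _ ⟩
        F X ⊛ F (X - u - v) ⊕ sum b ⊛ F (X - u - v) ∎

    E-term-at : ∀ X u v → G u v ≡ true → v ∈ X → u ≢ v → E-term X u v v ≋ F (X - u - v) ⊛ F (X - u - v)
    E-term-at X u v g v∈X u≢v = minus-𝟘
      (S.*-congʳ (when-≡ (F (X - u - v)) (nbr⁺ G (X - u) u v (x∈p∧x≢y⇒x∈p-y v∈X (u≢v ∘ ≡.sym)) g)))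
      (S.trans (S.*-congˡ (when-≡ (F (X - v - u - v)) not-nbr)) (S.zeroʳ _))
      where
      not-nbr : nbr G (X - v - u) u v ≡ false
      not-nbr with nbr G (X - v - u) u v in eq
      ... | false = ≡.refl
      ... | true  = ⊥-elim (proj₂ (x∈p-y⁻ X v (proj₁ (x∈p-y⁻ (X - v) u (proj₁ (nbr⁻ G (X - v - u) u v eq))))) ≡.refl)

    private
      E-term-none : ∀ X u v z → nbr G (X - u) u z ≡ false → E-term X u v z ≋ 𝟘
      E-term-none X u v z p = minus-𝟘 (S.trans (S.*-congʳ (when-≡ (F (X - u - z)) p)) (S.zeroˡ _))
        (S.trans (S.*-congˡ (when-≡ (F (X - v - u - z)) none)) (S.zeroʳ _))
        where
        none : nbr G (X - v - u) u z ≡ false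
        none with nbr G (X - v - u) u z in eq
        ... | false = ≡.refl
        ... | true with nbr⁻ G (X - v - u) u z eq
        ...   | m , g with x∈p-y⁻ (X - v) u m
        ...     | m′ , z≢u = ≡.trans (≡.sym (nbr⁺ G (X - u) u z (x∈p∧x≢y⇒x∈p-y (proj₁ (x∈p-y⁻ X v m′)) z≢u) g)) p

    -- Induction on the size of X: every nonzero summand is a square or an `E` on the smaller set
    -- `X - u`.
    LowNonneg-E : ∀ m X u v → ∣ X ∣ ℕ.≤ m → u ≢ v → u ∈ X → v ∈ X → LowNonneg (E X u v)
    LowNonneg-E-term : ∀ m X u v → ∣ X ∣ ℕ.≤ m → u ≢ v → u ∈ X → v ∈ X → ∀ z → LowNonneg (E-term X u v z)

    LowNonneg-E m X u v le u≢v u∈X v∈X = LowNonneg-resp (S.sym (E-expand X u v u≢v u∈X v∈X))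
      (LowNonneg-sum (E-term X u v) (LowNonneg-E-term m X u v le u≢v u∈X v∈X))

    LowNonneg-E-term zero    X u v le u≢v u∈X v∈X z = ⊥-elim (ℕₚ.n≮0 (≡.subst (ℕ._≤ 0) (card-remove u∈X) le))
    LowNonneg-E-term (suc m) X u v le u≢v u∈X v∈X z with nbr G (X - u) u z in eq
    ... | false = LowNonneg-resp (S.sym (E-term-none′ eq)) LowNonneg-𝟘
      where
      E-term-none′ : nbr G (X - u) u z ≡ false → 𝟘 ⊛ F (X - u - v) ⊕ ⊝
          (F (X - u) ⊛ when (nbr G (X - v - u) u z) (F (X - v - u - z))) ≋ 𝟘
      E-term-none′ p = S.trans (S.+-congʳ (S.*-congʳ (S.sym (when-≡ (F (X - u - z)) p)))) (E-term-none X u v z p)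
    ... | true with nbr⁻ G (X - u) u z eq
    ...   | z∈ , g with z ≟ v
    ...     | yes ≡.refl = LowNonneg-resp (S.sym
        (S.trans (S.+-congʳ (S.*-congʳ (S.sym (when-≡ (F (X - u - v)) eq)))) (E-term-at X u v g v∈X u≢v)))
                             (LowNonneg-square (F (X - u - v)))
    ...     | no z≢v = LowNonneg-resp (S.sym (S.+-congˡ (S.-‿cong (S.*-congˡ
                 (S.trans (when-≡ (F (X - v - u - z)) nb) (S.reflexive (≡.cong F perm)))))))
               (LowNonneg-E m (X - u) z v (ℕₚ.≤-pred (≡.subst (ℕ._≤ suc m) (card-remove u∈X) le)) z≢v z∈
                 (x∈p∧x≢y⇒x∈p-y v∈X (u≢v ∘ ≡.sym)))
      where
      nb : nbr G (X - v - u) u z ≡ true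
      nb = let a , b = x∈p-y⁻ X u z∈ in nbr⁺ G (X - v - u) u z (x∈p∧x≢y⇒x∈p-y (x∈p∧x≢y⇒x∈p-y a z≢v) b) g
      perm : X - v - u - z ≡ X - u - z - v
      perm = ≡.trans (≡.cong (_- z) (p─x─y≡p─y─x X v u)) (p─x─y≡p─y─x (X - u) v z)

    E-nonneg : ∀ X u v → u ≢ v → u ∈ X → v ∈ X → LowNonneg (E X u v)
    E-nonneg X u v = LowNonneg-E ∣ X ∣ X u v ℕₚ.≤-refl

    -- For an edge uv the square of F(X∖u∖v) is itself a summand, so a bound on the order of `E`
    -- descends to it.
    E-edge : ∀ X u v → u ≢ v → u ∈ X → v ∈ X → G u v ≡ true → ∀ j →
             Ord≥ (suc (dbl j)) (E X u v) → Ord≥ (suc j) (F (X - u - v))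
    E-edge X u v u≢v u∈X v∈X g j p = Ord≥-sqrt-odd j (Ord≥-resp (E-term-at X u v g v∈X u≢v)
      (sum-odd (E-term X u v) (LowNonneg-E-term ∣ X ∣ X u v ℕₚ.≤-refl u≢v u∈X v∈X) j
        (Ord≥-resp (E-expand X u v u≢v u∈X v∈X) p) v))

    F-empty : ∀ X → (∀ z → z ∉ X) → F X ≋ const 1#
    F-empty X none = go (allPairs n)
      where
      ∏-empty : ∀ {m} (Y : Subset m) y → (∀ z → z ∉ Y) → ∏ Y y ≋ const 1#
      ∏-empty []          y p = S.refl
      ∏-empty (true ∷ Y)  y p = ⊥-elim (p zero here)
      ∏-empty (false ∷ Y) y p = S.trans (S.*-identityˡ _) (∏-empty Y (y ∘ suc) λ z m → p (suc z) (there m))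
      go : ∀ L → Φ G y L X ≋ const 1#
      go []      = ∏-empty X y none
      go (e ∷ L) with ok G X e in eq
      ... | false = minus-𝟘 (go L) S.refl
      ... | true  = ⊥-elim (none _ (proj₁ (proj₂ (ok⁻ G X e eq))))

  -- F is affine in the weight of `w` with slope F(X∖w), since the recursion at `w` contains that
  -- weight only as the factor `y w`.
  F-shift : ∀ y y′ w r → (∀ z → z ≢ w → y′ z ≋ y z) → y′ w ≋ y w ⊕ r →
            ∀ X → w ∈ X → F y′ X ≋ F y X ⊕ r ⊛ F y (X - w)
  F-shift y y′ w r same new X w∈X = ∙-cancelʳ Σ _ _ (begin
    F y′ X ⊕ Σ                ≈⟨ S.+-congˡ (sum-cong-≋ λ z → when-cong (nbr G (X - w) w z)
                                   (S.sym (off (X - w - z) λ m →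
                                       proj₂ (x∈p-y⁻ X w (proj₁ (x∈p-y⁻ (X - w) z m))) ≡.refl))) ⟩
    F y′ X ⊕ Σ′               ≈⟨ μΦ-vertex G G-sym y′ X w w∈X ⟩
    y′ w ⊛ F y′ (X - w)       ≈⟨ S.*-cong new (off (X - w) λ m → proj₂ (x∈p-y⁻ X w m) ≡.refl) ⟩
    (y w ⊕ r) ⊛ F y (X - w)   ≈⟨ S.distribʳ _ _ _ ⟩
    y w ⊛ F y (X - w) ⊕ r ⊛ F y (X - w)  ≈⟨ S.+-congʳ (S.sym (μΦ-vertex G G-sym y X w w∈X)) ⟩
    (F y X ⊕ Σ) ⊕ r ⊛ F y (X - w)        ≈⟨ solve 3 (λ a b c → (a :+ b) :+ c := (a :+ c) :+ b) S.refl _ _ _ ⟩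
    (F y X ⊕ r ⊛ F y (X - w)) ⊕ Σ ∎)
    where
    Σ Σ′ : Ser
    Σ  = sum (λ z → when (nbr G (X - w) w z) (F y (X - w - z)))
    Σ′ = sum (λ z → when (nbr G (X - w) w z) (F y′ (X - w - z)))
    off : ∀ Y → w ∉ Y → F y′ Y ≋ F y Y
    off Y w∉Y = Φ-cong (allPairs n) Y (λ _ _ _ _ → ≡.refl) (λ z m → same z λ { ≡.refl → w∉Y m })

-- Multiplicities

module Valuation {ℓ : Level} (R : RealField ℓ) (θ : RealField.Carrier R) {n : ℕ} (G : Graph n)
    (G-sym : ∀ i j → G i j ≡ G j i) where
  open RealField R hiding (zero; _-_)
  open RealFacts R
  open Series commutativeRing
  open Order R
  open MatchingSum serRing
  open Weighted R G G-sym using (sum-diff; minus-𝟘; F-shift) renaming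
      (F to Fʷ; E to Eʷ; E-nonneg to Eʷ-nonneg; E-edge to Eʷ-edge; F-empty to Fʷ-empty)
  open import Algebra.Properties.Group S.+-group using (∙-cancelʳ)
  open import Algebra.Properties.Semiring.Sum S.semiring using
      (sum; sum-cong-≋; ∑-distrib-+; ∑-comm; *-distribˡ-sum; *-distribʳ-sum)
  open import Algebra.Solver.Ring.NaturalCoefficients.Default S.commutativeSemiring using (solve; _:=_; _:+_; _:*_)
  open import Relation.Binary.Reasoning.Setoid S.setoid

  F : Subset n → Ser
  F = Fʷ (λ _ → 𝕏 θ)

  E : Subset n → Fin n → Fin n → Ser
  E = Eʷ (λ _ → 𝕏 θ)

  F-rec : ∀ X u → u ∈ X → F X ⊕ sum (λ z → when (nbr G (X - u) u z) (F (X - u - z))) ≋ 𝕏 θ ⊛ F (X - u)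
  F-rec = μΦ-vertex G G-sym (λ _ → 𝕏 θ)

  when-D : ∀ b f → D (when b f) ≋ when b (D f)
  when-D true  f = S.refl
  when-D false f = D-𝟘

  sum-remove : ∀ X u → u ∈ X → (f : Fin n → Ser) →
               sum (λ w → when (lookup X w) (f w)) ≋ f u ⊕ sum (λ w → when (lookup (X - u) w) (f w))
  sum-remove X u u∈X f = S.trans (sum-cong-≋ split) (S.trans (∑-distrib-+ {n} _ _) (S.+-congʳ (sum-delta u f)))
    where
    split : ∀ w → when (lookup X w) (f w) ≋ when (does (w ≟ u)) (f w) ⊕ when (lookup (X - u) w) (f w)
    split w with w ≟ u
    ... | yes ≡.refl = S.trans (when-≡ (f u) ([]=⇒lookup u∈X))
                         (S.sym (S.trans (S.+-congˡ (when-≡ (f u) (lookup-∉ (x∉p-x X u)))) (S.+-identityʳ _)))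
    ... | no  w≢u    = S.trans (when-≡ (f w) (bool-ext
                           (λ p → []=⇒lookup (x∈p∧x≢y⇒x∈p-y (lookup⇒[]= w X p) w≢u))
                           (λ p → []=⇒lookup (proj₁ (x∈p-y⁻ X u (lookup⇒[]= w (X - u) p))))))
                         (S.sym (S.+-identityˡ _))

  -- Induction through the recursion at a vertex u of X. Differentiating its neighbour sum yields
  -- `S₁`, over a neighbour z and a further deleted vertex w; the recursions for the sets `X - w`
  -- yield the same terms as `S₂`, with the two deletions interchanged.
  D-F : ∀ m X → ∣ X ∣ ℕ.≤ m → D (F X) ≋ sum (λ z → when (lookup X z) (F (X - z)))
  D-F m X le with nonempty? X
  ... | no  none = S.trans (D-cong (Fʷ-empty _ X (λ z z∈X → none (z , z∈X)))) (S.trans (D-const 1#)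
                     (S.sym (sum-≈0 {n} _ λ z → when-≡ (F (X - z)) (lookup-∉ (λ z∈X → none (z , z∈X))))))
  D-F zero    X le | yes (u , u∈X) = ⊥-elim (ℕₚ.n≮0 (≡.subst (ℕ._≤ 0) (card-remove u∈X) le))
  D-F (suc m) X le | yes (u , u∈X) = ∙-cancelʳ S₁ _ _ (begin
    D (F X) ⊕ S₁                      ≈⟨ S.+-congˡ (S.sym D-b) ⟩
    D (F X) ⊕ D (sum b)               ≈⟨ S.sym (D-⊕ (F X) (sum b)) ⟩
    D (F X ⊕ sum b)                   ≈⟨ D-cong (F-rec X u u∈X) ⟩
    D (𝕏 θ ⊛ F (X - u))               ≈⟨ D-𝕏 θ (F (X - u)) ⟩
    F (X - u) ⊕ 𝕏 θ ⊛ D (F (X - u))   ≈⟨ S.+-congˡ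
        (S.trans (S.*-congˡ (D-F m (X - u) le-u)) (*-distribˡ-sum {n} (𝕏 θ) _)) ⟩
    F (X - u) ⊕ sum (λ w → 𝕏 θ ⊛ when (lookup (X - u) w) (F (X - u - w)))
                                      ≈⟨ S.+-congˡ (S.trans (sum-cong-≋ expand) (∑-distrib-+ {n} _ _)) ⟩
    F (X - u) ⊕ (rest ⊕ S₂)           ≈⟨ S.trans (S.sym (S.+-assoc _ _ _)) (S.+-congˡ (S.sym S₁≋S₂)) ⟩
    (F (X - u) ⊕ rest) ⊕ S₁           ≈⟨ S.+-congʳ (S.sym (sum-remove X u u∈X (λ z → F (X - z)))) ⟩
    sum (λ z → when (lookup X z) (F (X - z))) ⊕ S₁ ∎)
    where
    le-u : ∣ X - u ∣ ℕ.≤ m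
    le-u = ℕₚ.≤-pred (≡.subst (ℕ._≤ suc m) (card-remove u∈X) le)
    b : Fin n → Ser
    b z = when (nbr G (X - u) u z) (F (X - u - z))
    t₁ t₂ : Fin n → Fin n → Ser
    t₁ z w = when (nbr G (X - u) u z) (when (lookup (X - u - z) w) (F (X - u - z - w)))
    t₂ w z = when (lookup (X - u) w) (when (nbr G (X - w - u) u z) (F (X - w - u - z)))
    S₁ S₂ rest : Ser
    S₁ = sum (λ z → sum (λ w → t₁ z w))
    S₂ = sum (λ w → sum (λ z → t₂ w z))
    rest = sum (λ w → when (lookup (X - u) w) (F (X - w)))
    D-b : D (sum b) ≋ S₁
    D-b = S.trans (D-sum b) (sum-cong-≋ λ z → S.trans (when-D (nbr G (X - u) u z) (F (X - u - z)))
      (S.trans (when-cong (nbr G (X - u) u z) (D-F m (X - u - z) (ℕₚ.≤-trans (∣p─q∣≤∣p∣ (X - u) ⁅ z ⁆) le-u)))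
               (S.sym (sum-when (nbr G (X - u) u z) (λ w → when (lookup (X - u - z) w) (F (X - u - z - w)))))))
    expand : ∀ w → 𝕏 θ ⊛ when (lookup (X - u) w) (F (X - u - w)) ≋ when (lookup (X - u) w) (F (X - w)) ⊕ sum
        (λ z → t₂ w z)
    expand w with lookup (X - u) w in eq
    ... | false = S.trans (S.zeroʳ _) (S.sym (S.trans (S.+-identityˡ _) (sum-≈0 {n} (λ _ → 𝟘) (λ _ → S.refl))))
    ... | true with x∈p-y⁻ X u (lookup⇒[]= w (X - u) eq)
    ...   | w∈X , w≢u = S.trans (S.*-congˡ (S.reflexive (≡.cong F (p─x─y≡p─y─x X u w))))
              (S.sym (F-rec (X - w) u (x∈p∧x≢y⇒x∈p-y u∈X (w≢u ∘ ≡.sym))))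
    conds : ∀ z w → nbr G (X - u) u z ∧ lookup (X - u - z) w ≡ lookup (X - u) w ∧ nbr G (X - w - u) u z
    conds z w = bool-ext
      (λ p → let p₁ , p₂ = ∧-true⁻ {nbr G (X - u) u z} p
                 z∈ , g = nbr⁻ G (X - u) u z p₁
                 z∈X , z≢u = x∈p-y⁻ X u z∈
                 w∈ , w≢z = x∈p-y⁻ (X - u) z (lookup⇒[]= w _ p₂)
             in ∧-true⁺ ([]=⇒lookup w∈) (nbr⁺ G (X - w - u) u z
                 (x∈p∧x≢y⇒x∈p-y (x∈p∧x≢y⇒x∈p-y z∈X (w≢z ∘ ≡.sym)) z≢u) g))
      (λ p → let p₁ , p₂ = ∧-true⁻ {lookup (X - u) w} p
                 w∈ = lookup⇒[]= w (X - u) p₁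
                 z∈ , g = nbr⁻ G (X - w - u) u z p₂
                 z∈X-w , z≢u = x∈p-y⁻ (X - w) u z∈
                 z∈X , z≢w = x∈p-y⁻ X w z∈X-w
             in ∧-true⁺ (nbr⁺ G (X - u) u z (x∈p∧x≢y⇒x∈p-y z∈X z≢u) g) ([]=⇒lookup (x∈p∧x≢y⇒x∈p-y w∈ (z≢w ∘ ≡.sym))))
    S₁≋S₂ : S₁ ≋ S₂
    S₁≋S₂ = S.trans (∑-comm {n} {n} t₁) (sum-cong-≋ λ w → sum-cong-≋ λ z → S.reflexive (≡.trans
      (≡.cong (λ Z → when (nbr G (X - u) u z) (when (lookup (X - u - z) w) (F Z)))
        (≡.trans (p─x─y≡p─y─x (X - u) z w) (≡.cong (_- z) (p─x─y≡p─y─x X u w))))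
      (when-nest (nbr G (X - u) u z) _ (lookup (X - u) w) _ _ (conds z w))))

  -- As a series in t, F(X) is monic of degree |X|; in particular it is nonzero and has an order.
  F-top : ∀ m X → ∣ X ∣ ℕ.≤ m → (∀ j → ∣ X ∣ ℕ.< j → F X j ≈ 0#) × F X ∣ X ∣ ≈ 1#
  F-top m X le with nonempty? X
  ... | no none = (λ { (suc j) _ → at F≋1 (suc j) }) , trans (at F≋1 ∣ X ∣) (reflexive (≡.cong (const 1#) ∣X∣≡0))
    where
    F≋1 = Fʷ-empty (λ _ → 𝕏 θ) X (λ z z∈X → none (z , z∈X))
    ∣X∣≡0 : ∣ X ∣ ≡ 0
    ∣X∣≡0 = ≡.trans (≡.cong ∣_∣ (Empty-unique none)) (∣⊥∣≡0 n)
  F-top zero    X le | yes (u , u∈X) = ⊥-elim (ℕₚ.n≮0 (≡.subst (ℕ._≤ 0) (card-remove u∈X) le))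
  F-top (suc m) X le | yes (u , u∈X) = high , trans (reflexive (≡.cong (F X) (card-remove u∈X)))
      (trans (coefficient c ℕₚ.≤-refl) (trans (+-congʳ (trans (*-congˡ (proj₁ IH (suc c) ℕₚ.≤-refl)) (zeroʳ θ)))
          (trans (+-identityˡ _) (proj₂ IH))))
    where
    c = ∣ X - u ∣
    le-u : c ℕ.≤ m
    le-u = ℕₚ.≤-pred (≡.subst (ℕ._≤ suc m) (card-remove u∈X) le)
    b : Fin n → Ser
    b z = when (nbr G (X - u) u z) (F (X - u - z))
    IH = F-top m (X - u) le-u
    sum-at : ∀ {k} (t : Fin k → Ser) j → (∀ z → t z j ≈ 0#) → sum t j ≈ 0#
    sum-at {zero}  t j p = refl
    sum-at {suc k} t j p = trans (+-cong (p zero) (sum-at (λ i → t (suc i)) j (λ i → p (suc i)))) (+-identityˡ _)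
    b-high : ∀ j → c ℕ.≤ j → ∀ z → b z (suc j) ≈ 0#
    b-high j c≤j z with nbr G (X - u) u z in eq
    ... | false = refl
    ... | true  = proj₁ (F-top m (X - u - z) (ℕₚ.≤-trans (∣p─q∣≤∣p∣ (X - u) ⁅ z ⁆) le-u)) (suc j)
                    (s≤s (ℕₚ.≤-trans (∣p─q∣≤∣p∣ (X - u) ⁅ z ⁆) c≤j))
    coefficient : ∀ j → c ℕ.≤ j → F X (suc j) ≈ θ * F (X - u) (suc j) + F (X - u) j
    coefficient j c≤j = trans (sym (trans (+-congˡ (sum-at b (suc j) (b-high j c≤j))) (+-identityʳ _)))
      (trans (at (F-rec X u u∈X) (suc j)) (𝕏-⊛ θ (F (X - u)) (suc j)))
    high : ∀ j → ∣ X ∣ ℕ.< j → F X j ≈ 0#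
    high (suc j) (s≤s lt) = trans (coefficient j (ℕₚ.≤-trans (ℕₚ.n≤1+n c) lt′))
      (trans (+-cong (trans (*-congˡ (proj₁ IH (suc j) (ℕₚ.m≤n⇒m≤1+n lt′))) (zeroʳ θ)) (proj₁ IH j lt′))
          (+-identityˡ _))
      where
      lt′ : c ℕ.< j
      lt′ = ≡.subst (ℕ._≤ j) (card-remove u∈X) lt

  -- Sealed so that `v` does not unfold to the search; `IsOrd` is all that is known about it.
  abstract
    ord : ∀ X → ∃ (IsOrd (F X))
    ord X = find-ord (F X) ∣ X ∣ λ e → 0≉1 (trans (sym e) (proj₂ (F-top ∣ X ∣ X ℕₚ.≤-refl)))

  v : Subset n → ℕ
  v X = proj₁ (ord X)

  v-ord : ∀ X → IsOrd (F X) (v X)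
  v-ord X = proj₂ (ord X)

  Ord≥⇒v : ∀ {m} X → Ord≥ m (F X) → m ℕ.≤ v X
  Ord≥⇒v X = Ord≥⇒≤ (v-ord X)

  v⇒Ord≥ : ∀ {m} X → m ℕ.≤ v X → Ord≥ m (F X)
  v⇒Ord≥ X le = Ord≥-weaken le (proj₁ (v-ord X))

  Ord≥-⊛′ : ∀ {m} a b f g → m ℕ.≤ a ℕ.+ b → Ord≥ a f → Ord≥ b g → Ord≥ m (f ⊛ g)
  Ord≥-⊛′ a b f g le p q = Ord≥-weaken le (Ord≥-⊛ a b p q)

  -- A summand of the Wronskian F′(X) F(X∖u) - F(X) F′(X∖u): the square of F(X∖u) for z = u, and
  -- `E X u z` for every other z in X.
  W-term : Subset n → Fin n → Fin n → Ser
  W-term X u z = when (lookup X z) (F (X - z)) ⊛ F (X - u) ⊕ ⊝ (F X ⊛ when (lookup (X - u) z) (F (X - u - z)))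

  W-expand : ∀ X u → D (F X) ⊛ F (X - u) ⊕ ⊝ (F X ⊛ D (F (X - u))) ≋ sum (W-term X u)
  W-expand X u = S.trans (S.+-cong
      (S.trans (S.*-congʳ (D-F ∣ X ∣ X ℕₚ.≤-refl)) (*-distribʳ-sum {n} (F (X - u)) _))
      (S.-‿cong (S.trans (S.*-congˡ (D-F ∣ X - u ∣ (X - u) ℕₚ.≤-refl)) (*-distribˡ-sum {n} (F X) _))))
    (S.sym (sum-diff (λ z → when (lookup X z) (F (X - z)) ⊛ F (X - u))
        (λ z → F X ⊛ when (lookup (X - u) z) (F (X - u - z)))))

  W-term-at : ∀ X u → u ∈ X → W-term X u u ≋ F (X - u) ⊛ F (X - u)
  W-term-at X u u∈X = minus-𝟘 (S.*-congʳ (when-≡ (F (X - u)) ([]=⇒lookup u∈X)))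
    (S.trans (S.*-congˡ (when-≡ (F (X - u - u)) (lookup-∉ (x∉p-x X u)))) (S.zeroʳ _))

  LowNonneg-W-term : ∀ X u → u ∈ X → ∀ z → LowNonneg (W-term X u z)
  LowNonneg-W-term X u u∈X z with z ≟ u
  ... | yes ≡.refl = LowNonneg-resp (S.sym (W-term-at X u u∈X)) (LowNonneg-square (F (X - u)))
  ... | no  z≢u with z ∈? X
  ...   | yes z∈X = LowNonneg-resp (S.+-cong
                      (S.trans (S.*-comm _ _) (S.*-congʳ (S.sym (when-≡ (F (X - z)) ([]=⇒lookup z∈X)))))
                      (S.-‿cong (S.*-congˡ (S.sym (when-≡ (F (X - u - z)) ([]=⇒lookup (x∈p∧x≢y⇒x∈p-y z∈X z≢u)))))))
                      (Eʷ-nonneg (λ _ → 𝕏 θ) X u z (z≢u ∘ ≡.sym) u∈X z∈X)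
  ...   | no  z∉X = LowNonneg-resp (S.sym (minus-𝟘
                      (S.trans (S.*-congʳ (when-≡ (F (X - z)) (lookup-∉ z∉X))) (S.zeroˡ _))
                      (S.trans (S.*-congˡ (when-≡ (F (X - u - z)) (lookup-∉ (z∉X ∘ proj₁ ∘ x∈p-y⁻ X u))))
                          (S.zeroʳ _)))) LowNonneg-𝟘

  -- Let l = v(X∖u). If v(X) were at least l + 2, the Wronskian would have order at least 2l + 1,
  -- and so would its summand F(X∖u)², whose order is 2l.
  v-lower : ∀ X u → u ∈ X → v X ℕ.≤ suc (v (X - u))
  v-lower X u u∈X with v X ℕ.≤? suc (v (X - u))
  ... | yes p = p
  ... | no ¬p = ⊥-elim (ℕₚ.<-irrefl ≡.refl (Ord≥⇒v (X - u) (Ord≥-sqrt-odd l (Ord≥-resp (W-term-at X u u∈X)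
      (sum-odd (W-term X u) (LowNonneg-W-term X u u∈X) l (Ord≥-resp (W-expand X u) W≥) u)))))
    where
    l = v (X - u)
    -- `pred` covers l = 0, where the derivative need not vanish; the other factor F(X) then
    -- supplies the whole order.
    DFu : ∀ k → k ≡ v (X - u) → Ord≥ (ℕ.pred k) (D (F (X - u)))
    DFu zero    e = λ _ ()
    DFu (suc k) e = Ord≥-D (v⇒Ord≥ (X - u) (ℕₚ.≤-reflexive e))
    arith : ∀ l → suc (dbl l) ℕ.≤ suc (suc l) ℕ.+ ℕ.pred l
    arith zero    = s≤s z≤n
    arith (suc l) = s≤s (s≤s (s≤s (ℕₚ.≤-reflexive (dbl≡+ l))))
    W≥ : Ord≥ (suc (dbl l)) (D (F X) ⊛ F (X - u) ⊕ ⊝ (F X ⊛ D (F (X - u))))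
    W≥ = Ord≥-⊕
      (Ord≥-⊛′ (suc l) l (D (F X)) (F (X - u)) (s≤s (ℕₚ.≤-reflexive (dbl≡+ l))) (Ord≥-D (v⇒Ord≥ X (ℕₚ.≰⇒> ¬p)))
          (v⇒Ord≥ (X - u) ℕₚ.≤-refl))
      (Ord≥-⊝ (Ord≥-⊛′ (suc (suc l)) (ℕ.pred l) (F X) (D (F (X - u))) (arith l) (v⇒Ord≥ X (ℕₚ.≰⇒> ¬p))
          (DFu l ≡.refl)))

  Ord≥-cancel : ∀ {m} f g → Ord≥ m (f ⊕ g) → Ord≥ m g → Ord≥ m f
  Ord≥-cancel f g p q j r = trans (sym (+-identityʳ _)) (trans (+-congˡ (sym (q j r))) (p j r))

  v-rec : ∀ X u m → u ∈ X → m ℕ.≤ v (X - u) → (∀ z → z ∈ X - u → G u z ≡ true → m ℕ.≤ v (X - u - z)) → m ℕ.≤ v X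
  v-rec X u m u∈X le les = Ord≥⇒v X (Ord≥-cancel (F X) (sum b)
      (Ord≥-resp (S.sym (F-rec X u u∈X)) (Ord≥-⊛′ 0 m (𝕏 θ) (F (X - u)) ℕₚ.≤-refl (λ _ ()) (v⇒Ord≥ (X - u) le)))
      (Ord≥-sum b b≥))
    where
    b : Fin n → Ser
    b z = when (nbr G (X - u) u z) (F (X - u - z))
    b≥ : ∀ z → Ord≥ m (b z)
    b≥ z with nbr G (X - u) u z in eq
    ... | false = Ord≥-𝟘
    ... | true  = let z∈ , g = nbr⁻ G (X - u) u z eq in v⇒Ord≥ (X - u - z) (les z z∈ g)

  -- The lower half of interlacing, applied in `X - u`, shows that every term of the recursion at
  -- `u` has order at least v(X∖u) - 1.
  v-upper : ∀ X u → u ∈ X → v (X - u) ℕ.≤ suc (v X)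
  v-upper X u u∈X = pred≤⇒≤suc (v (X - u)) (v-rec X u (ℕ.pred (v (X - u))) u∈X ℕₚ.pred[n]≤n
    λ z z∈ g → ℕₚ.pred-mono-≤ (v-lower (X - u) z z∈))
    where
    pred≤⇒≤suc : ∀ m {k} → ℕ.pred m ℕ.≤ k → m ℕ.≤ suc k
    pred≤⇒≤suc zero    _  = z≤n
    pred≤⇒≤suc (suc m) le = s≤s le

  -- Without such a neighbour every term of the recursion at `u` would have order at least v(X∖u),
  -- which exceeds v(X).
  positive⇒essential-nbr : ∀ X u → u ∈ X → v (X - u) ≡ suc (v X) →
                           ∃ λ z → z ∈ X - u × G u z ≡ true × suc (v (X - u - z)) ≡ v (X - u)
  positive⇒essential-nbr X u u∈X e
    with Finₚ.any? (λ z → (z ∈? (X - u)) ×-dec ((G u z Bool.≟ true) ×-dec (suc (v (X - u - z)) ℕ.≟ v (X - u))))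
  ... | yes p = p
  ... | no ¬p = ⊥-elim (ℕₚ.<-irrefl ≡.refl (ℕₚ.≤-trans (ℕₚ.≤-reflexive (≡.sym e))
                  (v-rec X u (v (X - u)) u∈X ℕₚ.≤-refl λ z z∈ g →
                    ℕₚ.≤-pred (ℕₚ.≤∧≢⇒< (v-lower (X - u) z z∈) λ q → ¬p (z , z∈ , g , ≡.sym q)))))

  E-ord : ∀ X a b m → m ℕ.≤ v (X - a) ℕ.+ v (X - b) → m ℕ.≤ v X ℕ.+ v (X - a - b) → Ord≥ m (E X a b)
  E-ord X a b m p q = Ord≥-⊕ (Ord≥-⊛′ _ _ (F (X - a)) (F (X - b)) p (proj₁ (v-ord (X - a))) (proj₁ (v-ord (X - b))))
    (Ord≥-⊝ (Ord≥-⊛′ _ _ (F X) (F (X - a - b)) q (proj₁ (v-ord X)) (proj₁ (v-ord (X - a - b)))))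

  module _ (X : Subset n) (a b : Fin n) (a≢b : a ≢ b) (a∈X : a ∈ X) (b∈X : b ∈ X) (ab : G a b ≡ true) where

    -- The odd bound 2m + 1 on `E` is inherited by a square, whose order is even; this is the source
    -- of the gain from m to m + 1.
    edge-bound : ∀ m → suc (m ℕ.+ m) ℕ.≤ v (X - a) ℕ.+ v (X - b) → suc (m ℕ.+ m) ℕ.≤ v X ℕ.+ v (X - a - b) →
        suc m ℕ.≤ v (X - a - b)
    edge-bound m p q = Ord≥⇒v (X - a - b) (Eʷ-edge (λ _ → 𝕏 θ) X a b a≢b a∈X b∈X ab m
      (≡.subst (λ k → Ord≥ (suc k) (E X a b)) (≡.sym (dbl≡+ m)) (E-ord X a b _ p q)))

    -- Let m = v(X∖a∖b). If a were not positive, v(X) would be at least m + 1 and v(X∖b) at least m,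
    -- so both products in `E` would reach order 2m + 1 and `edge-bound` would contradict the choice
    -- of m.
    essential-nbr⇒positive : suc (v (X - a - b)) ≡ v (X - a) → suc (v X) ≡ v (X - a)
    essential-nbr⇒positive e with suc (v X) ℕ.≤? v (X - a)
    ... | yes p = ℕₚ.≤-antisym p (v-upper X a a∈X)
    ... | no ¬p = ⊥-elim (ℕₚ.<-irrefl ≡.refl (edge-bound m (ℕₚ.+-mono-≤ (ℕₚ.≤-reflexive e) m≤)
        (ℕₚ.+-mono-≤ m<vX ℕₚ.≤-refl)))
      where
      m = v (X - a - b)
      m<vX : suc m ℕ.≤ v X
      m<vX = ℕₚ.≤-trans (ℕₚ.≤-reflexive e) (ℕₚ.≤-pred (ℕₚ.≰⇒> ¬p))
      m≤ : m ℕ.≤ v (X - b)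
      m≤ = ℕₚ.≤-pred (ℕₚ.≤-trans m<vX (v-lower X b b∈X))

    -- A parity contradiction. With m = v(X∖b), a neutral a makes F(X∖a) F(X∖b) of order exactly 2m
    -- + 1. But `E` has even order, hence at least 2m + 2, and `edge-bound` lifts F(X) F(X∖a∖b) to
    -- 2m + 2 as well.
    essential-nbr⇒not-neutral : suc (v (X - b)) ≡ v X → v (X - a) ≢ v X
    essential-nbr⇒not-neutral e e′ = ℕₚ.<-irrefl ≡.refl
        (≡.subst₂ ℕ._≤_ (≡.trans (dbl≡+ (suc m)) (≡.cong suc (ℕₚ.+-suc m m))) (≡.cong (ℕ._+ m) (≡.trans e′ (≡.sym e)))
          (Ord≥⇒≤ (IsOrd-⊛ (v-ord (X - a)) (v-ord (X - b))) product≥))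
      where
      m = v (X - b)
      m≤ : m ℕ.≤ v (X - a - b)
      m≤ = ℕₚ.≤-pred (ℕₚ.≤-trans (ℕₚ.≤-reflexive (≡.trans e (≡.sym e′)))
          (v-lower (X - a) b (x∈p∧x≢y⇒x∈p-y b∈X (a≢b ∘ ≡.sym))))
      p₁ : suc (m ℕ.+ m) ℕ.≤ v (X - a) ℕ.+ v (X - b)
      p₁ = ℕₚ.+-mono-≤ (ℕₚ.≤-reflexive (≡.trans e (≡.sym e′))) ℕₚ.≤-refl
      p₂ : suc (m ℕ.+ m) ℕ.≤ v X ℕ.+ v (X - a - b)
      p₂ = ℕₚ.+-mono-≤ (ℕₚ.≤-reflexive e) m≤
      E≥ : Ord≥ (dbl (suc m)) (E X a b)
      E≥ = LowNonneg-even (Eʷ-nonneg (λ _ → 𝕏 θ) X a b a≢b a∈X b∈X) m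
             (≡.subst (λ k → Ord≥ (suc k) (E X a b)) (≡.sym (dbl≡+ m)) (E-ord X a b _ p₁ p₂))
      product≥ : Ord≥ (dbl (suc m)) (F (X - a) ⊛ F (X - b))
      product≥ = Ord≥-cancel _ (⊝ (F X ⊛ F (X - a - b))) E≥ (Ord≥-⊝ (Ord≥-⊛′ (suc m) (suc m) (F X) (F (X - a - b))
        (ℕₚ.≤-reflexive (dbl≡+ (suc m))) (v⇒Ord≥ X (ℕₚ.≤-reflexive e)) (v⇒Ord≥ (X - a - b) (edge-bound m p₁ p₂))))

  -- In characteristic zero F′(X) has order v(X) - 1, and F′(X) is the sum of the F(X∖z); they
  -- cannot all have order v(X) or more.
  has-essential : ∀ X → v X ≢ 0 → ∃ λ z → z ∈ X × suc (v (X - z)) ≡ v X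
  has-essential X nz with Finₚ.any? (λ z → (z ∈? X) ×-dec (suc (v (X - z)) ℕ.≟ v X))
  ... | yes p = p
  ... | no ¬p = ⊥-elim (go (v X) ≡.refl nz)
    where
    go : ∀ k → k ≡ v X → k ≢ 0 → ⊥
    go zero    e nz = nz ≡.refl
    go (suc k) e nz = *-≉0 (fromℕ-suc≉0 k) (≡.subst (λ m → ¬ (F X m ≈ 0#)) (≡.sym e) (proj₂ (v-ord X)))
      (Ord≥-resp (S.sym (D-F ∣ X ∣ X ℕₚ.≤-refl)) (Ord≥-sum _ terms) k ℕₚ.≤-refl)
      where
      terms : ∀ z → Ord≥ (suc k) (when (lookup X z) (F (X - z)))
      terms z with lookup X z in eq
      ... | false = Ord≥-𝟘
      ... | true  = let z∈X = lookup⇒[]= z X eq in v⇒Ord≥ (X - z) (ℕₚ.≤-trans (ℕₚ.≤-reflexive e)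
                      (ℕₚ.≤-pred (ℕₚ.≤∧≢⇒< (v-lower X z z∈X) λ q → ¬p (z , z∈X , ≡.sym q))))

-- Exchange, and multiplicativity over components.

module Structure {ℓ : Level} (R : RealField ℓ) (θ : RealField.Carrier R) {n : ℕ} (G : Graph n)
    (G-sym : ∀ i j → G i j ≡ G j i) where
  open RealField R hiding (zero; _-_)
  open RealFacts R
  open Series commutativeRing
  open Order R
  open MatchingSum serRing
  open Valuation R θ G G-sym
  open Weighted R G G-sym using (F-shift) renaming
      (F to Fʷ; E to Eʷ; E-nonneg to Eʷ-nonneg; F-empty to Fʷ-empty)
  open import Algebra.Properties.Group S.+-group using (∙-cancelʳ)
  open import Algebra.Properties.Semiring.Sum S.semiring using (sum; sum-cong-≋; *-distribʳ-sum)
  open import Algebra.Solver.Ring.NaturalCoefficients.Default S.commutativeSemiring using (solve; _:=_; _:+_; _:*_)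
  open import Relation.Binary.Reasoning.Setoid S.setoid

  -- If both pairs {w, d} and {w, d′} were dependent, raising the weight of w from x to x + ρ (x − θ)
  -- would change the coefficient of (x − θ)^(2k+2) in E H d d′ linearly in ρ, with nonzero slope,
  -- although it is nonnegative for every ρ.
  exchange : ∀ H d d′ w k → d ≢ d′ → w ≢ d → w ≢ d′ → d ∈ H → d′ ∈ H → w ∈ H →
    suc (suc k) ℕ.≤ v H → v (H - w) ≡ suc k → suc k ℕ.≤ v (H - d) → suc k ℕ.≤ v (H - d′) → v (H - d - d′) ≡ k →
    suc k ℕ.≤ v (H - d - w) → suc k ℕ.≤ v (H - d′ - w) → ⊥
  exchange H d d′ w k d≢d′ w≢d w≢d′ d∈H d′∈H w∈H vH vw vd vd′ vdd′ vdw vd′w =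
    1≰0 (≤-resp (+-identityˡ 1#) (trans (+-congʳ E′N) (-‿inverseˡ 1#))
        (+-mono-≤ 1# (proj₁ (Eʷ-nonneg y′ H d d′ d≢d′ d∈H d′∈H (suc k) E′≥))))
    where
    N = dbl (suc k)
    N≡ : N ≡ suc (suc k ℕ.+ k)
    N≡ = ≡.cong (λ m → suc (suc m)) (dbl≡+ k)
    α = (F (H - d) ⊛ F (H - d′)) N
    β = (F H ⊛ F (H - d - d′)) N
    c = F (H - w) (suc k) * F (H - d - d′) k
    c≉0 : ¬ (c ≈ 0#)
    c≉0 = *-≉0 (≡.subst (λ m → ¬ (F (H - w) m ≈ 0#)) vw (proj₂ (v-ord (H - w))))
               (≡.subst (λ m → ¬ (F (H - d - d′) m ≈ 0#)) vdd′ (proj₂ (v-ord (H - d - d′))))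
    c⁻¹ = proj₁ (inverse c c≉0)
    -- The solution of α - (β + ρ c) = -1: it forces a negative lowest coefficient.
    ρ = (α + (- β) + 1#) * c⁻¹
    r = shift (const ρ)
    y y′ : Fin n → Ser
    y _ = 𝕏 θ
    y′ z = if does (z ≟ w) then 𝕏 θ ⊕ r else 𝕏 θ
    same : ∀ z → z ≢ w → y′ z ≋ y z
    same z z≢w = S.reflexive (≡.cong (λ b → if b then 𝕏 θ ⊕ r else 𝕏 θ) (dec-false (z ≟ w) z≢w))
    new : y′ w ≋ y w ⊕ r
    new = S.reflexive (≡.cong (λ b → if b then 𝕏 θ ⊕ r else 𝕏 θ) (dec-true (w ≟ w) ≡.refl))
    F′ : ∀ Y → w ∈ Y → Fʷ y′ Y ≋ F Y ⊕ r ⊛ F (Y - w)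
    F′ = F-shift y y′ w r same new
    w∈H-d = x∈p∧x≢y⇒x∈p-y w∈H w≢d
    w∈H-d-d′ = x∈p∧x≢y⇒x∈p-y w∈H-d w≢d′
    r≥ : Ord≥ 1 r
    r≥ zero (s≤s z≤n) = refl
    vdd′w : k ℕ.≤ v (H - d - d′ - w)
    vdd′w = ≡.subst (λ Z → k ℕ.≤ v Z) (p─x─y≡p─y─x (H - d) w d′)
      (ℕₚ.≤-pred (ℕₚ.≤-trans vdw (v-lower (H - d - w) d′
          (x∈p∧x≢y⇒x∈p-y (x∈p∧x≢y⇒x∈p-y d′∈H (d≢d′ ∘ ≡.sym)) (w≢d′ ∘ ≡.sym)))))
    -- The corrections caused by the new weight. `P₂` and `Q₂` have order above `N`; only `Q₁`
    -- reaches `N`, where its coefficient is ρ c.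
    P₂ Q₁ Q₂ : Ser
    P₂ = r ⊛ ((F (H - d) ⊛ F (H - d′ - w) ⊕ F (H - d - w) ⊛ F (H - d′)) ⊕ r ⊛ (F (H - d - w) ⊛ F (H - d′ - w)))
    Q₁ = r ⊛ (F (H - w) ⊛ F (H - d - d′))
    Q₂ = r ⊛ (F H ⊛ F (H - d - d′ - w) ⊕ r ⊛ (F (H - w) ⊛ F (H - d - d′ - w)))
    E′≋ : Eʷ y′ H d d′ ≋ (F (H - d) ⊛ F (H - d′) ⊕ P₂) ⊕ ⊝ ((F H ⊛ F (H - d - d′) ⊕ Q₁) ⊕ Q₂)
    E′≋ = S.+-cong
      (S.trans (S.*-cong (F′ (H - d) w∈H-d) (F′ (H - d′) (x∈p∧x≢y⇒x∈p-y w∈H w≢d′)))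
        (solve 5 (λ a b r p q → (a :+ r :* p) :* (b :+ r :* q) := a :* b :+ r :*
            ((a :* q :+ p :* b) :+ r :* (p :* q))) S.refl
          (F (H - d)) (F (H - d′)) r (F (H - d - w)) (F (H - d′ - w))))
      (S.-‿cong (S.trans (S.*-cong (F′ H w∈H) (F′ (H - d - d′) w∈H-d-d′))
        (solve 5 (λ a b r p q → (a :+ r :* p) :* (b :+ r :* q) := (a :* b :+ r :* (p :* b)) :+ r :*
            (a :* q :+ r :* (p :* q))) S.refl
          (F H) (F (H - d - d′)) r (F (H - w)) (F (H - d - d′ - w)))))
    prod≥ : ∀ {m} a b Y Z → m ℕ.≤ a ℕ.+ b → a ℕ.≤ v Y → b ℕ.≤ v Z → Ord≥ m (F Y ⊛ F Z)
    prod≥ a b Y Z le p q = Ord≥-⊛′ a b (F Y) (F Z) le (v⇒Ord≥ Y p) (v⇒Ord≥ Z q)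
    r⊛≥ : ∀ {m f} → Ord≥ m f → Ord≥ (suc m) (r ⊛ f)
    r⊛≥ p = Ord≥-⊛ 1 _ r≥ p
    N≤₁ : N ℕ.≤ suc k ℕ.+ suc k
    N≤₁ = ℕₚ.≤-reflexive (dbl≡+ (suc k))
    N≤₂ : N ℕ.≤ suc (suc k) ℕ.+ k
    N≤₂ = ℕₚ.≤-reflexive N≡
    N≤₃ : dbl k ℕ.≤ k ℕ.+ k
    N≤₃ = ℕₚ.≤-reflexive (dbl≡+ k)
    P₂≥ : Ord≥ (suc N) P₂
    P₂≥ = r⊛≥ (Ord≥-⊕ (Ord≥-⊕ (prod≥ (suc k) (suc k) (H - d) (H - d′ - w) N≤₁ vd vd′w)
        (prod≥ (suc k) (suc k) (H - d - w) (H - d′) N≤₁ vdw vd′))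
                (Ord≥-weaken (ℕₚ.n≤1+n N) (r⊛≥ (prod≥ (suc k) (suc k) (H - d - w) (H - d′ - w) N≤₁ vdw vd′w))))
    Q₂≥ : Ord≥ (suc N) Q₂
    Q₂≥ = r⊛≥ (Ord≥-⊕ (prod≥ (suc (suc k)) k H (H - d - d′ - w) N≤₂ vH vdd′w)
                (r⊛≥ (prod≥ (suc k) k (H - w) (H - d - d′ - w) (s≤s N≤₃) (ℕₚ.≤-reflexive (≡.sym vw)) vdd′w)))
    wdd′≥ : Ord≥ (suc k ℕ.+ k) (F (H - w) ⊛ F (H - d - d′))
    wdd′≥ = prod≥ (suc k) k (H - w) (H - d - d′) ℕₚ.≤-refl (ℕₚ.≤-reflexive (≡.sym vw)) (ℕₚ.≤-reflexive (≡.sym vdd′))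
    Q₁≥ : Ord≥ N Q₁
    Q₁≥ = ≡.subst (λ m → Ord≥ m Q₁) (≡.sym N≡) (r⊛≥ wdd′≥)
    Q₁N : Q₁ N ≈ ρ * c
    Q₁N = trans (reflexive (≡.cong Q₁ N≡)) (trans (⊛-lead 1 (suc k ℕ.+ k) r≥ wdd′≥) (*-congˡ
      (⊛-lead (suc k) k (v⇒Ord≥ (H - w) (ℕₚ.≤-reflexive (≡.sym vw)))
          (v⇒Ord≥ (H - d - d′) (ℕₚ.≤-reflexive (≡.sym vdd′))))))
    E′≥ : Ord≥ N (Eʷ y′ H d d′)
    E′≥ = Ord≥-resp (S.sym E′≋) (Ord≥-⊕
      (Ord≥-⊕ (prod≥ (suc k) (suc k) (H - d) (H - d′) N≤₁ vd vd′) (Ord≥-weaken (ℕₚ.n≤1+n N) P₂≥))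
      (Ord≥-⊝ (Ord≥-⊕ (Ord≥-⊕ (prod≥ (suc (suc k)) k H (H - d - d′) N≤₂ vH (ℕₚ.≤-reflexive (≡.sym vdd′))) Q₁≥)
          (Ord≥-weaken (ℕₚ.n≤1+n N) Q₂≥))))
    ρc : ρ * c ≈ α + (- β) + 1#
    ρc = trans (*-assoc _ _ _) (trans (*-congˡ (trans (*-comm _ _) (proj₂ (inverse c c≉0)))) (*-identityʳ _))
    E′N : Eʷ y′ H d d′ N ≈ - 1#
    E′N = trans (at E′≋ N) (trans
      (+-cong (trans (+-congˡ (P₂≥ N ℕₚ.≤-refl)) (+-identityʳ α))
              (-‿cong (trans (+-cong (+-congˡ (trans Q₁N ρc)) (Q₂≥ N ℕₚ.≤-refl)) (+-identityʳ _))))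
      (cancellation α β))
      where
      open import Algebra.Properties.AbelianGroup +-abelianGroup using () renaming (⁻¹-∙-comm to -‿+-comm)
      cancellation : ∀ α β → α + (- (β + ((α + (- β)) + 1#))) ≈ - 1#
      cancellation α β = trans (+-congˡ (-‿cong (trans (sym (+-assoc β _ _)) (+-congʳ (trans (+-congˡ (+-comm α _))
          (trans (sym (+-assoc β _ _)) (trans (+-congʳ (-‿inverseʳ β)) (+-identityˡ α))))))))
        (trans (+-congˡ (sym (-‿+-comm α 1#)))
            (trans (sym (+-assoc _ _ _)) (trans (+-congʳ (-‿inverseʳ α)) (+-identityˡ _))))

  -- Both sides obey the same recursion at a vertex u of Y ∩ X, because all neighbours of u in Y lie
  -- in X again.
  F-product : ∀ m X Y → ∣ Y ∩ X ∣ ℕ.≤ m → Separates G X Y → F Y ≋ F (Y ∩ X) ⊛ F (Y ─ X)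
  F-product m X Y le s with nonempty? (Y ∩ X)
  ... | no none = S.sym (S.trans (S.*-cong (Fʷ-empty _ (Y ∩ X) λ z z∈ → none (z , z∈))
                    (S.reflexive (≡.cong F (⊆-ext (λ x m → proj₁ (x∈p─q⁻ Y X m))
                      (λ x m → x∈p∧x∉q⇒x∈p─q m λ x∈X → none (x , x∈p∩q⁺ (m , x∈X))))))) (S.*-identityˡ _))
  F-product zero    X Y le s | yes (u , u∈) = ⊥-elim (ℕₚ.n≮0 (≡.subst (ℕ._≤ 0) (card-remove u∈) le))
  F-product (suc m) X Y le s | yes (u , u∈) = ∙-cancelʳ (sum b) _ _ (begin
    F Y ⊕ sum b                        ≈⟨ F-rec Y u u∈Y ⟩
    𝕏 θ ⊛ F (Y - u)                    ≈⟨ S.*-congˡ (S.trans (F-product m X (Y - u) le-u (Separates-minus u s))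
                                             (S.reflexive (≡.cong₂ (λ P Q → F P ⊛ F Q) (∩-minus Y X u)
                                                 (─-minus-∈ Y X u u∈X)))) ⟩
    𝕏 θ ⊛ (F (Y ∩ X - u) ⊛ K)          ≈⟨ S.sym (S.*-assoc _ _ _) ⟩
    (𝕏 θ ⊛ F (Y ∩ X - u)) ⊛ K          ≈⟨ S.*-congʳ (S.sym (F-rec (Y ∩ X) u u∈)) ⟩
    (F (Y ∩ X) ⊕ sum b′) ⊛ K           ≈⟨ S.distribʳ _ _ _ ⟩
    F (Y ∩ X) ⊛ K ⊕ sum b′ ⊛ K         ≈⟨ S.+-congˡ
        (S.trans (*-distribʳ-sum K b′) (sum-cong-≋ λ z → S.sym (term z))) ⟩
    F (Y ∩ X) ⊛ K ⊕ sum b ∎)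
    where
    K = F (Y ─ X)
    u∈Y = proj₁ (x∈p∩q⁻ Y X u∈)
    u∈X = proj₂ (x∈p∩q⁻ Y X u∈)
    b b′ : Fin n → Ser
    b z = when (nbr G (Y - u) u z) (F (Y - u - z))
    b′ z = when (nbr G (Y ∩ X - u) u z) (F (Y ∩ X - u - z))
    le′ : ∣ Y ∩ X - u ∣ ℕ.≤ m
    le′ = ℕₚ.≤-pred (≡.subst (ℕ._≤ suc m) (card-remove u∈) le)
    le-u : ∣ (Y - u) ∩ X ∣ ℕ.≤ m
    le-u = ≡.subst (λ Z → ∣ Z ∣ ℕ.≤ m) (≡.sym (∩-minus Y X u)) le′
    eq-z : ∀ z → (Y - u - z) ∩ X ≡ Y ∩ X - u - z
    eq-z z = ≡.trans (∩-minus (Y - u) X z) (≡.cong (_- z) (∩-minus Y X u))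
    nbrs : ∀ z → nbr G (Y ∩ X - u) u z ≡ nbr G (Y - u) u z
    nbrs z = bool-ext
      (λ p → let a , g = nbr⁻ G (Y ∩ X - u) u z p ; c , d = x∈p-y⁻ (Y ∩ X) u a
             in nbr⁺ G (Y - u) u z (x∈p∧x≢y⇒x∈p-y (proj₁ (x∈p∩q⁻ Y X c)) d) g)
      (λ p → let a , g = nbr⁻ G (Y - u) u z p ; c , d = x∈p-y⁻ Y u a
             in nbr⁺ G (Y ∩ X - u) u z (x∈p∧x≢y⇒x∈p-y (x∈p∩q⁺ (c , s u z u∈Y c u∈X g)) d) g)
    term : ∀ z → b z ≋ b′ z ⊛ K
    term z with nbr G (Y - u) u z in eq
    ... | false = S.sym (S.trans (S.*-congʳ (when-≡ (F (Y ∩ X - u - z)) (≡.trans (nbrs z) eq))) (S.zeroˡ _))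
    ... | true  with nbr⁻ G (Y - u) u z eq
    ...   | z∈ , g = S.trans (F-product m X (Y - u - z)
        (≡.subst (λ Z → ∣ Z ∣ ℕ.≤ m) (≡.sym (eq-z z)) (ℕₚ.≤-trans (∣p─q∣≤∣p∣ (Y ∩ X - u) ⁅ z ⁆) le′))
                (Separates-minus z (Separates-minus u s)))
              (S.trans (S.reflexive (≡.cong₂ (λ P Q → F P ⊛ F Q) (eq-z z)
                 (≡.trans (─-minus-∈ (Y - u) X z z∈X) (─-minus-∈ Y X u u∈X))))
                 (S.*-congʳ (S.sym (when-≡ (F (Y ∩ X - u - z)) (≡.trans (nbrs z) eq)))))
      where z∈X = s u z u∈Y (proj₁ (x∈p-y⁻ Y u z∈)) u∈X g

  v-product : ∀ X Y → Separates G X Y → v Y ≡ v (Y ∩ X) ℕ.+ v (Y ─ X)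
  v-product X Y s = IsOrd-unique (v-ord Y)
    (IsOrd-resp (S.sym (F-product ∣ Y ∩ X ∣ X Y ℕₚ.≤-refl s)) (IsOrd-⊛ (v-ord (Y ∩ X)) (v-ord (Y ─ X))))

-- Stability

-- v X stands for mult(θ, G[X]).
record MultiplicityLaws {n : ℕ} (G : Graph n) (v : Subset n → ℕ) : Set where
  field
    lower : ∀ X u → u ∈ X → v X ℕ.≤ suc (v (X - u))
    upper : ∀ X u → u ∈ X → v (X - u) ℕ.≤ suc (v X)
    positive⇒nbr : ∀ X u → u ∈ X → v (X - u) ≡ suc (v X) →
                   ∃ λ z → z ∈ X - u × G u z ≡ true × suc (v (X - u - z)) ≡ v (X - u)
    nbr⇒positive : ∀ X a b → a ≢ b → a ∈ X → b ∈ X → G a b ≡ true →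
                   suc (v (X - a - b)) ≡ v (X - a) → suc (v X) ≡ v (X - a)
    not-neutral : ∀ X a b → a ≢ b → a ∈ X → b ∈ X → G a b ≡ true → suc (v (X - b)) ≡ v X → v (X - a) ≢ v X
    exchange : ∀ H d d′ w k → d ≢ d′ → w ≢ d → w ≢ d′ → d ∈ H → d′ ∈ H → w ∈ H →
      suc (suc k) ℕ.≤ v H → v (H - w) ≡ suc k → suc k ℕ.≤ v (H - d) → suc k ℕ.≤ v (H - d′) → v (H - d - d′) ≡ k →
      suc k ℕ.≤ v (H - d - w) → suc k ℕ.≤ v (H - d′ - w) → ⊥
    has-essential : ∀ X → v X ≢ 0 → ∃ λ z → z ∈ X × suc (v (X - z)) ≡ v X
    product : ∀ X Y → Separates G X Y → v Y ≡ v (Y ∩ X) ℕ.+ v (Y ─ X)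

module Stability {n : ℕ} {G : Graph n} {v : Subset n → ℕ} (laws : MultiplicityLaws G v) where
  open MultiplicityLaws laws
  open import Data.Nat using (_≤_)
  open ℕₚ using (≤-trans; ≤-reflexive; ≤-refl; ≤-antisym; ≤-pred; ≤∧≢⇒<; n≤1+n)

  v-swap : ∀ X a b → v (X - a - b) ≡ v (X - b - a)
  v-swap X a b = ≡.cong v (p─x─y≡p─y─x X a b)

  -- Relative to G[X], since the property is followed while vertices are deleted.
  Special : Subset n → Fin n → Set
  Special X a = suc (v (X - a)) ≢ v X × ∃ λ d → d ∈ X × G a d ≡ true × suc (v (X - d)) ≡ v X

  module _ {X : Subset n} {a : Fin n} (a∈X : a ∈ X) (sp : Special X a) where
    private
      d    = proj₁ (proj₂ sp)
      d∈X  = proj₁ (proj₂ (proj₂ sp))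
      ad   = proj₁ (proj₂ (proj₂ (proj₂ sp)))
      d-es = proj₂ (proj₂ (proj₂ (proj₂ sp)))
      k    = v (X - d)
      a≢d : a ≢ d
      a≢d a≡d = proj₁ sp (≡.trans (≡.cong (λ z → suc (v (X - z))) a≡d) d-es)

    -- Interlacing leaves three types: a special vertex is not essential, and next to an essential
    -- vertex it cannot be neutral.
    special⇒positive : v (X - a) ≡ suc (v X)
    special⇒positive = ≤-antisym (upper X a a∈X)
      (≤∧≢⇒< (≤-pred (≤∧≢⇒< (lower X a a∈X) (proj₁ sp ∘ ≡.sym))) (not-neutral X a d a≢d a∈X d∈X ad d-es ∘ ≡.sym))

    private
      vXa : v (X - a) ≡ suc (suc k)
      vXa = ≡.trans special⇒positive (≡.cong suc (≡.sym d-es))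

      a∈X-d : a ∈ X - d
      a∈X-d = x∈p∧x≢y⇒x∈p-y a∈X a≢d

      d∈X-a : d ∈ X - a
      d∈X-a = x∈p∧x≢y⇒x∈p-y d∈X (a≢d ∘ ≡.sym)

      -- Squeezed from both sides, by v(X∖d) = k and v(X∖a) = k + 2.
      vXda : v (X - d - a) ≡ suc k
      vXda = ≤-antisym (upper (X - d) a a∈X-d)
        (≡.subst (suc k ≤_) (v-swap X a d) (≤-pred (≤-trans (≤-reflexive (≡.sym vXa)) (lower (X - a) d d∈X-a))))

      vXad : v (X - a - d) ≡ suc k
      vXad = ≡.trans (v-swap X a d) vXda

    module _ {w : Fin n} (w∈X : w ∈ X) (w≢a : w ≢ a) where
      private
        a∈X-w : a ∈ X - w
        a∈X-w = x∈p∧x≢y⇒x∈p-y a∈X (w≢a ∘ ≡.sym)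

        w∈X-a : w ∈ X - a
        w∈X-a = x∈p∧x≢y⇒x∈p-y w∈X w≢a

        rotate : ∀ x y z → X - x - y - z ≡ X - z - y - x
        rotate x y z = ≡.trans (≡.cong (_- z) (p─x─y≡p─y─x X x y))
          (≡.trans (p─x─y≡p─y─x (X - y) x z) (≡.cong (_- x) (p─x─y≡p─y─x X y z)))

        swap₁ : ∀ x y z → X - x - y - z ≡ X - y - x - z
        swap₁ x y z = ≡.cong (_- z) (p─x─y≡p─y─x X x y)

        witness : ∀ e → e ∈ X → e ≢ a → e ≢ w → G a e ≡ true → suc (v (X - w - a - e)) ≡ v (X - w - a) →
            v (X - w - a) ≡ suc (v (X - w))
        witness e e∈X e≢a e≢w g p =
          ≡.sym (nbr⇒positive (X - w) a e (e≢a ∘ ≡.sym) a∈X-w (x∈p∧x≢y⇒x∈p-y e∈X e≢w) g p)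

        -- The case where w is essential in X∖a. It suffices to find a neighbour of a that is
        -- essential in X∖w∖a. The candidates are d and a second neighbour d′ for which {d, d′}
        -- lowers v(X∖a) by two; by exchange one of them works.
        stable-essential : v (X - w - a) ≡ suc k → v (X - w - a) ≡ suc (v (X - w))
        stable-essential p with w ≟ d
        ... | yes ≡.refl = vXda
        -- Since a is still positive in X∖d, it has a neighbour d′ that is essential in X∖d∖a.
        ... | no w≢d with positive⇒nbr (X - d) a a∈X-d vXda
        ...   | d′ , d′∈ , ad′ , e with x∈p-y⁻ (X - d) a d′∈
        ...     | d′∈X-d , d′≢a with x∈p-y⁻ X d d′∈X-d
        ...       | d′∈X , d′≢d with w ≟ d′
        ...         | yes ≡.refl = witness d d∈X (a≢d ∘ ≡.sym) (w≢d ∘ ≡.sym) ad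
                                     (≡.trans (≡.cong (suc ∘ v) (rotate w a d)) (≡.trans e (≡.trans vXda (≡.sym p))))
        ...         | no w≢d′ with suc (v (X - w - a - d)) ℕ.≟ v (X - w - a) | suc (v (X - w - a - d′)) ℕ.≟ v
            (X - w - a)
        ...           | yes q | _     = witness d d∈X (a≢d ∘ ≡.sym) (w≢d ∘ ≡.sym) ad q
        ...           | no _  | yes q = witness d′ d′∈X d′≢a (w≢d′ ∘ ≡.sym) ad′ q
        ...           | no q  | no q′ = ⊥-elim (exchange (X - a) d d′ w k (d′≢d ∘ ≡.sym) w≢d w≢d′ d∈X-a d′∈X-a w∈X-a
            (≤-reflexive (≡.sym vXa)) (≡.trans (v-swap X a w) p) (≤-reflexive (≡.sym vXad))
            (≤-pred (≤-trans (≤-reflexive (≡.sym vXa)) (lower (X - a) d′ d′∈X-a)))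
            (ℕₚ.suc-injective (≡.trans (≡.cong (suc ∘ v) (swap₁ a d d′)) (≡.trans e vXda)))
            (far d d∈X (a≢d ∘ ≡.sym) (w≢d ∘ ≡.sym) q) (far d′ d′∈X d′≢a (w≢d′ ∘ ≡.sym) q′))
          where
          d′∈X-a = x∈p∧x≢y⇒x∈p-y d′∈X d′≢a
          far : ∀ e → e ∈ X → e ≢ a → e ≢ w → suc (v (X - w - a - e)) ≢ v (X - w - a) → suc k ≤ v (X - a - e - w)
          far e e∈X e≢a e≢w q = ≤-trans (≤-reflexive (≡.sym p)) (≤-trans
            (≤-pred (≤∧≢⇒< (lower (X - w - a) e (x∈p∧x≢y⇒x∈p-y (x∈p∧x≢y⇒x∈p-y e∈X e≢w) e≢a)) (q ∘ ≡.sym)))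
            (≤-reflexive (≡.cong v (≡.trans (swap₁ w a e) (p─x─y≡p─y─x (X - a) w e)))))

      -- Equivalently, w has the same type in X∖a as in X. If w is not essential in X∖a, then
      -- v(X∖w∖a) is at least k + 2, while v(X∖w) is at most k + 2; only equality in the latter
      -- needs an argument.
      stability : v (X - w - a) ≡ suc (v (X - w))
      stability with v (X - w - a) ℕ.≟ suc k
      ... | yes p = stable-essential p
      ... | no ¬p = ≤-antisym (upper (X - w) a a∈X-w) big
        where
        ge : suc (suc k) ≤ v (X - w - a)
        ge = ≤∧≢⇒< (≡.subst (suc k ≤_) (v-swap X a w)
            (≤-pred (≤-trans (≤-reflexive (≡.sym vXa)) (lower (X - a) w w∈X-a)))) (¬p ∘ ≡.sym)
        le : v (X - w) ≤ suc (suc k)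
        le = ≤-trans (upper X w w∈X) (s≤s (≤-reflexive (≡.sym d-es)))
        big : suc (v (X - w)) ≤ v (X - w - a)
        big with v (X - w) ℕ.≟ suc (suc k)
        ... | no ne = ≤-trans (≤∧≢⇒< le ne) ge
        -- Here w is positive, so d stays essential in X∖w and its neighbour a cannot be neutral
        -- there.
        ... | yes eq = ≤∧≢⇒< (≤-trans le ge) (not-neutral (X - w) a d a≢d a∈X-w
            (x∈p∧x≢y⇒x∈p-y d∈X (w≢d ∘ ≡.sym)) ad d-es′ ∘ ≡.sym)
          where
          w≢d : w ≢ d
          w≢d ≡.refl = ℕₚ.<-irrefl ≡.refl (≤-trans (≤-reflexive (≡.sym eq)) (n≤1+n k))
          d-es′ : suc (v (X - w - d)) ≡ v (X - w)
          d-es′ = ≤-antisym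
            (≤-trans (s≤s (≤-trans (≤-reflexive (v-swap X w d)) (upper (X - d) w (x∈p∧x≢y⇒x∈p-y w∈X w≢d))))
                (≤-reflexive (≡.sym eq)))
            (lower (X - w) d (x∈p∧x≢y⇒x∈p-y d∈X (w≢d ∘ ≡.sym)))

  AllSpecial : Subset n → Subset n → Set
  AllSpecial A Y = ∀ a → a ∈ A → a ∈ Y → Special Y a

  -- Deleting u raises the total by one, while v(Y∖d) rises by at most one, so an essential d stays
  -- essential; stability keeps a from becoming essential.
  AllSpecial-positive : ∀ {A Y u} → AllSpecial A Y → u ∈ Y → v (Y - u) ≡ suc (v Y) → AllSpecial A (Y - u)
  AllSpecial-positive {A} {Y} {u} sp u∈Y pos a a∈A a∈ with x∈p-y⁻ Y u a∈
  ... | a∈Y , a≢u with sp a a∈A a∈Y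
  ...   | sa@(_ , d , d∈Y , ad , d-es) =
    (λ e → ℕₚ.<-irrefl ≡.refl (≤-trans (≤-reflexive
        (≡.trans (≡.cong suc (≡.sym (stability a∈Y sa u∈Y (a≢u ∘ ≡.sym)))) e)) (n≤1+n _))) ,
    d , x∈p∧x≢y⇒x∈p-y d∈Y d≢u , ad , ≤-antisym
      (≤-trans (s≤s (≤-trans (≤-reflexive (v-swap Y u d)) (upper (Y - d) u (x∈p∧x≢y⇒x∈p-y u∈Y (d≢u ∘ ≡.sym)))))
          (≤-reflexive (≡.trans (≡.cong suc d-es) (≡.sym pos))))
      (lower (Y - u) d (x∈p∧x≢y⇒x∈p-y d∈Y d≢u))
    where
    d≢u : d ≢ u
    d≢u ≡.refl = ℕₚ.<-irrefl ≡.refl (≤-trans (≤-reflexive (≡.sym pos)) (≤-trans (n≤1+n _) (≤-reflexive d-es)))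

  module _ (A : Subset n) where

    -- The right-hand side is the largest value that interlacing allows.
    Full : Subset n → Set
    Full Y = v (Y ─ A) ≡ v Y ℕ.+ ∣ Y ∩ A ∣

    card-∩ : ∀ {Y a} → a ∈ A → a ∈ Y → ∣ Y ∩ A ∣ ≡ suc ∣ (Y - a) ∩ A ∣
    card-∩ {Y} {a} a∈A a∈Y = ≡.trans (card-remove (x∈p∩q⁺ (a∈Y , a∈A))) (≡.cong (suc ∘ ∣_∣) (≡.sym (∩-minus Y A a)))

    Full-none : ∀ {Y} → (∀ a → a ∉ Y ∩ A) → Full Y
    Full-none {Y} none = ≡.trans (≡.cong v (⊆-ext (λ x m → proj₁ (x∈p─q⁻ Y A m))
        (λ x m → x∈p∧x∉q⇒x∈p─q m (λ x∈A → none x (x∈p∩q⁺ (m , x∈A))))))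
      (≡.sym (≡.trans (≡.cong (v Y ℕ.+_) (≡.trans (≡.cong ∣_∣ (Empty-unique λ { (a , m) → none a m })) (∣⊥∣≡0 n)))
          (ℕₚ.+-identityʳ _)))

    Full-step : ∀ {Y a} → a ∈ A → a ∈ Y → v (Y - a) ≡ suc (v Y) → Full (Y - a) → Full Y
    Full-step {Y} {a} a∈A a∈Y pos full = ≡.trans (≡.cong v (≡.sym (─-minus-∈ Y A a a∈A))) (≡.trans full
      (≡.trans (≡.cong (ℕ._+ _) pos) (≡.trans (≡.sym (ℕₚ.+-suc (v Y) _))
          (≡.cong (v Y ℕ.+_) (≡.sym (card-∩ a∈A a∈Y))))))

    AllSpecial⇒Full : ∀ m Y → ∣ Y ∩ A ∣ ≤ m → AllSpecial A Y → Full Y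
    AllSpecial⇒Full m Y le sp with nonempty? (Y ∩ A)
    ... | no none = Full-none (λ a m → none (a , m))
    AllSpecial⇒Full zero Y le sp | yes (a , m∈) = ⊥-elim (ℕₚ.n≮0 (≡.subst (_≤ 0) (card-remove m∈) le))
    AllSpecial⇒Full (suc m) Y le sp | yes (a , m∈) = let a∈Y , a∈A = x∈p∩q⁻ Y A m∈
                                                         pos = special⇒positive a∈Y (sp a a∈A a∈Y) in
      Full-step a∈A a∈Y pos (AllSpecial⇒Full m (Y - a) (≤-pred (≡.subst (_≤ suc m) (card-∩ a∈A a∈Y) le))
          (AllSpecial-positive sp a∈Y pos))

    -- Specialness may be lost in Y∖w, so the induction deletes the vertices of A from Y, where they
    -- remain special, and lets stability transfer each gain of one to Y∖w.
    AllSpecial⇒Full-minus : ∀ m Y w → ∣ (Y - w) ∩ A ∣ ≤ m → w ∈ Y → AllSpecial A Y → Full (Y - w)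
    AllSpecial⇒Full-minus m Y w le w∈Y sp with nonempty? ((Y - w) ∩ A)
    ... | no none = Full-none (λ a m → none (a , m))
    AllSpecial⇒Full-minus zero Y w le w∈Y sp | yes (a , m∈) = ⊥-elim (ℕₚ.n≮0 (≡.subst (_≤ 0) (card-remove m∈) le))
    AllSpecial⇒Full-minus (suc m) Y w le w∈Y sp | yes (a , m∈) =
      let a∈Y-w , a∈A = x∈p∩q⁻ (Y - w) A m∈
          a∈Y , a≢w = x∈p-y⁻ Y w a∈Y-w
          sa = sp a a∈A a∈Y
          swap = p─x─y≡p─y─x Y w a
      in Full-step a∈A a∈Y-w (stability a∈Y sa w∈Y (a≢w ∘ ≡.sym))
           (≡.subst Full (≡.sym swap) (AllSpecial⇒Full-minus m (Y - a) w
             (≡.subst (λ Z → ∣ Z ∩ A ∣ ≤ m) swap (≤-pred (≡.subst (_≤ suc m) (card-∩ a∈A a∈Y-w) le)))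
             (x∈p∧x≢y⇒x∈p-y w∈Y (a≢w ∘ ≡.sym)) (AllSpecial-positive sp a∈Y (special⇒positive a∈Y sa))))

    v-─-upper : ∀ m Y → ∣ Y ∩ A ∣ ≤ m → v (Y ─ A) ≤ v Y ℕ.+ ∣ Y ∩ A ∣
    v-─-upper m Y le with nonempty? (Y ∩ A)
    ... | no none = ≤-reflexive (Full-none (λ a m → none (a , m)))
    v-─-upper zero Y le | yes (a , m∈) = ⊥-elim (ℕₚ.n≮0 (≡.subst (_≤ 0) (card-remove m∈) le))
    v-─-upper (suc m) Y le | yes (a , m∈) = let a∈Y , a∈A = x∈p∩q⁻ Y A m∈ in
      ≤-trans (≤-reflexive (≡.cong v (≡.sym (─-minus-∈ Y A a a∈A))))
        (≤-trans (v-─-upper m (Y - a) (≤-pred (≡.subst (_≤ suc m) (card-∩ a∈A a∈Y) le)))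
          (≤-trans (ℕₚ.+-monoˡ-≤ _ (upper Y a a∈Y))
            (≤-reflexive (≡.trans (≡.sym (ℕₚ.+-suc (v Y) _)) (≡.cong (v Y ℕ.+_) (≡.sym (card-∩ a∈A a∈Y)))))))

    -- Equality in a bound obtained by adding up unit steps forces equality in each step.
    Full-unstep : ∀ {Y a} → a ∈ A → a ∈ Y → Full Y → v (Y - a) ≡ suc (v Y) × Full (Y - a)
    Full-unstep {Y} {a} a∈A a∈Y full = pos , ≡.trans (≡.cong v (─-minus-∈ Y A a a∈A))
        (≡.trans full (≡.trans shifted (≡.cong (ℕ._+ c) (≡.sym pos))))
      where
      c = ∣ (Y - a) ∩ A ∣
      shifted : v Y ℕ.+ ∣ Y ∩ A ∣ ≡ suc (v Y) ℕ.+ c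
      shifted = ≡.trans (≡.cong (v Y ℕ.+_) (card-∩ a∈A a∈Y)) (ℕₚ.+-suc (v Y) c)
      pos : v (Y - a) ≡ suc (v Y)
      pos = ≤-antisym (upper Y a a∈Y) (ℕₚ.+-cancelʳ-≤ c _ _ (≤-trans (≤-reflexive (≡.sym (≡.trans full shifted)))
        (≤-trans (≤-reflexive (≡.cong v (≡.sym (─-minus-∈ Y A a a∈A)))) (v-─-upper c (Y - a) ≤-refl))))

    -- Deleting z lowers v(Y) by one and can lower v(Y∖A) by at most one, so the upper bound remains
    -- attained.
    Full-essential : ∀ {Y z} → z ∉ A → z ∈ Y → suc (v (Y - z)) ≡ v Y → Full Y → Full (Y - z)
    Full-essential {Y} {z} z∉A z∈Y es full = ≤-antisym (v-─-upper _ (Y - z) ≤-refl)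
      (≤-pred (≤-trans (≤-reflexive (≡.trans (≡.cong₂ ℕ._+_ es (≡.cong ∣_∣ (∩-minus-∉ Y A z z∉A))) (≡.sym full)))
        (≤-trans (lower (Y ─ A) z (x∈p∧x∉q⇒x∈p─q z∈Y z∉A)) (s≤s (≤-reflexive (≡.cong v (p─q─r≡p─r─q Y A ⁅ z ⁆)))))))

-- Components and the graph S_θ(G)

module _ {n : ℕ} (G : Graph n) (A : Subset n) where

  private S = SGraph G A

  SGraph-sym : (∀ i j → G i j ≡ G j i) → ∀ i j → S i j ≡ S j i
  SGraph-sym G-sym i j = ≡.cong₂ _∧_ (≡.cong not ≟-comm) (≡.cong₂ _∨_ (G-sym i j) (∨-comm (lookup A i) (lookup A j)))
    where
    ≟-comm : does (i ≟ j) ≡ does (j ≟ i)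
    ≟-comm = bool-ext (λ p → dec-true (j ≟ i) (≡.sym (does-true⁻ (i ≟ j) p)))
        (λ p → dec-true (i ≟ j) (≡.sym (does-true⁻ (j ≟ i) p)))

  SGraph-⊇ : ∀ {i j} → i ≢ j → G i j ≡ true → S i j ≡ true
  SGraph-⊇ {i} {j} i≢j g = ∧-true⁺ (≡.cong not (dec-false (i ≟ j) i≢j)) (≡.cong (_∨ (lookup A i ∨ lookup A j)) g)

  SGraph-off : (∀ i → G i i ≡ false) → ∀ {i j} → i ∉ A → j ∉ A → S i j ≡ G i j
  SGraph-off G-irr {i} {j} i∉A j∉A with i ≟ j
  ... | yes ≡.refl = ≡.sym (G-irr i)
  ... | no _ with lookup A i in p | lookup A j in q
  ...   | true  | _     = ⊥-elim (i∉A (lookup⇒[]= i A p))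
  ...   | false | true  = ⊥-elim (j∉A (lookup⇒[]= j A q))
  ...   | false | false with G i j
  ...     | true  = ≡.refl
  ...     | false = ≡.refl

module _ {n : ℕ} {G : Graph n} where

  Reach-start : ∀ {X u w} → Reach G X u w → u ∈ X
  Reach-start (here m)     = m
  Reach-start (step m _ _) = m

  Reach-trans : ∀ {X u w x} → Reach G X u w → Reach G X w x → Reach G X u x
  Reach-trans (here _)     q = q
  Reach-trans (step m g p) q = step m g (Reach-trans p q)

  Reach-sym : (∀ i j → G i j ≡ G j i) → ∀ {X u w} → Reach G X u w → Reach G X w u
  Reach-sym G-sym (here m) = here m
  Reach-sym G-sym (step {u} {w} m g p) =
    Reach-trans (Reach-sym G-sym p) (step (Reach-start p) (≡.trans (G-sym w u) g) (here m))

  Reach-mono : ∀ {X Y} → X ⊆ Y → ∀ {u w} → Reach G X u w → Reach G Y u w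
  Reach-mono s (here m)     = here (s m)
  Reach-mono s (step m g p) = step (s m) g (Reach-mono s p)

  -- `m` is fuel: every round adds a vertex, so the invariant n ≤ |X| + m ends the growth before the
  -- fuel can run out.
  component-grow : (∀ i j → G i j ≡ G j i) → ∀ (A : Subset n) u m X → n ℕ.≤ ∣ X ∣ ℕ.+ m → u ∈ X →
    (∀ x → x ∈ X → x ∉ A) → (∀ x → x ∈ X → Reach G X u x) → ∃ λ Y → IsComponent G A Y × u ∈ Y
  component-grow G-sym A u m X le u∈X off conn
    with Finₚ.any? (λ x → Finₚ.any? (λ w → (x ∈? X) ×-dec
        ((¬? (w ∈? A)) ×-dec ((¬? (w ∈? X)) ×-dec (G x w Bool.≟ true)))))
  ... | no none = X , ((u , u∈X) , off , (λ a b a∈ b∈ → Reach-trans (Reach-sym G-sym (conn a a∈)) (conn b b∈)) ,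
      closed) , u∈X
    where
    closed : ∀ x w → x ∈ X → w ∉ A → G x w ≡ true → w ∈ X
    closed x w x∈ w∉A g with w ∈? X
    ... | yes p = p
    ... | no ¬p = ⊥-elim (none (x , w , x∈ , w∉A , ¬p , g))
  ... | yes (x , w , x∈ , w∉A , w∉X , g) = continue m le
    where
    X′ = X ∪ ⁅ w ⁆
    w∈X′ : w ∈ X′
    w∈X′ = q⊆p∪q X ⁅ w ⁆ (x∈⁅x⁆ w)
    bigger : ∣ X ∣ ℕ.< ∣ X′ ∣
    bigger = p⊂q⇒∣p∣<∣q∣ (p⊆p∪q ⁅ w ⁆ , w , w∈X′ , w∉X)
    off′ : ∀ y → y ∈ X′ → y ∉ A
    off′ y y∈ with x∈p∪q⁻ X ⁅ w ⁆ y∈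
    ... | inj₁ p = off y p
    ... | inj₂ p = λ y∈A → w∉A (≡.subst (_∈ A) (x∈⁅y⁆⇒x≡y w p) y∈A)
    conn′ : ∀ y → y ∈ X′ → Reach G X′ u y
    conn′ y y∈ with x∈p∪q⁻ X ⁅ w ⁆ y∈
    ... | inj₁ p = Reach-mono (p⊆p∪q ⁅ w ⁆) (conn y p)
    ... | inj₂ p = ≡.subst (Reach G X′ u) (≡.sym (x∈⁅y⁆⇒x≡y w p))
                     (Reach-trans (Reach-mono (p⊆p∪q ⁅ w ⁆) (conn x x∈)) (step (p⊆p∪q ⁅ w ⁆ x∈) g (here w∈X′)))
    continue : ∀ m → n ℕ.≤ ∣ X ∣ ℕ.+ m → ∃ λ Y → IsComponent G A Y × u ∈ Y
    continue zero    le = ⊥-elim (ℕₚ.<-irrefl ≡.refl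
        (ℕₚ.≤-trans bigger (ℕₚ.≤-trans (∣p∣≤n X′) (≡.subst (n ℕ.≤_) (ℕₚ.+-identityʳ _) le))))
    continue (suc m) le = component-grow G-sym A u m X′
      (ℕₚ.≤-trans le (ℕₚ.≤-trans (ℕₚ.≤-reflexive (ℕₚ.+-suc ∣ X ∣ m)) (ℕₚ.+-monoˡ-≤ m bigger)))
          (p⊆p∪q ⁅ w ⁆ u∈X) off′ conn′

  component : (∀ i j → G i j ≡ G j i) → ∀ (A : Subset n) u → u ∉ A → ∃ λ Y → IsComponent G A Y × u ∈ Y
  component G-sym A u u∉A = component-grow G-sym A u n ⁅ u ⁆ (ℕₚ.m≤n+m n _) (x∈⁅x⁆ u)
    (λ x m → ≡.subst (_∉ A) (≡.sym (x∈⁅y⁆⇒x≡y u m)) u∉A)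
    (λ x m → ≡.subst (Reach G ⁅ u ⁆ u) (≡.sym (x∈⁅y⁆⇒x≡y u m)) (here (x∈⁅x⁆ u)))

  component-⊆ : ∀ {A X Y w} → IsComponent G A X → IsComponent G A Y → w ∈ X → w ∈ Y → ∀ x → x ∈ X → x ∈ Y
  component-⊆ {A} {X} {Y} (_ , off , conn , _) (_ , _ , _ , closed) w∈X w∈Y x x∈X = follow (conn _ x w∈X x∈X) w∈Y
    where
    follow : ∀ {a b} → Reach G X a b → a ∈ Y → b ∈ Y
    follow (here _)               a∈Y = a∈Y
    follow (step {a} {b} _ g p) a∈Y = follow p (closed a b a∈Y (off b (Reach-start p)) g)

-- From S_θ(G) to G, to G∖A, and to its components.

module Decomposition {n : ℕ} {G : Graph n} (G-sym : ∀ i j → G i j ≡ G j i) (G-irr : ∀ i → G i i ≡ false)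
  {v vS : Subset n → ℕ} (laws : MultiplicityLaws G v) (A : Subset n) (lawsS : MultiplicityLaws (SGraph G A) vS)
  (agree : ∀ Y → (∀ i j → i ∈ Y → j ∈ Y → SGraph G A i j ≡ G i j) → vS Y ≡ v Y)
  (special : Stability.AllSpecial laws A ⊤)
  (A-complete : ∀ a → suc (v (⊤ - a)) ≢ v ⊤ → ∀ d → G a d ≡ true → suc (v (⊤ - d)) ≡ v ⊤ → a ∈ A)
  where
  open MultiplicityLaws laws
  open Stability laws
  open import Data.Nat using (_≤_)
  open ℕₚ using (≤-trans; ≤-reflexive; ≤-refl; ≤-antisym; ≤-pred; n≤1+n)
  module LS = MultiplicityLaws lawsS

  -- For a in Y ∩ A, positivity gives a neighbour z essential in Y∖a. The sets Y∖a and Y∖a∖z contain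
  -- fewer vertices of A, so by induction z is essential in Y∖a for S_θ(G) too; the edge az
  -- persists, hence a is positive there, and the two multiplicities of Y agree.
  vS≡v : ∀ m Y → ∣ Y ∩ A ∣ ≤ m → Full A Y → vS Y ≡ v Y
  vS≡v m Y le full with nonempty? (Y ∩ A)
  ... | no none = agree Y λ i j i∈ j∈ → SGraph-off G A G-irr (λ i∈A → none (i , x∈p∩q⁺ (i∈ , i∈A)))
      (λ j∈A → none (j , x∈p∩q⁺ (j∈ , j∈A)))
  vS≡v zero Y le full | yes (a , m∈) = ⊥-elim (ℕₚ.n≮0 (≡.subst (_≤ 0) (card-remove m∈) le))
  vS≡v (suc m) Y le full | yes (a , m∈) with x∈p∩q⁻ Y A m∈
  ... | a∈Y , a∈A with Full-unstep A a∈A a∈Y full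
  ...   | pos , full-a with positive⇒nbr Y a a∈Y pos
  ...     | z , z∈ , az , es with x∈p-y⁻ Y a z∈
  ...       | z∈Y , z≢a = ℕₚ.suc-injective (≡.trans
      (LS.nbr⇒positive Y a z (z≢a ∘ ≡.sym) a∈Y z∈Y (SGraph-⊇ G A (z≢a ∘ ≡.sym) az)
          (≡.trans (≡.cong suc eq-az) (≡.trans es (≡.sym eq-a))))
      (≡.trans eq-a pos))
    where
    le′ : ∣ (Y - a) ∩ A ∣ ≤ m
    le′ = ≤-pred (≡.subst (_≤ suc m) (card-∩ A a∈A a∈Y) le)
    -- By `full-a` the vertices of A in Y∖a are positive there, and z is essential.
    z∉A : z ∉ A
    z∉A z∈A = ℕₚ.<-irrefl ≡.refl (≤-trans (≤-reflexive
        (≡.trans (≡.cong suc (≡.sym (proj₁ (Full-unstep A z∈A z∈ full-a)))) es)) (n≤1+n _))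
    eq-a : vS (Y - a) ≡ v (Y - a)
    eq-a = vS≡v m (Y - a) le′ full-a
    eq-az : vS (Y - a - z) ≡ v (Y - a - z)
    eq-az = vS≡v m (Y - a - z) (≡.subst (λ Z → ∣ Z ∣ ≤ m) (≡.sym (∩-minus-∉ (Y - a) A z z∉A)) le′)
        (Full-essential A z∉A z∈ es full-a)

  V : Subset n
  V = ⊤

  k : ℕ
  k = v V

  c : ℕ
  c = ∣ V ∩ A ∣

  ∈V- : ∀ {u w} → w ≢ u → w ∈ V - u
  ∈V- = x∈p∧x≢y⇒x∈p-y ∈⊤

  Full-V : Full A V
  Full-V = AllSpecial⇒Full A _ V ≤-refl special

  Full-V- : ∀ w → Full A (V - w)
  Full-V- w = AllSpecial⇒Full-minus A _ V w ≤-refl ∈⊤ special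

  Full-V-- : ∀ u w → u ≢ w → v (V - u) ≡ suc k → Full A (V - u - w)
  Full-V-- u w u≢w pos = AllSpecial⇒Full-minus A _ (V - u) w ≤-refl (∈V- (u≢w ∘ ≡.sym))
      (AllSpecial-positive special ∈⊤ pos)

  plus2 : ∀ m → m ℕ.+ 2 ≡ suc (suc m)
  plus2 m = ℕₚ.+-comm m 2

  halfway : ∀ {l m p} → m ≡ l ℕ.+ 2 → m ≤ suc p → p ≤ suc l → p ≡ suc l
  halfway {l} e a b = ≤-antisym b (≤-pred (≤-trans (≤-reflexive (≡.trans (≡.sym (plus2 l)) (≡.sym e))) a))

  module _ {u w : Fin n} (u≢w : u ≢ w) where

    D2⇒positive : v (V - u - w) ≡ k ℕ.+ 2 → v (V - u) ≡ suc k
    D2⇒positive e = halfway e (upper (V - u) w (∈V- (u≢w ∘ ≡.sym))) (upper V u ∈⊤)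

    -- `Full` for V∖u∖w is available only once u is known to be positive in G. That is obtained
    -- first, from the gain of two in S_θ(G) and the agreement on V∖u.
    D2S⇒D2 : vS (V - u - w) ≡ vS V ℕ.+ 2 → v (V - u - w) ≡ k ℕ.+ 2
    D2S⇒D2 e = ≡.trans (≡.sym (vS≡v _ (V - u - w) ≤-refl (Full-V-- u w u≢w pos))) (≡.trans e (≡.cong (ℕ._+ 2) eqV))
      where
      eqV = vS≡v _ V ≤-refl Full-V
      pos : v (V - u) ≡ suc k
      pos = ≡.trans (≡.sym (vS≡v _ (V - u) ≤-refl (Full-V- u)))
        (≡.trans (halfway e (LS.upper (V - u) w (∈V- (u≢w ∘ ≡.sym))) (LS.upper V u ∈⊤)) (≡.cong suc eqV))

    D2⇒D2S : v (V - u - w) ≡ k ℕ.+ 2 → vS (V - u - w) ≡ vS V ℕ.+ 2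
    D2⇒D2S e = ≡.trans (vS≡v _ (V - u - w) ≤-refl (Full-V-- u w u≢w (D2⇒positive e)))
      (≡.trans e (≡.cong (ℕ._+ 2) (≡.sym (vS≡v _ V ≤-refl Full-V))))

  B : Subset n
  B = V ─ A

  v-B : v B ≡ k ℕ.+ c
  v-B = Full-V

  B-minus : ∀ Y u → (Y - u) ─ A ≡ (Y ─ A) - u
  B-minus Y u = p─q─r≡p─r─q Y ⁅ u ⁆ A

  v-B- : ∀ u → u ∉ A → v (B - u) ≡ v (V - u) ℕ.+ c
  v-B- u u∉A = ≡.trans (≡.cong v (≡.sym (B-minus V u)))
      (≡.trans (Full-V- u) (≡.cong (λ Z → v (V - u) ℕ.+ ∣ Z ∣) (∩-minus-∉ V A u u∉A)))

  module _ {u w : Fin n} (u≢w : u ≢ w) (u∉A : u ∉ A) (w∉A : w ∉ A) where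
    private
      B-- : (V - u - w) ─ A ≡ B - u - w
      B-- = ≡.trans (B-minus (V - u) w) (≡.cong (_- w) (B-minus V u))
      ∩-- : ∣ (V - u - w) ∩ A ∣ ≡ c
      ∩-- = ≡.cong ∣_∣ (≡.trans (∩-minus-∉ (V - u) A w w∉A) (∩-minus-∉ V A u u∉A))
      shuffle : k ℕ.+ 2 ℕ.+ c ≡ v B ℕ.+ 2
      shuffle = ≡.trans (ℕₚ.+-assoc k 2 c) (≡.trans (≡.cong (k ℕ.+_) (ℕₚ.+-comm 2 c))
          (≡.trans (≡.sym (ℕₚ.+-assoc k c 2)) (≡.cong (ℕ._+ 2) (≡.sym v-B))))

    D2⇒D2B : v (V - u - w) ≡ k ℕ.+ 2 → v (B - u - w) ≡ v B ℕ.+ 2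
    D2⇒D2B e = ≡.trans (≡.cong v (≡.sym B--)) (≡.trans (Full-V-- u w u≢w (D2⇒positive u≢w e))
      (≡.trans (≡.cong₂ ℕ._+_ e ∩--) shuffle))

    -- Positivity of u is not yet known here, so `Full` is replaced by the inequality `v-─-upper`;
    -- interlacing bounds the other side.
    D2B⇒D2 : v (B - u - w) ≡ v B ℕ.+ 2 → v (V - u - w) ≡ k ℕ.+ 2
    D2B⇒D2 e = ≤-antisym
      (≤-trans (upper (V - u) w (∈V- (u≢w ∘ ≡.sym))) (≤-trans (s≤s (upper V u ∈⊤)) (≤-reflexive (≡.sym (plus2 k)))))
      (ℕₚ.+-cancelʳ-≤ c _ _ (≤-trans (≤-reflexive (≡.trans shuffle (≡.sym e)))
        (≤-trans (≤-reflexive (≡.cong v (≡.sym B--)))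
            (≤-trans (v-─-upper A _ (V - u - w) ≤-refl) (≤-reflexive (≡.cong (v (V - u - w) ℕ.+_) ∩--))))))

  module _ {X : Subset n} (comp : IsComponent G A X) where
    private
      off = proj₁ (proj₂ comp)
      conn = proj₁ (proj₂ (proj₂ comp))
      closed = proj₂ (proj₂ (proj₂ comp))

      X⊆B : ∀ x → x ∈ X → x ∈ B
      X⊆B x x∈X = x∈p∧x∉q⇒x∈p─q ∈⊤ (off x x∈X)

      separates : Separates G X B
      separates i j i∈B j∈B i∈X g = closed i j i∈X (proj₂ (x∈p─q⁻ V A j∈B)) g

      B∩X : B ∩ X ≡ X
      B∩X = ⊆-ext (λ x m → proj₂ (x∈p∩q⁻ B X m)) (λ x m → x∈p∩q⁺ (X⊆B x m , m))

      B-∩X : ∀ u → (B - u) ∩ X ≡ X - u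
      B-∩X u = ≡.trans (∩-minus B X u) (≡.cong (_- u) B∩X)

    v-split : v B ≡ v X ℕ.+ v (B ─ X)
    v-split = ≡.trans (product X B separates) (≡.cong (λ Z → v Z ℕ.+ v (B ─ X)) B∩X)

    v-split-in : ∀ {u} → u ∈ X → v (B - u) ≡ v (X - u) ℕ.+ v (B ─ X)
    v-split-in {u} u∈X = ≡.trans (product X (B - u) (Separates-minus u separates))
      (≡.cong₂ (λ P Q → v P ℕ.+ v Q) (B-∩X u) (─-minus-∈ B X u u∈X))

    v-split-out : ∀ {w} → w ∉ X → v (B - w) ≡ v X ℕ.+ v ((B ─ X) - w)
    v-split-out {w} w∉X = ≡.trans (product X (B - w) (Separates-minus w separates))
      (≡.cong₂ (λ P Q → v P ℕ.+ v Q) (≡.trans (∩-minus-∉ B X w w∉X) B∩X) (p─q─r≡p─r─q B ⁅ w ⁆ X))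

    v-split-in-in : ∀ {u w} → u ∈ X → w ∈ X → v (B - u - w) ≡ v (X - u - w) ℕ.+ v (B ─ X)
    v-split-in-in {u} {w} u∈X w∈X = ≡.trans (product X (B - u - w) (Separates-minus w (Separates-minus u separates)))
      (≡.cong₂ (λ P Q → v P ℕ.+ v Q) (≡.trans (∩-minus (B - u) X w) (≡.cong (_- w) (B-∩X u)))
        (≡.trans (─-minus-∈ (B - u) X w w∈X) (─-minus-∈ B X u u∈X)))

    v-split-in-out : ∀ {u w} → u ∈ X → w ∉ X → v (B - u - w) ≡ v (X - u) ℕ.+ v ((B ─ X) - w)
    v-split-in-out {u} {w} u∈X w∉X = ≡.trans (product X (B - u - w) (Separates-minus w (Separates-minus u separates)))
      (≡.cong₂ (λ P Q → v P ℕ.+ v Q) (≡.trans (∩-minus-∉ (B - u) X w w∉X) (B-∩X u))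
        (≡.trans (p─q─r≡p─r─q (B - u) ⁅ w ⁆ X) (≡.cong (_- w) (─-minus-∈ B X u u∈X))))

    private
      rest = v (B ─ X)

      swap-last : ∀ a b → a ℕ.+ 2 ℕ.+ b ≡ a ℕ.+ b ℕ.+ 2
      swap-last a b = ≡.trans (ℕₚ.+-assoc a 2 b)
          (≡.trans (≡.cong (a ℕ.+_) (ℕₚ.+-comm 2 b)) (≡.sym (ℕₚ.+-assoc a b 2)))

    D2X⇒D2B : ∀ {u w} → u ∈ X → w ∈ X → v (X - u - w) ≡ v X ℕ.+ 2 → v (B - u - w) ≡ v B ℕ.+ 2
    D2X⇒D2B u∈X w∈X e = ≡.trans (v-split-in-in u∈X w∈X) (≡.trans (≡.cong (ℕ._+ rest) e)
      (≡.trans (swap-last (v X) rest) (≡.cong (ℕ._+ 2) (≡.sym v-split))))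

    D2B⇒D2X : ∀ {u w} → u ∈ X → w ∈ X → v (B - u - w) ≡ v B ℕ.+ 2 → v (X - u - w) ≡ v X ℕ.+ 2
    D2B⇒D2X u∈X w∈X e = ℕₚ.+-cancelʳ-≡ rest _ _ (≡.trans (≡.sym (v-split-in-in u∈X w∈X)) (≡.trans e
      (≡.trans (≡.cong (ℕ._+ 2) v-split) (≡.sym (swap-last (v X) rest)))))

    positive-B : ∀ {u} → u ∉ A → v (V - u) ≡ suc k → v (B - u) ≡ suc (v B)
    positive-B u∉A pos = ≡.trans (v-B- _ u∉A) (≡.trans (≡.cong (ℕ._+ c) pos) (≡.cong suc (≡.sym v-B)))

    -- Multiplicity adds over X and the rest of B, and each of the two parts gains one.
    positive-apart⇒D2B : ∀ {u w} → u ∈ X → w ∉ X → w ∉ A → v (V - u) ≡ suc k → v (V - w) ≡ suc k →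
        v (B - u - w) ≡ v B ℕ.+ 2
    positive-apart⇒D2B {u} {w} u∈X w∉X w∉A pu pw = ≡.trans (v-split-in-out u∈X w∉X) (≡.trans (≡.cong₂ ℕ._+_ eu ew)
      (≡.trans (≡.cong suc (ℕₚ.+-suc (v X) rest))
          (≡.trans (≡.cong (λ m → suc (suc m)) (≡.sym v-split)) (≡.sym (plus2 (v B))))))
      where
      eu : v (X - u) ≡ suc (v X)
      eu = ℕₚ.+-cancelʳ-≡ rest _ _ (≡.trans (≡.sym (v-split-in u∈X))
          (≡.trans (positive-B (off u u∈X) pu) (≡.cong suc v-split)))
      ew : v ((B ─ X) - w) ≡ suc rest
      ew = ℕₚ.+-cancelˡ-≡ (v X) _ _ (≡.trans (≡.sym (v-split-out w∉X))
          (≡.trans (positive-B w∉A pw) (≡.trans (≡.cong suc v-split) (≡.sym (ℕₚ.+-suc (v X) rest)))))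

    -- A neighbour of an essential vertex that is not essential itself would be special and so lie
    -- in A, which the component avoids.
    essential-spreads : ∀ {z u} → Reach G X z u → suc (v (V - z)) ≡ k → suc (v (V - u)) ≡ k
    essential-spreads (here _) es = es
    essential-spreads (step {z} {w} _ g p) es with suc (v (V - w)) ℕ.≟ k
    ... | yes q = essential-spreads p q
    ... | no ¬q = ⊥-elim (off w (Reach-start p) (A-complete w ¬q z (≡.trans (G-sym w z) g) es))

    positive⇒zero : ∀ {u} → u ∈ X → v (V - u) ≡ suc k → v X ≡ 0
    positive⇒zero {u} u∈X pos with v X ℕ.≟ 0
    ... | yes p = p
    ... | no ¬p with has-essential X ¬p
    ...   | z , z∈X , es = ⊥-elim (ℕₚ.<-irrefl ≡.refl
        (≤-trans (≤-trans (n≤1+n _) (≤-reflexive (≡.cong suc (≡.sym pos))))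
                             (≤-reflexive (essential-spreads (conn z u z∈X u∈X) es-V))))
      where
      -- Passing from X to B adds `rest`, and from B to G subtracts `c`, both before and after
      -- deleting z; so z is essential in G as well.
      es-V : suc (v (V - z)) ≡ k
      es-V = ℕₚ.+-cancelʳ-≡ c _ _ (≡.trans (≡.cong suc (≡.sym (v-B- z (off z z∈X))))
          (≡.trans (≡.cong suc (v-split-in z∈X))
        (≡.trans (≡.cong (ℕ._+ rest) es) (≡.trans (≡.sym v-split) v-B))))

  module _ {u w : Fin n} (u≢w : u ≢ w) where

    D2-special : u ∈ A → v (V - u - w) ≡ suc (v (V - w))
    D2-special u∈A = ≡.trans (v-swap V u w) (stability ∈⊤ (special u u∈A ∈⊤) ∈⊤ (u≢w ∘ ≡.sym))

    special-positive⇒D2 : u ∈ A → v (V - w) ≡ suc k → v (V - u - w) ≡ k ℕ.+ 2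
    special-positive⇒D2 u∈A pos = ≡.trans (D2-special u∈A) (≡.trans (≡.cong suc pos) (≡.sym (plus2 k)))

  D2-swap : ∀ {u w} → v (V - u - w) ≡ k ℕ.+ 2 → v (V - w - u) ≡ k ℕ.+ 2
  D2-swap {u} {w} e = ≡.trans (v-swap V w u) e

  special-positive : ∀ {u} → u ∈ A → v (V - u) ≡ suc k
  special-positive {u} u∈A = special⇒positive ∈⊤ (special u u∈A ∈⊤)

  Pos : Fin n → Set
  Pos u = v (V - u) ≡ suc k × u ∉ A

  ZeroComp : Subset n → Set
  ZeroComp X = IsComponent G A X × v X ≡ 0

  Cases : Fin n → Fin n → Set
  Cases u w = (u ∈ A × w ∈ A)
            ⊎ ((u ∈ A × Pos w) ⊎ (Pos u × w ∈ A))
            ⊎ (Pos u × Pos w × ∃ λ X → ∃ λ Y → ZeroComp X × ZeroComp Y × u ∈ X × w ∈ Y × X ≢ Y)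
            ⊎ (∃ λ X → ZeroComp X × u ∈ X × w ∈ X × v (X - u - w) ≡ v X ℕ.+ 2)

  D2⇒Cases : ∀ {u w} → u ≢ w → v (V - u - w) ≡ k ℕ.+ 2 → Cases u w
  D2⇒Cases {u} {w} u≢w e with u ∈? A | w ∈? A
  ... | yes p | yes q = inj₁ (p , q)
  ... | yes p | no  q = inj₂ (inj₁ (inj₁ (p , D2⇒positive (u≢w ∘ ≡.sym) (D2-swap e) , q)))
  ... | no  p | yes q = inj₂ (inj₁ (inj₂ ((D2⇒positive u≢w e , p) , q)))
  ... | no  p | no  q with component G-sym A u p
  ...   | X , compX , u∈X with w ∈? X
  ...     | yes w∈X = inj₂ (inj₂ (inj₂ (X , (compX , positive⇒zero compX u∈X (D2⇒positive u≢w e)) , u∈X , w∈X ,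
                        D2B⇒D2X compX u∈X w∈X (D2⇒D2B u≢w p q e))))
  ...     | no  w∉X with component G-sym A w q
  ...       | Y , compY , w∈Y = inj₂ (inj₂ (inj₁ ((pu , p) , (pw , q) , X , Y ,
                (compX , positive⇒zero compX u∈X pu) , (compY , positive⇒zero compY w∈Y pw) , u∈X , w∈Y ,
                    λ { ≡.refl → w∉X w∈Y })))
    where
    pu = D2⇒positive u≢w e
    pw = D2⇒positive (u≢w ∘ ≡.sym) (D2-swap e)

  Cases⇒D2 : ∀ {u w} → u ≢ w → Cases u w → v (V - u - w) ≡ k ℕ.+ 2
  Cases⇒D2 u≢w (inj₁ (p , q))                     = special-positive⇒D2 u≢w p (special-positive q)
  Cases⇒D2 u≢w (inj₂ (inj₁ (inj₁ (p , pos , _)))) = special-positive⇒D2 u≢w p pos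
  Cases⇒D2 u≢w (inj₂ (inj₁ (inj₂ ((pos , _) , q)))) = D2-swap (special-positive⇒D2 (u≢w ∘ ≡.sym) q pos)
  Cases⇒D2 u≢w (inj₂ (inj₂ (inj₁ ((pu , u∉A) , (pw , w∉A) , X , Y , (compX , _) , (compY , _) , u∈X , w∈Y , X≢Y)))) =
    D2B⇒D2 u≢w u∉A w∉A (positive-apart⇒D2B compX u∈X w∉X w∉A pu pw)
    where
    -- Two components that share a vertex are equal.
    w∉X : _ ∉ X
    w∉X w∈X = X≢Y (⊆-ext (component-⊆ compX compY w∈X w∈Y) (component-⊆ compY compX w∈Y w∈X))
  Cases⇒D2 u≢w (inj₂ (inj₂ (inj₂ (X , (compX , _) , u∈X , w∈X , e)))) =
    D2B⇒D2 u≢w (off _ u∈X) (off _ w∈X) (D2X⇒D2B compX u∈X w∈X e)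
    where off = proj₁ (proj₂ compX)

  D2S⇒Cases : ∀ {u w} → u ≢ w → vS (V - u - w) ≡ vS V ℕ.+ 2 → Cases u w
  D2S⇒Cases u≢w e = D2⇒Cases u≢w (D2S⇒D2 u≢w e)

  Cases⇒D2S : ∀ {u w} → u ≢ w → Cases u w → vS (V - u - w) ≡ vS V ℕ.+ 2
  Cases⇒D2S u≢w cs = D2⇒D2S u≢w (Cases⇒D2 u≢w cs)

-- Multiplicity of roots as order of vanishing, and the final translation.

module Multiplicity {ℓ : Level} (R : RealField ℓ) (θ : RealField.Carrier R) {n : ℕ} (G : Graph n)
    (G-sym : ∀ i j → G i j ≡ G j i) where
  open Matching R using (MultIs; μ)
  open Order R using (Mult⇒IsOrd; IsOrd⇒Mult; IsOrd-unique; IsOrd-resp)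
  open Series (RealField.commutativeRing R) using (serRing)
  open CommutativeRing serRing using (sym)
  open Valuation R θ G G-sym public using (v; v-ord)
  open Link R θ using (T-μ)

  mult : ∀ X → MultIs θ G X (v X)
  mult X = IsOrd⇒Mult θ (μ G X) (IsOrd-resp (sym (T-μ G X)) (v-ord X))

  mult-unique : ∀ X {m} → MultIs θ G X m → m ≡ v X
  mult-unique X p = IsOrd-unique (IsOrd-resp (T-μ G X) (Mult⇒IsOrd θ (μ G X) p)) (v-ord X)

  laws : MultiplicityLaws G v
  laws = record
    { lower = v-lower
    ; upper = v-upper
    ; positive⇒nbr = positive⇒essential-nbr
    ; nbr⇒positive = essential-nbr⇒positive
    ; not-neutral = essential-nbr⇒not-neutral
    ; exchange = exchange
    ; has-essential = has-essential
    ; product = v-product }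
    where
    open Valuation R θ G G-sym
    open Structure R θ G G-sym

theorem5p13 : ∀ {ℓ : Level} (R : RealField ℓ) (θ : RealField.Carrier R)
    {n : ℕ} (G : Graph n) → SimpleGraph G →
    (A : Subset n) →
    (∀ u → (u ∈ A → Matching.Special R θ G u) × (Matching.Special R θ G u → u ∈ A)) →
    (u v : Fin n) → u ≢ v →
    let P = Matching.PosNotSpecial R θ G A
        Z = Matching.ZeroComponent R θ G A
        lhs = Matching.D2Edge R θ (SGraph G A) ⊤ u v
        rhs = (u ∈ A × v ∈ A)
              ⊎ ((u ∈ A × P v) ⊎ (P u × v ∈ A))
              ⊎ (P u × P v × ∃ λ X → ∃ λ Y → Z X × Z Y × u ∈ X × v ∈ Y × X ≢ Y)
              ⊎ (∃ λ X → Z X × Matching.D2Edge R θ G X u v)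
    in (lhs → rhs) × (rhs → lhs)
theorem5p13 {ℓ} R θ {n} G (G-sym , G-irr) A A-spec u w u≢w = forward , backward
  where
  open Matching R using (MultIs; Essential; Positive; PosNotSpecial; ZeroComponent; D2Edge)
  module MG = Multiplicity R θ G G-sym
  module MS = Multiplicity R θ (SGraph G A) (SGraph-sym G A G-sym)
  open MG using (v)

  essential⁻ : ∀ {z} → Essential θ G z → suc (v (⊤ - z)) ≡ v ⊤
  essential⁻ {z} (a , b , p , q , e) = ≡.trans (≡.cong suc (≡.sym (MG.mult-unique (⊤ - z) q)))
      (≡.trans e (MG.mult-unique ⊤ p))

  essential⁺ : ∀ {z} → suc (v (⊤ - z)) ≡ v ⊤ → Essential θ G z
  essential⁺ {z} e = v ⊤ , v (⊤ - z) , MG.mult ⊤ , MG.mult (⊤ - z) , e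

  positive⁻ : ∀ {z} → Positive θ G z → v (⊤ - z) ≡ suc (v ⊤)
  positive⁻ {z} (a , b , p , q , e) = ≡.trans (≡.sym (MG.mult-unique (⊤ - z) q))
      (≡.trans e (≡.cong suc (MG.mult-unique ⊤ p)))

  positive⁺ : ∀ {z} → v (⊤ - z) ≡ suc (v ⊤) → Positive θ G z
  positive⁺ {z} e = v ⊤ , v (⊤ - z) , MG.mult ⊤ , MG.mult (⊤ - z) , e

  -- The matching sum of Y depends only on adjacency inside Y.
  agree : ∀ Y → (∀ i j → i ∈ Y → j ∈ Y → SGraph G A i j ≡ G i j) → MS.v Y ≡ v Y
  agree Y eq = IsOrd-unique (IsOrd-resp (Φ-cong (allPairs n) Y eq (λ _ _ → CommutativeRing.refl serRing))
      (MS.v-ord Y)) (MG.v-ord Y)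
    where
    open Series (RealField.commutativeRing R) using (serRing)
    open MatchingSum serRing using (Φ-cong)
    open Order R using (IsOrd-unique; IsOrd-resp)

  special : Stability.AllSpecial MG.laws A ⊤
  special a a∈A _ = let ne , d , ad , es = proj₁ (A-spec a) a∈A
      in (λ e → ne (essential⁺ e)) , d , ∈⊤ , ad , essential⁻ es

  A-complete : ∀ a → suc (v (⊤ - a)) ≢ v ⊤ → ∀ d → G a d ≡ true → suc (v (⊤ - d)) ≡ v ⊤ → a ∈ A
  A-complete a ne d ad es = proj₂ (A-spec a) ((λ e → ne (essential⁻ e)) , d , ad , essential⁺ es)

  open Decomposition G-sym G-irr MG.laws A MS.laws agree special A-complete using
      (Cases; Pos; ZeroComp; D2S⇒Cases; Cases⇒D2S)

  pos⁺ : ∀ {z} → Pos z → PosNotSpecial θ G A z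
  pos⁺ (p , q) = positive⁺ p , q

  pos⁻ : ∀ {z} → PosNotSpecial θ G A z → Pos z
  pos⁻ (p , q) = positive⁻ p , q

  zero⁺ : ∀ {X} → ZeroComp X → ZeroComponent θ G A X
  zero⁺ {X} (p , q) = p , ≡.subst (MultIs θ G X) q (MG.mult X)

  zero⁻ : ∀ {X} → ZeroComponent θ G A X → ZeroComp X
  zero⁻ {X} (p , q) = p , ≡.sym (MG.mult-unique X q)

  RHS : Set ℓ
  RHS = (u ∈ A × w ∈ A)
              ⊎ ((u ∈ A × PosNotSpecial θ G A w) ⊎ (PosNotSpecial θ G A u × w ∈ A))
              ⊎ (PosNotSpecial θ G A u × PosNotSpecial θ G A w × ∃ λ X → ∃ λ Y →
                  ZeroComponent θ G A X × ZeroComponent θ G A Y × u ∈ X × w ∈ Y × X ≢ Y)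
              ⊎ (∃ λ X → ZeroComponent θ G A X × D2Edge θ G X u w)

  forward : D2Edge θ (SGraph G A) ⊤ u w → RHS
  forward (_ , _ , _ , a , b , p , q , e) =
    from (D2S⇒Cases u≢w (≡.trans (≡.sym (MS.mult-unique (⊤ - u - w) q))
        (≡.trans e (≡.cong (ℕ._+ 2) (MS.mult-unique ⊤ p)))))
    where
    from : Cases u w → RHS
    from (inj₁ c) = inj₁ c
    from (inj₂ (inj₁ (inj₁ (c , d)))) = inj₂ (inj₁ (inj₁ (c , pos⁺ d)))
    from (inj₂ (inj₁ (inj₂ (c , d)))) = inj₂ (inj₁ (inj₂ (pos⁺ c , d)))
    from (inj₂ (inj₂ (inj₁ (c , d , X , Y , zX , zY , rest)))) =
      inj₂ (inj₂ (inj₁ (pos⁺ c , pos⁺ d , X , Y , zero⁺ zX , zero⁺ zY , rest)))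
    from (inj₂ (inj₂ (inj₂ (X , zX , c , d , f)))) =
      inj₂ (inj₂ (inj₂ (X , zero⁺ zX , u≢w , c , d , v X , v (X - u - w) , MG.mult X , MG.mult (X - u - w) , f)))

  backward : RHS → D2Edge θ (SGraph G A) ⊤ u w
  backward r = u≢w , ∈⊤ , ∈⊤ , MS.v ⊤ , MS.v (⊤ - u - w) , MS.mult ⊤ , MS.mult (⊤ - u - w) , Cases⇒D2S u≢w (to r)
    where
    to : RHS → Cases u w
    to (inj₁ c) = inj₁ c
    to (inj₂ (inj₁ (inj₁ (c , d)))) = inj₂ (inj₁ (inj₁ (c , pos⁻ d)))
    to (inj₂ (inj₁ (inj₂ (c , d)))) = inj₂ (inj₁ (inj₂ (pos⁻ c , d)))
    to (inj₂ (inj₂ (inj₁ (c , d , X , Y , zX , zY , rest)))) =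
        inj₂ (inj₂ (inj₁ (pos⁻ c , pos⁻ d , X , Y , zero⁻ zX , zero⁻ zY , rest)))
    to (inj₂ (inj₂ (inj₂ (X , zX , _ , c , d , a , b , p , q , e)))) =
      inj₂ (inj₂ (inj₂ (X , zero⁻ zX , c , d , ≡.trans (≡.sym (MG.mult-unique (X - u - w) q))
          (≡.trans e (≡.cong (ℕ._+ 2) (MG.mult-unique X p))))))
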